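{- For every special $\Pi^0_1$ sets $P,Q\subseteq2^{\mathbb N}$ there exists a $\Pi^0_1$ set $\widehat P\subseteq2^{\mathbb N}$ such that $Q\not\le^{<\omega}_\omega\widehat P$ and $\widehat P$ is $(\omega,1)$-equivalent to $P$.
   Context: A set is special if it is nonempty and contains no computable element. Let $\{\Phi_e\}_{e\in\mathbb N}$ be an effective enumeration of all partial computable functions $\Phi_e:\subseteq\mathbb N^{\mathbb N}\to\mathbb N^{\mathbb N}$. A learner is a total computable function $\Psi:\mathbb N^{<\mathbb N}\to\mathbb N$; let $\{\Psi_e\}_{e\in\mathbb N}$ be an effective enumeration of all learners. A partial function $\Gamma:\subseteq\mathbb N^{\mathbb N}\to\mathbb N^{\mathbb N}$ is identified by $\Psi$ on $g$ if $\lim_n\Psi(g\upharpoonright n)$ exists and $\Phi_{\lim_n\Psi(g\upharpoonright n)}(g)=\Gamma(g)$. $\Gamma$ is $(<\omega,\omega)$-computable if there is $b\in\mathbb N$ such that for every $g\in\mathrm{dom}(\Gamma)$, $\Gamma$ is identified by $\Psi_e$ on $g$ for some $e<b$. $\Gamma$ is $(\omega,1)$-computable if $\Gamma(g)\le_Tg$ for every $g\in\mathrm{dom}(\Gamma)$. For $A,B\subseteq\mathbb N^{\mathbb N}$, $A\le^\alpha_\beta B$ means there is an $(\alpha,\beta)$-computable $\Gamma$ with $B\subseteq\mathrm{dom}(\Gamma)$ and $\Gamma(g)\in A$ for every $g\in B$ (so $\le^\omega_1$ is Muchnik reducibility). $A$ and $B$ are $(\omega,1)$-equivalent if $A\le^\omega_1B$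 and $B\le^\omega_1A$. -}

module Defs where

open import Data.Bool.Base using (Bool; true; if_then_else_)
open import Data.Fin.Base using (Fin; toℕ; fromℕ<)
open import Data.Fin.Properties using (toℕ<n; fromℕ<-toℕ)
open import Data.List.Base using (List; []; _∷_; _++_; applyUpTo)
open import Data.Nat.Base
open import Data.Nat.Properties
open import Data.Product.Base using (Σ-syntax; ∃; ∃-syntax; _×_; _,_; proj₁; proj₂)
open import Data.Vec.Base using (Vec; lookup)
import Data.Vec.Base as Vec
open import Function.Bundles using (_⇔_)
open import Level using (0ℓ)
open import Relation.Binary.PropositionalEquality
open import Relation.Nullary using (¬_; yes; no; contradiction)
open import Relation.Unary using (Pred; _∈_; _⊆_; Satisfiable)

Baire : Set
Baire = ℕ → ℕ

2^ℕ : Pred Baire 0ℓ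
2^ℕ g = ∀ n → g n < 2

_↾_ : Baire → ℕ → List ℕ
g ↾ n = applyUpTo g n

-- The Cantor pairing: ⟨ x , y ⟩ = (x + y)(x + y + 1)/2 + y.

triangle : ℕ → ℕ
triangle zero    = zero
triangle (suc n) = suc n + triangle n

⟨_,_⟩ : ℕ → ℕ → ℕ
⟨ x , y ⟩ = triangle (x + y) + y

next : ℕ × ℕ → ℕ × ℕ
next (zero  , y) = suc y , zero
next (suc x , y) = x , suc y

unpair : ℕ → ℕ × ℕ
unpair zero    = zero , zero
unpair (suc n) = next (unpair n)

unpair-⟨,⟩ : ∀ x y → unpair ⟨ x , y ⟩ ≡ (x , y)
unpair-⟨,⟩ x y = go (x + y) x y refl
  where
  go : ∀ s x y → x + y ≡ s → unpair ⟨ x , y ⟩ ≡ (x , y)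
  go s zero zero _ = refl
  go (suc s) (suc x) zero p
    rewrite +-identityʳ (x + 0 + triangle (x + 0)) | +-identityʳ x
          | +-comm x (triangle x) | go s zero x (suc-injective p) = refl
  go s x (suc y) p
    rewrite +-suc (triangle (x + suc y)) y | +-suc x y | go s (suc x) y p = refl

⌜_⌝ : List ℕ → ℕ
⌜ [] ⌝    = zero
⌜ x ∷ σ ⌝ = suc ⟨ x , ⌜ σ ⌝ ⟩

-- Programs for the partial recursive functions of one argument with k
-- function oracles.  Arguments of higher arity are coded by pairing.

data Code (k : ℕ) : Set where
  zer suc fst snd : Code k
  oracle          : Fin k → Code k
  pair comp prec  : Code k → Code k → Code k
  min             : Code k → Code k

-- ⟦ c ⟧ gs x y: with oracles gs and on input x, c halts with output y.

⟦_⟧ : ∀ {k} → Code k → Vec Baire k → ℕ → ℕ → Set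

-- PrecGraph c d gs a n y: the value at n is y, where the value at 0 is
-- c(a) and the value at suc n is d(a, n, value at n).
PrecGraph : ∀ {k} → Code k → Code k → Vec Baire k → ℕ → ℕ → ℕ → Set
PrecGraph c d gs a zero    y = ⟦ c ⟧ gs a y
PrecGraph c d gs a (suc n) y =
  ∃[ z ] PrecGraph c d gs a n z × ⟦ d ⟧ gs ⟨ a , ⟨ n , z ⟩ ⟩ y

⟦ zer ⟧      gs x y = y ≡ zero
⟦ suc ⟧      gs x y = y ≡ suc x
⟦ fst ⟧      gs x y = y ≡ proj₁ (unpair x)
⟦ snd ⟧      gs x y = y ≡ proj₂ (unpair x)
⟦ oracle i ⟧ gs x y = y ≡ lookup gs i x
⟦ pair c d ⟧ gs x y = ∃[ a ] ∃[ b ] ⟦ c ⟧ gs x a × ⟦ d ⟧ gs x b × y ≡ ⟨ a , b ⟩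
⟦ comp c d ⟧ gs x y = ∃[ z ] ⟦ d ⟧ gs x z × ⟦ c ⟧ gs z y
⟦ prec c d ⟧ gs x y = PrecGraph c d gs (proj₁ (unpair x)) (proj₂ (unpair x)) y
⟦ min c ⟧    gs x y =
  ⟦ c ⟧ gs ⟨ x , y ⟩ zero × (∀ m → m < y → ∃[ z ] ⟦ c ⟧ gs ⟨ x , m ⟩ (suc z))

-- A surjective Gödel numbering of programs: decode-encode.

encode : ∀ {k} → Code k → ℕ
encode zer        = ⟨ 0 , 0 ⟩
encode suc        = ⟨ 1 , 0 ⟩
encode fst        = ⟨ 2 , 0 ⟩
encode snd        = ⟨ 3 , 0 ⟩
encode (oracle i) = ⟨ 4 , toℕ i ⟩
encode (pair c d) = ⟨ 5 , ⟨ encode c , encode d ⟩ ⟩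
encode (comp c d) = ⟨ 6 , ⟨ encode c , encode d ⟩ ⟩
encode (prec c d) = ⟨ 7 , ⟨ encode c , encode d ⟩ ⟩
encode (min c)    = ⟨ 8 , encode c ⟩

-- The first argument bounds the recursion depth; any bound ≥ the number
-- being decoded suffices.  Numbers that encode nothing decode to junk.
decodeWithin : ∀ {k} → ℕ → ℕ → Code k
decodeTagged : ∀ {k} → ℕ → ℕ × ℕ → Code k

decodeWithin zero    e = zer
decodeWithin (suc s) e = decodeTagged s (unpair e)

decodeTagged     s (1 , _) = suc
decodeTagged     s (2 , _) = fst
decodeTagged     s (3 , _) = snd
decodeTagged {k} s (4 , i) with i <? k
... | yes i<k = oracle (fromℕ< i<k)
... | no _    = zer
decodeTagged     s (5 , p) = pair (decodeWithin s (proj₁ (unpair p))) (decodeWithin s (proj₂ (unpair p)))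
decodeTagged     s (6 , p) = comp (decodeWithin s (proj₁ (unpair p))) (decodeWithin s (proj₂ (unpair p)))
decodeTagged     s (7 , p) = prec (decodeWithin s (proj₁ (unpair p))) (decodeWithin s (proj₂ (unpair p)))
decodeTagged     s (8 , e) = min (decodeWithin s e)
decodeTagged     s _       = zer

decode : ∀ {k} → ℕ → Code k
decode e = decodeWithin e e

n≤triangle : ∀ n → n ≤ triangle n
n≤triangle zero    = z≤n
n≤triangle (suc n) = m≤m+n (suc n) (triangle n)

x≤⟨x,y⟩ : ∀ x y → x ≤ ⟨ x , y ⟩
x≤⟨x,y⟩ x y = ≤-trans (m≤m+n x y) (≤-trans (n≤triangle (x + y)) (m≤m+n _ y))

y≤⟨x,y⟩ : ∀ x y → y ≤ ⟨ x , y ⟩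
y≤⟨x,y⟩ x y = m≤n+m y (triangle (x + y))

y<⟨1+x,y⟩ : ∀ x y → y < ⟨ suc x , y ⟩
y<⟨1+x,y⟩ x y = +-mono-≤ {1} (≤-trans (s≤s z≤n) (n≤triangle (suc x + y))) ≤-refl

decode-encode : ∀ {k} (c : Code k) → decode (encode c) ≡ c
decode-encode c = within c _ ≤-refl
  where
  within : ∀ {k} (c : Code k) s → encode c ≤ s → decodeWithin s (encode c) ≡ c

  tagged : ∀ {k} t p s → ⟨ suc t , p ⟩ ≤ s →
           ∃[ r ] p ≤ r × decodeWithin {k} s ⟨ suc t , p ⟩ ≡ decodeTagged r (suc t , p)
  tagged t p zero    le = contradiction (≤-trans (x≤⟨x,y⟩ (suc t) p) le) λ ()
  tagged t p (suc s) le =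
    s , ≤-pred (≤-trans (y<⟨1+x,y⟩ t p) le)
      , cong (decodeTagged s) (unpair-⟨,⟩ (suc t) p)

  both : ∀ {k} (c d : Code k) r → ⟨ encode c , encode d ⟩ ≤ r →
         decodeWithin r (proj₁ (unpair ⟨ encode c , encode d ⟩)) ≡ c ×
         decodeWithin r (proj₂ (unpair ⟨ encode c , encode d ⟩)) ≡ d
  both c d r le rewrite unpair-⟨,⟩ (encode c) (encode d) =
    within c r (≤-trans (x≤⟨x,y⟩ _ _) le) ,
    within d r (≤-trans (y≤⟨x,y⟩ (encode c) (encode d)) le)

  within zer zero    _ = refl
  within zer (suc s) _ = refl
  within suc s le with r , _ , eq ← tagged 0 0 s le = eq
  within fst s le with r , _ , eq ← tagged 1 0 s le = eq
  within snd s le with r , _ , eq ← tagged 2 0 s le = eq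
  within {k} (oracle i) s le with r , _ , eq ← tagged {k} 3 (toℕ i) s le =
    trans eq oracle-tag
    where
    oracle-tag : decodeTagged r (4 , toℕ i) ≡ oracle i
    oracle-tag with toℕ i <? k
    ... | yes i<k = cong oracle (fromℕ<-toℕ i i<k)
    ... | no i≮k  = contradiction (toℕ<n i) i≮k
  within (pair c d) s le
    with r , le′ , eq ← tagged 4 ⟨ encode c , encode d ⟩ s le =
    trans eq (cong₂ pair (proj₁ (both c d r le′)) (proj₂ (both c d r le′)))
  within (comp c d) s le
    with r , le′ , eq ← tagged 5 ⟨ encode c , encode d ⟩ s le =
    trans eq (cong₂ comp (proj₁ (both c d r le′)) (proj₂ (both c d r le′)))
  within (prec c d) s le
    with r , le′ , eq ← tagged 6 ⟨ encode c , encode d ⟩ s le =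
    trans eq (cong₂ prec (proj₁ (both c d r le′)) (proj₂ (both c d r le′)))
  within (min c) s le
    with r , le′ , eq ← tagged 7 (encode c) s le =
    trans eq (cong min (within c r le′))

Computable : Baire → Set
Computable f = ∃[ c ] ∀ n → ⟦_⟧ {0} c Vec.[] n (f n)

ComputableOnStrings : (List ℕ → ℕ) → Set
ComputableOnStrings ψ = ∃[ c ] ∀ σ → ⟦_⟧ {0} c Vec.[] ⌜ σ ⌝ (ψ σ)

-- Φ[ e ] g ≃ f: the e-th partial computable functional is defined at g,
-- with value f.
Φ[_]_≃_ : ℕ → Baire → Baire → Set
Φ[ e ] g ≃ f = ∀ n → ⟦ decode e ⟧ (g Vec.∷ Vec.[]) n (f n)

infix 4 _≤ᵀ_
_≤ᵀ_ : Baire → Baire → Set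
f ≤ᵀ g = ∃[ e ] Φ[ e ] g ≃ f

-- Ψ[ e ]≃ ψ: the e-th partial computable function on strings is total and
-- equal to ψ.  The learners are exactly the ψ so indexed; indices of
-- non-total functions index no learner.
Ψ[_]≃_ : ℕ → (List ℕ → ℕ) → Set
Ψ[ e ]≃ ψ = ∀ σ → ⟦ decode {0} e ⟧ Vec.[] ⌜ σ ⌝ (ψ σ)

Converges : (ℕ → ℕ) → ℕ → Set
Converges s i = ∃[ N ] ∀ n → N ≤ n → s n ≡ i

record ComputableTree : Set where
  field
    mem           : List ℕ → Bool
    computable    : ComputableOnStrings (λ σ → if mem σ then 1 else 0)
    prefix-closed : ∀ σ τ → mem (σ ++ τ) ≡ true → mem σ ≡ true

  Path : Pred Baire 0ℓ
  Path g = ∀ n → mem (g ↾ n) ≡ true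

-- For P ⊆ 2^ℕ it is immaterial whether trees of binary strings or of
-- arbitrary strings are used.
IsΠ⁰₁ : Pred Baire 0ℓ → Set
IsΠ⁰₁ P = Σ[ T ∈ ComputableTree ] (∀ g → g ∈ P ⇔ g ∈ ComputableTree.Path T)

Special : Pred Baire 0ℓ → Set
Special P = Satisfiable P × (∀ g → g ∈ P → ¬ Computable g)

-- Equality of points of Baire space is pointwise, and partial functions
-- respect it (which also makes values independent of domain proofs).
record PartialFunction : Set₁ where
  field
    dom        : Pred Baire 0ℓ
    apply      : ∀ g → g ∈ dom → Baire
    dom-resp   : ∀ {g h} → g ≗ h → g ∈ dom → h ∈ dom
    apply-cong : ∀ {g h} → g ≗ h → (p : g ∈ dom) (q : h ∈ dom) → apply g p ≗ apply h q

open PartialFunction public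

IdentifiedOn : (Γ : PartialFunction) → (List ℕ → ℕ) → ∀ g → g ∈ dom Γ → Set
IdentifiedOn Γ ψ g p =
  ∃[ i ] Converges (λ n → ψ (g ↾ n)) i × Φ[ i ] g ≃ apply Γ g p

⟨<ω,ω⟩-computable : PartialFunction → Set
⟨<ω,ω⟩-computable Γ =
  ∃[ b ] ∀ g (p : g ∈ dom Γ) →
    ∃[ e ] e < b × (∃[ ψ ] Ψ[ e ]≃ ψ × IdentifiedOn Γ ψ g p)

⟨ω,1⟩-computable : PartialFunction → Set
⟨ω,1⟩-computable Γ = ∀ g (p : g ∈ dom Γ) → apply Γ g p ≤ᵀ g

ReducibleVia : (PartialFunction → Set) → Pred Baire 0ℓ → Pred Baire 0ℓ → Set₁
ReducibleVia K A B =
  Σ[ Γ ∈ PartialFunction ] K Γ ×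
    (Σ[ B⊆dom ∈ (B ⊆ dom Γ) ] (∀ g (p : g ∈ B) → apply Γ g (B⊆dom p) ∈ A))

infix 4 _≤^<ω-ω_ _≤^ω-1_ _≡^ω-1_

_≤^<ω-ω_ : Pred Baire 0ℓ → Pred Baire 0ℓ → Set₁
_≤^<ω-ω_ = ReducibleVia ⟨<ω,ω⟩-computable

_≤^ω-1_ : Pred Baire 0ℓ → Pred Baire 0ℓ → Set₁
_≤^ω-1_ = ReducibleVia ⟨ω,1⟩-computable

_≡^ω-1_ : Pred Baire 0ℓ → Pred Baire 0ℓ → Set₁
A ≡^ω-1 B = A ≤^ω-1 B × B ≤^ω-1 A

{-# OPTIONS --safe #-}
-- A point of P̂ is read in blocks.  A minimal non-member of the tree of P codes
-- an item, after which the tree of P starts afresh.  Points of P contain no item,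
-- and points with finitely many items have a tail in P.  Items have levels
-- from a finite range; let ℓ be the least level occurring infinitely often in a
-- point x.  If infinitely many items of level ℓ are commits, then the entries
-- they commit to form a member of P computable from x.  Otherwise almost all of
-- them are resets, each determined by the previous one and adding an entry to a
-- path through the tree of Q, so Q has a computable member, which is impossible.
-- Hence P̂ and P are Muchnik equivalent.
--
-- To defeat b learners at some point of P̂, suppose that beyond some position a
-- learner does not change its mind i on extensions by items of level at least ℓ.
-- Commit to a program of level ℓ that searches for extensions on which the
-- functional i yields a further value that stays in the tree of Q, and reset at
-- each success.  This chain ends, and then the functional fails on all extensions
-- by items of level greater than ℓ.  Continue at level ℓ + 1 with the other
-- learners.  Once none of them can be stabilised, some sequence of
-- extensions changes the minds of all of them infinitely often.
module Submission where

open import Defs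
open import Axiom.ExcludedMiddle using (ExcludedMiddle)
open import Data.Bool.Base using (Bool; true; false; if_then_else_)
open import Data.Empty using (⊥; ⊥-elim)
open import Data.Fin.Base as Fin using (Fin; toℕ)
open import Data.List.Base using (List; []; _∷_; _++_; _∷ʳ_; applyUpTo; foldl; length; reverse; take; drop)
open import Data.List.Membership.Propositional using (_∈_)
open import Data.List.Membership.Propositional.Properties using (∈-∃++; ∈-++⁻; ∈-++⁺ˡ; ∈-++⁺ʳ)
open import Data.List.Properties
  using (foldl-∷ʳ; foldl-++; applyUpTo-∷ʳ; ++-assoc; ++-identityʳ; length-++; take++drop≡id; take-all;
         reverse-++; unfold-reverse; reverse-involutive)
open import Data.List.Relation.Unary.Any using (here; there)
open import Data.List.Reverse using (Reverse; reverseView; []; _∶_∶ʳ_)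
open import Data.Nat.Base hiding (pred)
open import Data.Nat.Properties
open import Data.Product.Base using (Σ-syntax; ∃; ∃-syntax; _×_; _,_; proj₁; proj₂)
open import Data.Sum.Base using (_⊎_; inj₁; inj₂)
open import Data.Vec.Base using (Vec; lookup)
import Data.Vec.Base as Vec
open import Function.Base using (_∘_; _$_)
open import Function.Bundles using (Equivalence; mk⇔)
open import Level using (0ℓ)
open import Relation.Binary.Definitions using (tri<; tri≈; tri>)
open import Relation.Binary.PropositionalEquality
open import Relation.Nullary using (¬_; Dec; yes; no; contradiction)
open import Relation.Unary using (Pred; _⊆_) renaming (_∈_ to _∈ᴾ_)

-- The conflict is that a reset needs a certificate found by a computable search, while a search
-- cannot tell a string of the tree of P that extends to a member of P from a dead end, and the
-- history it finds may have committed to a dead end. A reset therefore discards the commitments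
-- made above its base and returns to the string `κ` of the base, which the diagonal argument, not
-- being computable, has kept extendible. The price is that resets make no progress towards a member
-- of P. That P has no computable member enters elsewhere: it yields infinitely many minimal
-- non-members, enough to code all items.
--
-- Confining later extensions to higher levels keeps a stuck base in place: it stays the base for
-- its level in every later history, so the failed search speaks about all of them. Against `b`
-- learners the levels 0 to `b` are used: at most one for each restrained learner, and one on which
-- to keep moving while the others change their minds. The range is declared by the first item of a
-- point, so a single set serves all `b`.

private variable
  k : ℕ
  gs : Vec Baire k
  f φ θ : ℕ → ℕ
  f₂ : ℕ → ℕ → ℕ
  f₃ : ℕ → ℕ → ℕ → ℕ

-- Opaque copies of the pairing functions, lest triangle unfold in types.
opaque
  ⟪_,_⟫ : ℕ → ℕ → ℕ
  ⟪ a , b ⟫ = ⟨ a , b ⟩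

  π₁ π₂ : ℕ → ℕ
  π₁ n = proj₁ (unpair n)
  π₂ n = proj₂ (unpair n)

  ⟨,⟩-⟪,⟫ : ∀ a b → ⟨ a , b ⟩ ≡ ⟪ a , b ⟫
  ⟨,⟩-⟪,⟫ a b = refl

  π₁-⟪,⟫ : ∀ a b → π₁ ⟪ a , b ⟫ ≡ a
  π₁-⟪,⟫ a b = cong proj₁ (unpair-⟨,⟩ a b)

  π₂-⟪,⟫ : ∀ a b → π₂ ⟪ a , b ⟫ ≡ b
  π₂-⟪,⟫ a b = cong proj₂ (unpair-⟨,⟩ a b)

  π₁-0 : π₁ 0 ≡ 0
  π₁-0 = refl

  π₂-0 : π₂ 0 ≡ 0
  π₂-0 = refl

  y≤⟪x,y⟫ : ∀ x y → y ≤ ⟪ x , y ⟫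
  y≤⟪x,y⟫ = y≤⟨x,y⟩

  ⟪π₁,π₂⟫ : ∀ n → ⟪ π₁ n , π₂ n ⟫ ≡ n
  ⟪π₁,π₂⟫ zero    = refl
  ⟪π₁,π₂⟫ (suc n) = trans (⟨next⟩ (π₁ n) (π₂ n)) (cong suc (⟪π₁,π₂⟫ n))
    where
    ⟨next⟩ : ∀ x y → ⟨ proj₁ (next (x , y)) , proj₂ (next (x , y)) ⟩ ≡ suc ⟨ x , y ⟩
    ⟨next⟩ zero y rewrite +-identityʳ y | +-identityʳ (y + triangle y) = cong suc (+-comm y (triangle y))
    ⟨next⟩ (suc x) y rewrite +-suc x y = +-suc _ y

pred : ℕ → ℕ
pred zero    = zero
pred (suc n) = n

opaque
  cons : ℕ → ℕ → ℕ
  cons x z = suc ⟪ x , z ⟫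

  hd tl : ℕ → ℕ
  hd z = π₁ (pred z)
  tl z = π₂ (pred z)

  hd-cons : ∀ x z → hd (cons x z) ≡ x
  hd-cons = π₁-⟪,⟫

  tl-cons : ∀ x z → tl (cons x z) ≡ z
  tl-cons = π₂-⟪,⟫

  hd-0 : hd 0 ≡ 0
  hd-0 = π₁-0

  tl-0 : tl 0 ≡ 0
  tl-0 = π₂-0

  cons≢0 : ∀ {x z} → cons x z ≢ 0
  cons≢0 ()

  cons-hd-tl : ∀ {z} → z ≢ 0 → cons (hd z) (tl z) ≡ z
  cons-hd-tl {zero}  z≢0 = contradiction refl z≢0
  cons-hd-tl {suc z} _   = cong suc (⟪π₁,π₂⟫ z)

  z<cons : ∀ x z → z < cons x z
  z<cons x z = s≤s (y≤⟪x,y⟫ x z)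

  code-∷ : ∀ x σ → ⌜ x ∷ σ ⌝ ≡ cons x ⌜ σ ⌝
  code-∷ x σ = cong suc (⟨,⟩-⟪,⟫ x ⌜ σ ⌝)

cons-injective : ∀ {x y z w} → cons x z ≡ cons y w → x ≡ y × z ≡ w
cons-injective {x} {y} {z} {w} eq =
  trans (sym (hd-cons x z)) (trans (cong hd eq) (hd-cons y w)) ,
  trans (sym (tl-cons x z)) (trans (cong tl eq) (tl-cons y w))

-- The tail of a nonzero code is a smaller number, so induction along tails becomes induction on a
-- numerical bound.
cons-ind : (A : ℕ → Set) → A 0 → (∀ x z → A z → A (cons x z)) → ∀ z → A z
cons-ind A a₀ a₊ z = go z z ≤-refl
  where
  go : ∀ n z → z ≤ n → A z
  go n       zero    _  = a₀
  go (suc n) (suc z) le =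
    subst A eq (a₊ (hd (suc z)) (tl (suc z)) (go n (tl (suc z)) (≤-pred (≤-trans lt le))))
    where
    eq : cons (hd (suc z)) (tl (suc z)) ≡ suc z
    eq = cons-hd-tl λ ()
    lt : tl (suc z) < suc z
    lt = subst (tl (suc z) <_) eq (z<cons _ _)

code-surjective : ∀ z → ∃[ σ ] ⌜ σ ⌝ ≡ z
code-surjective = cons-ind (λ z → ∃[ σ ] ⌜ σ ⌝ ≡ z) ([] , refl) λ { x _ (σ , refl) → x ∷ σ , code-∷ x σ }

length≤code : ∀ σ → length σ ≤ ⌜ σ ⌝
length≤code []      = z≤n
length≤code (x ∷ σ) rewrite code-∷ x σ = ≤-trans (s≤s (length≤code σ)) (z<cons x ⌜ σ ⌝)

-- Zero plays the role of "true": tests are numbers, conjunction is addition.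
ifz : ℕ → ℕ → ℕ → ℕ
ifz zero    a b = a
ifz (suc _) a b = b

natrec : ℕ → (ℕ → ℕ → ℕ) → ℕ → ℕ
natrec b s zero    = b
natrec b s (suc n) = s n (natrec b s n)

iter : (ℕ → ℕ) → ℕ → ℕ → ℕ
iter f z zero    = z
iter f z (suc n) = f (iter f z n)

iter-suc : ∀ f z n → iter f z (suc n) ≡ iter f (f z) n
iter-suc f z zero    = refl
iter-suc f z (suc n) = cong f (iter-suc f z n)

-- Computability relative to oracles

record Comp {k} (gs : Vec Baire k) (f : ℕ → ℕ) : Set where
  constructor _by_
  field
    code  : Code k
    graph : ∀ n → ⟦ code ⟧ gs n (f n)
open Comp

record Comp₂ {k} (gs : Vec Baire k) (f : ℕ → ℕ → ℕ) : Set where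
  constructor curried
  field uncurried : Comp gs (λ p → f (π₁ p) (π₂ p))
open Comp₂

record Comp₃ {k} (gs : Vec Baire k) (f : ℕ → ℕ → ℕ → ℕ) : Set where
  constructor curried
  field uncurried : Comp gs (λ p → f (π₁ p) (π₁ (π₂ p)) (π₂ (π₂ p)))
open Comp₃

Comp-cong : (∀ n → f n ≡ φ n) → Comp gs f → Comp gs φ
Comp-cong eq (c by sem) = c by λ n → subst (⟦ c ⟧ _ n) (eq n) (sem n)

infixr 9 _∙_
_∙_ : Comp gs f → Comp gs φ → Comp gs (λ x → f (φ x))
(c by F) ∙ (d by G) = comp c d by λ n → _ , G n , F _

⟪_,_⟫ᶜ : Comp gs f → Comp gs φ → Comp gs (λ x → ⟪ f x , φ x ⟫)
⟪ c by F , d by G ⟫ᶜ = pair c d by λ n → _ , _ , F n , G n , sym (⟨,⟩-⟪,⟫ _ _)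

π₁ᶜ : Comp gs π₁
π₁ᶜ = fst by graph′
  where
  opaque
    unfolding π₁
    graph′ : ∀ n → π₁ n ≡ proj₁ (unpair n)
    graph′ _ = refl

π₂ᶜ : Comp gs π₂
π₂ᶜ = snd by graph′
  where
  opaque
    unfolding π₂
    graph′ : ∀ n → π₂ n ≡ proj₂ (unpair n)
    graph′ _ = refl

idᶜ : Comp gs (λ x → x)
idᶜ = Comp-cong ⟪π₁,π₂⟫ ⟪ π₁ᶜ , π₂ᶜ ⟫ᶜ

sucᶜ : Comp gs suc
sucᶜ = suc by λ _ → refl

constᶜ : ∀ n → Comp gs (λ _ → n)
constᶜ zero    = zer by λ _ → refl
constᶜ (suc n) = sucᶜ ∙ constᶜ n

ap₂ : Comp₂ gs f₂ → Comp gs f → Comp gs φ → Comp gs (λ x → f₂ (f x) (φ x))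
ap₂ {f₂ = f₂} {f = f} {φ = φ} (curried F) F₁ F₂ =
  Comp-cong (λ x → cong₂ f₂ (π₁-⟪,⟫ (f x) (φ x)) (π₂-⟪,⟫ (f x) (φ x))) (F ∙ ⟪ F₁ , F₂ ⟫ᶜ)

unfold : ∀ (f : ℕ → ℕ → ℕ → ℕ) a b c → let p = ⟪ a , ⟪ b , c ⟫ ⟫ in
         f (π₁ p) (π₁ (π₂ p)) (π₂ (π₂ p)) ≡ f a b c
unfold f a b c rewrite π₁-⟪,⟫ a ⟪ b , c ⟫ | π₂-⟪,⟫ a ⟪ b , c ⟫ | π₁-⟪,⟫ b c | π₂-⟪,⟫ b c = refl

opaque
  unfolding π₁ π₂
  prec-graph : ∀ {c d} p {y} → PrecGraph c d gs (π₁ p) (π₂ p) y → ⟦ prec c d ⟧ gs p y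
  prec-graph p graph = graph

natrecᶜ : Comp gs f → Comp₃ gs f₃ → Comp₂ gs (λ a n → natrec (f a) (f₃ a) n)
natrecᶜ {gs = gs} {f = f} {f₃ = f₃} (c by F) (curried (d by G)) =
  curried (prec c d by λ p → prec-graph p (go (π₁ p) (π₂ p)))
  where
  go : ∀ a n → PrecGraph c d gs a n (natrec (f a) (f₃ a) n)
  go a zero    = F a
  go a (suc n) = _ , go a n , subst₂ (⟦ d ⟧ gs) (sym (trans (⟨,⟩-⟪,⟫ a _) (cong (⟪ a ,_⟫) (⟨,⟩-⟪,⟫ n _)))) (unfold f₃ a n _) (G _)

iterᶜ : Comp₂ gs f₂ → Comp gs f → Comp gs φ → Comp gs θ → Comp gs (λ x → iter (f₂ (f x)) (φ x) (θ x))
iterᶜ {gs = gs} {f₂ = f₂} {f = f} {φ = φ} {θ = θ} F A Z N =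
  Comp-cong (λ x → iter-natrec (f x) (φ x) (θ x)) (ap₂ R ⟪ A , Z ⟫ᶜ N)
  where
  R : Comp₂ gs (λ a n → natrec (π₂ a) (λ _ → f₂ (π₁ a)) n)
  R = natrecᶜ {f₃ = λ a _ → f₂ (π₁ a)} π₂ᶜ (curried (ap₂ F (π₁ᶜ ∙ π₁ᶜ) (π₂ᶜ ∙ π₂ᶜ)))
  iter-natrec : ∀ a z n → natrec (π₂ ⟪ a , z ⟫) (λ _ → f₂ (π₁ ⟪ a , z ⟫)) n ≡ iter (f₂ a) z n
  iter-natrec a z n rewrite π₁-⟪,⟫ a z | π₂-⟪,⟫ a z = go n
    where
    go : ∀ n → natrec z (λ _ → f₂ a) n ≡ iter (f₂ a) z n
    go zero    = refl
    go (suc n) = cong (f₂ a) (go n)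

iterᶜ₁ : Comp gs f → Comp gs φ → Comp gs θ → Comp gs (λ x → iter f (φ x) (θ x))
iterᶜ₁ {f = f} F = iterᶜ {f₂ = λ _ → f} (curried (F ∙ π₂ᶜ)) (constᶜ 0)

ifzᶜ : Comp gs f → Comp gs φ → Comp gs θ → Comp gs (λ x → ifz (f x) (φ x) (θ x))
ifzᶜ {f = f} {φ = φ} {θ = θ} N A B = Comp-cong (λ x → go (φ x) (θ x) (f x)) (ap₂ R ⟪ A , B ⟫ᶜ N)
  where
  R = natrecᶜ {f₃ = λ a _ _ → π₂ a} π₁ᶜ (curried (π₂ᶜ ∙ π₁ᶜ))
  go : ∀ a b n → natrec (π₁ ⟪ a , b ⟫) (λ _ _ → π₂ ⟪ a , b ⟫) n ≡ ifz n a b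
  go a b zero    = π₁-⟪,⟫ a b
  go a b (suc n) = π₂-⟪,⟫ a b

predᶜ : Comp gs pred
predᶜ = Comp-cong eq (ap₂ (natrecᶜ {f₃ = λ _ n _ → n} (constᶜ 0) (curried (π₁ᶜ ∙ π₂ᶜ))) (constᶜ 0) idᶜ)
  where
  eq : ∀ n → natrec 0 (λ n _ → n) n ≡ pred n
  eq zero    = refl
  eq (suc n) = refl

monusᶜ : Comp₂ gs _∸_
monusᶜ = curried (Comp-cong (λ p → eq (π₁ p) (π₂ p)) (iterᶜ₁ predᶜ π₁ᶜ π₂ᶜ))
  where
  pred-∸ : ∀ m n → pred (m ∸ n) ≡ m ∸ suc n
  pred-∸ zero    zero    = refl
  pred-∸ zero    (suc n) = refl
  pred-∸ (suc m) zero    = refl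
  pred-∸ (suc m) (suc n) = pred-∸ m n
  eq : ∀ m n → iter pred m n ≡ m ∸ n
  eq m zero    = refl
  eq m (suc n) = trans (cong pred (eq m n)) (pred-∸ m n)

addᶜ : Comp₂ gs _+_
addᶜ = curried (Comp-cong (λ p → eq (π₁ p) (π₂ p)) (iterᶜ₁ sucᶜ π₂ᶜ π₁ᶜ))
  where
  eq : ∀ m n → iter suc n m ≡ m + n
  eq zero    n = refl
  eq (suc m) n = cong suc (eq m n)

infixl 6 _+ᶜ_ _∸ᶜ_
_+ᶜ_ : Comp gs f → Comp gs φ → Comp gs (λ x → f x + φ x)
_+ᶜ_ = ap₂ addᶜ

_∸ᶜ_ : Comp gs f → Comp gs φ → Comp gs (λ x → f x ∸ φ x)
_∸ᶜ_ = ap₂ monusᶜ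

dist : ℕ → ℕ → ℕ
dist m n = (m ∸ n) + (n ∸ m)

dist≡0 : ∀ {m n} → dist m n ≡ 0 → m ≡ n
dist≡0 {m} {n} eq =
  ≤-antisym (m∸n≡0⇒m≤n (m+n≡0⇒m≡0 (m ∸ n) eq)) (m∸n≡0⇒m≤n (m+n≡0⇒n≡0 (m ∸ n) eq))

dist-refl : ∀ {m n} → m ≡ n → dist m n ≡ 0
dist-refl {m} refl rewrite n∸n≡0 m = refl

distᶜ : Comp gs f → Comp gs φ → Comp gs (λ x → dist (f x) (φ x))
distᶜ F G = (F ∸ᶜ G) +ᶜ (G ∸ᶜ F)

ifz-1-0 : ∀ n → ifz n 1 0 ≡ 0 → n ≢ 0
ifz-1-0 (suc n) _ ()

ifz-≢ : ∀ {n a b} → n ≢ 0 → ifz n a b ≡ b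
ifz-≢ {zero}  n≢0 = contradiction refl n≢0
ifz-≢ {suc n} _   = refl

ifz-≡ : ∀ {n a b} → n ≡ 0 → ifz n a b ≡ a
ifz-≡ refl = refl

opaque
  unfolding cons hd tl
  consᶜ : Comp gs f → Comp gs φ → Comp gs (λ x → cons (f x) (φ x))
  consᶜ F G = sucᶜ ∙ ⟪ F , G ⟫ᶜ

  hdᶜ : Comp gs hd
  hdᶜ = π₁ᶜ ∙ predᶜ

  tlᶜ : Comp gs tl
  tlᶜ = π₂ᶜ ∙ predᶜ

foldStep : (ℕ → ℕ → ℕ) → ℕ → ℕ
foldStep s p = ifz (π₂ p) p ⟪ s (π₁ p) (hd (π₂ p)) , tl (π₂ p) ⟫

opaque
  -- The state pairs the accumulator with the unread part of the list and idles once that is empty.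
  -- A code is at least as large as the length of its list, so `z` itself is a sufficient number of
  -- rounds.
  foldN : (ℕ → ℕ → ℕ) → ℕ → ℕ → ℕ
  foldN s a z = π₁ (iter (foldStep s) ⟪ a , z ⟫ z)

  foldN-code : ∀ s a σ → foldN s a ⌜ σ ⌝ ≡ foldl s a σ
  foldN-code s a σ = trans (cong π₁ (go σ _ (length≤code σ) a)) (π₁-⟪,⟫ (foldl s a σ) 0)
    where
    idle : ∀ a n → iter (foldStep s) ⟪ a , 0 ⟫ n ≡ ⟪ a , 0 ⟫
    idle a zero    = refl
    idle a (suc n) rewrite idle a n | π₂-⟪,⟫ a 0 = refl
    foldStep-cons : ∀ a x z → foldStep s ⟪ a , cons x z ⟫ ≡ ⟪ s a x , z ⟫
    foldStep-cons a x z
      rewrite π₂-⟪,⟫ a (cons x z)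
            | ifz-≢ {a = ⟪ a , cons x z ⟫} {⟪ s (π₁ ⟪ a , cons x z ⟫) (hd (cons x z)) , tl (cons x z) ⟫}
                    (cons≢0 {x} {z})
            | π₁-⟪,⟫ a (cons x z) | hd-cons x z | tl-cons x z = refl
    go : ∀ σ n → length σ ≤ n → ∀ a → iter (foldStep s) ⟪ a , ⌜ σ ⌝ ⟫ n ≡ ⟪ foldl s a σ , 0 ⟫
    go []      n       _        a = idle a n
    go (x ∷ σ) (suc n) (s≤s le) a =
      trans (iter-suc (foldStep s) _ n)
        (trans (cong (λ p → iter (foldStep s) p n)
                 (trans (cong (λ z → foldStep s ⟪ a , z ⟫) (code-∷ x σ)) (foldStep-cons a x ⌜ σ ⌝)))
               (go σ n le (s a x)))

  foldNᶜ : Comp₂ gs f₂ → Comp gs f → Comp gs φ → Comp gs (λ x → foldN f₂ (f x) (φ x))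
  foldNᶜ {gs = gs} {f₂ = f₂} S A Z = π₁ᶜ ∙ iterᶜ₁ step ⟪ A , Z ⟫ᶜ Z
    where
    step : Comp gs (foldStep f₂)
    step = ifzᶜ π₂ᶜ idᶜ ⟪ ap₂ S π₁ᶜ (hdᶜ ∙ π₂ᶜ) , tlᶜ ∙ π₂ᶜ ⟫ᶜ

-- Strings that grow are coded in reverse, so that extending them is cons.
rcode : Baire → ℕ → ℕ
rcode g zero    = 0
rcode g (suc n) = cons (g n) (rcode g n)

opaque
  len : ℕ → ℕ
  len = foldN (λ n _ → suc n) 0

  lenᶜ : Comp gs len
  lenᶜ = foldNᶜ (curried (sucᶜ ∙ π₁ᶜ)) (constᶜ 0) idᶜ

  len-fold : ∀ σ → len ⌜ σ ⌝ ≡ foldl (λ n _ → suc n) 0 σ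
  len-fold = foldN-code (λ n _ → suc n) 0

len-code : ∀ σ → len ⌜ σ ⌝ ≡ length σ
len-code σ = trans (len-fold σ) (go 0 σ)
  where
  go : ∀ n (σ : List ℕ) → foldl (λ n _ → suc n) n σ ≡ n + length σ
  go n []      = sym (+-identityʳ n)
  go n (x ∷ σ) = trans (go (suc n) σ) (sym (+-suc n (length σ)))

len-0 : len 0 ≡ 0
len-0 = len-code []

len-cons : ∀ x z → len (cons x z) ≡ suc (len z)
len-cons x z with σ , refl ← code-surjective z =
  trans (cong len (sym (code-∷ x σ))) (trans (len-code (x ∷ σ)) (cong suc (sym (len-code σ))))

len-rcode : ∀ g n → len (rcode g n) ≡ n
len-rcode g zero    = len-0
len-rcode g (suc n) = trans (len-cons (g n) (rcode g n)) (cong suc (len-rcode g n))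

opaque
  revN : ℕ → ℕ
  revN = foldN (λ z x → cons x z) 0

  revN-code : ∀ σ → revN ⌜ σ ⌝ ≡ foldl (λ z x → cons x z) 0 σ
  revN-code = foldN-code (λ z x → cons x z) 0

  revNᶜ : Comp gs revN
  revNᶜ = foldNᶜ (curried (consᶜ π₂ᶜ π₁ᶜ)) (constᶜ 0) idᶜ

opaque
  -- Positions count from the start of the string, the far end of its reversed code.
  at : ℕ → ℕ → ℕ
  at z n = hd (iter tl z (len z ∸ suc n))

  atᶜ : Comp gs f → Comp gs φ → Comp gs (λ x → at (f x) (φ x))
  atᶜ Z N = hdᶜ ∙ iterᶜ₁ tlᶜ Z ((lenᶜ ∙ Z) ∸ᶜ (sucᶜ ∙ N))

  at-top : ∀ y w → at (cons y w) (len w) ≡ y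
  at-top y w rewrite len-cons y w | n∸n≡0 (len w) = hd-cons y w

  at-cons : ∀ y w n → n < len w → at (cons y w) n ≡ at w n
  at-cons y w n n<len rewrite len-cons y w | +-∸-assoc 1 n<len =
    cong hd (trans (iter-suc tl (cons y w) (len w ∸ suc n)) (cong (λ z → iter tl z (len w ∸ suc n)) (tl-cons y w)))

opaque
  -- For forward codes, with values shifted by one: 0 means beyond the end.
  nthN : ℕ → ℕ → ℕ
  nthN z n = ifz (iter tl z n) 0 (suc (hd (iter tl z n)))

  nthNᶜ : Comp gs f → Comp gs φ → Comp gs (λ x → nthN (f x) (φ x))
  nthNᶜ {gs = gs} {f = f} {φ = φ} Z N = ifzᶜ I (constᶜ 0) (sucᶜ ∙ hdᶜ ∙ I)
    where
    I : Comp gs (λ x → iter tl (f x) (φ x))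
    I = iterᶜ₁ tlᶜ Z N

  nthN-zero : ∀ x σ → nthN ⌜ x ∷ σ ⌝ 0 ≡ suc x
  nthN-zero x σ = trans (cong (λ z → nthN z 0) (code-∷ x σ)) (trans (ifz-≢ cons≢0) (cong suc (hd-cons x ⌜ σ ⌝)))

  nthN-suc : ∀ x σ n → nthN ⌜ x ∷ σ ⌝ (suc n) ≡ nthN ⌜ σ ⌝ n
  nthN-suc x σ n =
    cong (λ z → ifz z 0 (suc (hd z)))
      (trans (iter-suc tl ⌜ x ∷ σ ⌝ n)
             (cong (λ z → iter tl z n) (trans (cong tl (code-∷ x σ)) (tl-cons x ⌜ σ ⌝))))

  nthN-[] : ∀ n → nthN 0 n ≡ 0
  nthN-[] n = ifz-≡ (go n)
    where
    go : ∀ n → iter tl 0 n ≡ 0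
    go zero    = refl
    go (suc n) = trans (cong tl (go n)) tl-0

nthN-↾ : ∀ g {L n} → n < L → nthN ⌜ g ↾ L ⌝ n ≡ suc (g n)
nthN-↾ g {suc L} {zero}  _        = nthN-zero (g 0) _
nthN-↾ g {suc L} {suc n} (s≤s lt) = trans (nthN-suc (g 0) _ n) (nthN-↾ (g ∘ suc) lt)

nthN-↾⁻ : ∀ g L n {v} → nthN ⌜ g ↾ L ⌝ n ≡ suc v → v ≡ g n
nthN-↾⁻ g zero    n       eq with () ← trans (sym (nthN-[] n)) eq
nthN-↾⁻ g (suc L) zero    eq = suc-injective (trans (sym eq) (nthN-zero (g 0) _))
nthN-↾⁻ g (suc L) (suc n) eq = nthN-↾⁻ (g ∘ suc) L n (trans (sym (nthN-suc (g 0) _ n)) eq)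

nthN-++ : ∀ σ τ n {v} → nthN ⌜ σ ⌝ n ≡ suc v → nthN ⌜ σ ++ τ ⌝ n ≡ suc v
nthN-++ []      τ n       eq with () ← trans (sym (nthN-[] n)) eq
nthN-++ (x ∷ σ) τ zero    eq = trans (nthN-zero x (σ ++ τ)) (trans (sym (nthN-zero x σ)) eq)
nthN-++ (x ∷ σ) τ (suc n) eq =
  trans (nthN-suc x (σ ++ τ) n) (nthN-++ σ τ n (trans (sym (nthN-suc x σ n)) eq))

least : (p : ℕ → ℕ) → ∀ {n} → p n ≡ 0 → ∃[ m ] p m ≡ 0 × (∀ j → j < m → p j ≢ 0)
least p {n} pn = go n 0 (λ _ ()) (subst (λ j → p j ≡ 0) (sym (+-identityʳ n)) pn)
  where
  below′ : ∀ {m} → (∀ j → j < m → p j ≢ 0) → p m ≢ 0 → ∀ j → j < suc m → p j ≢ 0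
  below′ below pm≢0 j (s≤s j≤m) with m≤n⇒m<n∨m≡n j≤m
  ... | inj₁ j<m  = below j j<m
  ... | inj₂ refl = pm≢0
  go : ∀ d m → (∀ j → j < m → p j ≢ 0) → p (d + m) ≡ 0 → ∃[ m ] p m ≡ 0 × (∀ j → j < m → p j ≢ 0)
  go zero    m below pm = m , pm , below
  go (suc d) m below pm with p m ≟ 0
  ... | yes eq = m , eq , below
  ... | no neq = go d (suc m) (below′ below neq) (subst (λ j → p j ≡ 0) (sym (+-suc d m)) pm)

nonzero-suc : ∀ {n} → n ≢ 0 → ∃[ m ] n ≡ suc m
nonzero-suc {zero}  n≢0 = contradiction refl n≢0
nonzero-suc {suc n} _   = n , refl

-- A zero is required at this `x` only, so the lemma also covers searches that diverge at other
-- arguments.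
min-graph : (F : Comp₂ gs f₂) → ∀ x {y} → f₂ x y ≡ 0 → (∀ j → j < y → f₂ x j ≢ 0) →
            ⟦ min (code (uncurried F)) ⟧ gs x y
min-graph {gs = gs} {f₂ = f₂} (curried (c by F)) x {y} zy below =
  run zy , λ j j<y → let z , e = nonzero-suc (below j j<y) in z , run e
  where
  run : ∀ {j v} → f₂ x j ≡ v → ⟦ c ⟧ gs ⟨ x , j ⟩ v
  run {j} e = subst₂ (⟦ c ⟧ gs) (sym (⟨,⟩-⟪,⟫ x j))
    (trans (cong₂ f₂ (π₁-⟪,⟫ x j) (π₂-⟪,⟫ x j)) e) (F ⟪ x , j ⟫)

minimize : Comp₂ gs f₂ → (∀ x → ∃[ y ] f₂ x y ≡ 0) →
           ∃[ μ ] Comp gs μ × (∀ x → f₂ x (μ x) ≡ 0 × (∀ j → j < μ x → f₂ x j ≢ 0))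
minimize {f₂ = f₂} F ex =
  (λ x → proj₁ (least (f₂ x) (proj₂ (ex x)))) ,
  (min (code (uncurried F)) by λ x → let _ , z , below = least (f₂ x) (proj₂ (ex x)) in min-graph F x z below) ,
  λ x → proj₂ (least (f₂ x) (proj₂ (ex x)))

lift : Code 0 → Code k
lift zer        = zer
lift suc        = suc
lift fst        = fst
lift snd        = snd
lift (pair c d) = pair (lift c) (lift d)
lift (comp c d) = comp (lift c) (lift d)
lift (prec c d) = prec (lift c) (lift d)
lift (min c)    = min (lift c)

lift-graph : ∀ (c : Code 0) {x y} → ⟦ c ⟧ Vec.[] x y → ⟦ lift c ⟧ gs x y
lift-graph zer e = e
lift-graph suc e = e
lift-graph fst e = e
lift-graph snd e = e
lift-graph (pair c d) (a , b , p , q , e) = a , b , lift-graph c p , lift-graph d q , e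
lift-graph (comp c d) (z , p , q) = z , lift-graph d p , lift-graph c q
lift-graph {gs = gs} (prec c d) {x} = go (proj₁ (unpair x)) (proj₂ (unpair x))
  where
  go : ∀ a n {y} → PrecGraph c d Vec.[] a n y → PrecGraph (lift c) (lift d) gs a n y
  go a zero    p           = lift-graph c p
  go a (suc n) (z , p , q) = z , go a n p , lift-graph d q
lift-graph (min c) (p , q) = lift-graph c p , λ m m<y → let z , r = q m m<y in z , lift-graph c r

liftᶜ : Comp Vec.[] f → Comp gs f
liftᶜ (c by F) = lift c by λ n → lift-graph c (F n)

liftᶜ₂ : Comp₂ Vec.[] f₂ → Comp₂ gs f₂
liftᶜ₂ (curried F) = curried (liftᶜ F)

deterministic : ∀ (c : Code k) {x y y′} → ⟦ c ⟧ gs x y → ⟦ c ⟧ gs x y′ → y ≡ y′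
deterministic zer refl refl = refl
deterministic suc refl refl = refl
deterministic fst refl refl = refl
deterministic snd refl refl = refl
deterministic (oracle i) refl refl = refl
deterministic (pair c d) (_ , _ , p , q , refl) (_ , _ , p′ , q′ , refl) =
  cong₂ ⟨_,_⟩ (deterministic c p p′) (deterministic d q q′)
deterministic (comp c d) (_ , p , q) (_ , p′ , q′) with refl ← deterministic d p p′ = deterministic c q q′
deterministic {gs = gs} (prec c d) {x} = go (proj₁ (unpair x)) (proj₂ (unpair x))
  where
  go : ∀ a n {y y′} → PrecGraph c d gs a n y → PrecGraph c d gs a n y′ → y ≡ y′
  go a zero    p           p′             = deterministic c p p′
  go a (suc n) (_ , p , q) (_ , p′ , q′) with refl ← go a n p p′ = deterministic d q q′
deterministic (min c) {y = y} {y′} (p , q) (p′ , q′) with <-cmp y y′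
... | tri< y<y′ _ _ with () ← deterministic c p (proj₂ (q′ y y<y′))
... | tri≈ _ e _ = e
... | tri> _ _ y′<y with () ← deterministic c p′ (proj₂ (q y′ y′<y))

-- Initial segments of reversed codes and limits of growing sequences

data _≼_ (z : ℕ) : ℕ → Set where
  ≼-refl : z ≼ z
  ≼-cons : ∀ {w} y → z ≼ w → z ≼ cons y w

≼-trans : ∀ {u v w} → u ≼ v → v ≼ w → u ≼ w
≼-trans p ≼-refl       = p
≼-trans p (≼-cons y q) = ≼-cons y (≼-trans p q)

≼-len : ∀ {u v} → u ≼ v → len u ≤ len v
≼-len ≼-refl = ≤-refl
≼-len (≼-cons {w} y p) = ≤-trans (≼-len p) (≤-trans (n≤1+n _) (≤-reflexive (sym (len-cons y w))))

at-≼ : ∀ {u v} n → n < len u → u ≼ v → at v n ≡ at u n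
at-≼ n _  ≼-refl = refl
at-≼ {u} n lt (≼-cons {w} y p) = trans (at-cons y w n (<-≤-trans lt (≼-len p))) (at-≼ n lt p)

rcode-at : ∀ z g → (∀ n → n < len z → at z n ≡ g n) → z ≡ rcode g (len z)
rcode-at z g = cons-ind (λ z → (∀ n → n < len z → at z n ≡ g n) → z ≡ rcode g (len z)) base step z
  where
  base : _ → 0 ≡ rcode g (len 0)
  base _ rewrite len-0 = refl
  step : ∀ y w → ((∀ n → n < len w → at w n ≡ g n) → w ≡ rcode g (len w)) →
         (∀ n → n < len (cons y w) → at (cons y w) n ≡ g n) → cons y w ≡ rcode g (len (cons y w))
  step y w ih eq rewrite len-cons y w =
    cong₂ cons (trans (sym (at-top y w)) (eq (len w) ≤-refl))
               (ih λ n lt → trans (sym (at-cons y w n lt)) (eq n (m≤n⇒m≤1+n lt)))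

module _ (Z : ℕ → ℕ) (grow : ∀ j → Z j ≼ Z (suc j)) (long : ∀ j → j ≤ len (Z j)) where

  limit : Baire
  -- By `long`, `Z (suc n)` has more than `n` entries, so position `n` is already filled there.
  limit n = at (Z (suc n)) n

  limitᶜ : Comp gs Z → Comp gs limit
  limitᶜ C = atᶜ (C ∙ sucᶜ) idᶜ

  limit-grow : ∀ {i j} → i ≤′ j → Z i ≼ Z j
  limit-grow ≤′-refl     = ≼-refl
  limit-grow (≤′-step p) = ≼-trans (limit-grow p) (grow _)

  limit-prefix : ∀ j → Z j ≡ rcode limit (len (Z j))
  limit-prefix j = rcode-at (Z j) limit agree
    where
    agree : ∀ n → n < len (Z j) → at (Z j) n ≡ at (Z (suc n)) n
    agree n lt with ≤-total j (suc n)
    ... | inj₁ le = sym (at-≼ n lt (limit-grow (≤⇒≤′ le)))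
    ... | inj₂ le = at-≼ n (long (suc n)) (limit-grow (≤⇒≤′ le))

-- In contrast to `natrecᶜ`, the step program has to halt only on the values `G j`. It may therefore
-- contain an unbounded search that succeeds along this sequence alone. `G 0` is built in as a
-- constant.
seqᶜ : ∀ {G : ℕ → ℕ} (d : Code k) → (∀ j → ⟦ d ⟧ gs (G j) (G (suc j))) → Comp gs G
seqᶜ {gs = gs} {G} d D =
  comp (prec c (comp d (comp snd snd))) (pair zer (code (idᶜ {gs = gs}))) by λ n →
    ⟨ 0 , n ⟩ , (0 , n , refl , graph (idᶜ {gs = gs}) n , refl) ,
    subst (λ p → PrecGraph c (comp d (comp snd snd)) gs (proj₁ p) (proj₂ p) (G n)) (sym (unpair-⟨,⟩ 0 n)) (go n)
  where
  c : Code _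
  c = code (constᶜ {gs = gs} (G 0))
  go : ∀ n → PrecGraph c (comp d (comp snd snd)) gs 0 n (G n)
  go zero    = graph (constᶜ {gs = gs} (G 0)) 0
  go (suc n) = G n , go n , G n ,
    (⟨ n , G n ⟩ , sym (cong proj₂ (unpair-⟨,⟩ 0 ⟨ n , G n ⟩)) , sym (cong proj₂ (unpair-⟨,⟩ n (G n)))) , D n

rcode-closed : ∀ (T : ℕ → ℕ) → (∀ {i η} → T (cons i η) ≡ 0 → T η ≡ 0) →
               ∀ (x : Baire) {n N} → n ≤ N → T (rcode x N) ≡ 0 → T (rcode x n) ≡ 0
rcode-closed T tail x le = go (≤⇒≤′ le)
  where
  go : ∀ {n N} → n ≤′ N → T (rcode x N) ≡ 0 → T (rcode x n) ≡ 0
  go ≤′-refl     t = t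
  go (≤′-step p) t = go p (tail t)

-- A stack machine

-- A configuration is a value y with a stack of frames
-- ⟪ t , d ⟫, empty when the machine has halted.  Tags t ≤ 8 are those of
-- encode: such a frame applies a program to y.  The others resume pair (9
-- and 10), prec (11) and min (12).  An oracle is a function o with o q = 0
-- where undefined and suc of the value elsewhere; a query of an undefined
-- value leaves the configuration unchanged forever.

opaque
  exec : (a t d y K : ℕ) → ℕ
  exec a t d y K =
    ifz t ⟪ 0 , K ⟫ $
    ifz (t ∸ 1) ⟪ suc y , K ⟫ $
    ifz (t ∸ 2) ⟪ π₁ y , K ⟫ $
    ifz (t ∸ 3) ⟪ π₂ y , K ⟫ $
    ifz (t ∸ 4) (ifz a ⟪ y , cons ⟪ t , d ⟫ K ⟫ ⟪ pred a , K ⟫) $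
    ifz (t ∸ 5) ⟪ y , cons (π₁ d) (cons ⟪ 9 , ⟪ π₂ d , y ⟫ ⟫ K) ⟫ $
    ifz (t ∸ 6) ⟪ y , cons (π₂ d) (cons (π₁ d) K) ⟫ $
    ifz (t ∸ 7) ⟪ π₁ y , cons (π₁ d) (cons ⟪ 11 , ⟪ ⟪ π₂ d , π₁ y ⟫ , ⟪ 0 , π₂ y ⟫ ⟫ ⟫ K) ⟫ $
    ifz (t ∸ 8) ⟪ ⟪ y , 0 ⟫ , cons d (cons ⟪ 12 , ⟪ ⟪ d , y ⟫ , 0 ⟫ ⟫ K) ⟫ $
    ifz (t ∸ 9) ⟪ π₂ d , cons (π₁ d) (cons ⟪ 10 , y ⟫ K) ⟫ $
    ifz (t ∸ 10) ⟪ ⟪ d , y ⟫ , K ⟫ $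
    ifz (t ∸ 11)
      (ifz (π₂ (π₂ d)) ⟪ y , K ⟫
        ⟪ ⟪ π₂ (π₁ d) , ⟪ π₁ (π₂ d) , y ⟫ ⟫
        , cons (π₁ (π₁ d)) (cons ⟪ 11 , ⟪ π₁ d , ⟪ suc (π₁ (π₂ d)) , pred (π₂ (π₂ d)) ⟫ ⟫ ⟫ K) ⟫) $
    ifz y ⟪ π₂ d , K ⟫
      ⟪ ⟪ π₂ (π₁ d) , suc (π₂ d) ⟫
      , cons (π₁ (π₁ d)) (cons ⟪ 12 , ⟪ π₁ d , suc (π₂ d) ⟫ ⟫ K) ⟫

step : (ℕ → ℕ) → ℕ → ℕ
step o p = ifz (π₂ p) p (exec (o (π₁ p)) (π₁ (hd (π₂ p))) (π₂ (hd (π₂ p))) (π₁ p) (tl (π₂ p)))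

opaque
  unfolding exec
  execᶜ : ∀ {a t d y K} → Comp gs a → Comp gs t → Comp gs d → Comp gs y → Comp gs K →
          Comp gs (λ x → exec (a x) (t x) (d x) (y x) (K x))
  execᶜ A T D Y K =
    ifzᶜ T ⟪ constᶜ 0 , K ⟫ᶜ $
    ifzᶜ (T ∸ᶜ constᶜ 1) ⟪ sucᶜ ∙ Y , K ⟫ᶜ $
    ifzᶜ (T ∸ᶜ constᶜ 2) ⟪ π₁ᶜ ∙ Y , K ⟫ᶜ $
    ifzᶜ (T ∸ᶜ constᶜ 3) ⟪ π₂ᶜ ∙ Y , K ⟫ᶜ $
    ifzᶜ (T ∸ᶜ constᶜ 4) (ifzᶜ A ⟪ Y , consᶜ ⟪ T , D ⟫ᶜ K ⟫ᶜ ⟪ predᶜ ∙ A , K ⟫ᶜ) $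
    ifzᶜ (T ∸ᶜ constᶜ 5) ⟪ Y , consᶜ (π₁ᶜ ∙ D) (consᶜ ⟪ constᶜ 9 , ⟪ π₂ᶜ ∙ D , Y ⟫ᶜ ⟫ᶜ K) ⟫ᶜ $
    ifzᶜ (T ∸ᶜ constᶜ 6) ⟪ Y , consᶜ (π₂ᶜ ∙ D) (consᶜ (π₁ᶜ ∙ D) K) ⟫ᶜ $
    ifzᶜ (T ∸ᶜ constᶜ 7) ⟪ π₁ᶜ ∙ Y , consᶜ (π₁ᶜ ∙ D) (consᶜ ⟪ constᶜ 11 , ⟪ ⟪ π₂ᶜ ∙ D , π₁ᶜ ∙ Y ⟫ᶜ , ⟪ constᶜ 0 , π₂ᶜ ∙ Y ⟫ᶜ ⟫ᶜ ⟫ᶜ K) ⟫ᶜ $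
    ifzᶜ (T ∸ᶜ constᶜ 8) ⟪ ⟪ Y , constᶜ 0 ⟫ᶜ , consᶜ D (consᶜ ⟪ constᶜ 12 , ⟪ ⟪ D , Y ⟫ᶜ , constᶜ 0 ⟫ᶜ ⟫ᶜ K) ⟫ᶜ $
    ifzᶜ (T ∸ᶜ constᶜ 9) ⟪ π₂ᶜ ∙ D , consᶜ (π₁ᶜ ∙ D) (consᶜ ⟪ constᶜ 10 , Y ⟫ᶜ K) ⟫ᶜ $
    ifzᶜ (T ∸ᶜ constᶜ 10) ⟪ ⟪ D , Y ⟫ᶜ , K ⟫ᶜ $
    ifzᶜ (T ∸ᶜ constᶜ 11)
      (ifzᶜ (π₂ᶜ ∙ π₂ᶜ ∙ D) ⟪ Y , K ⟫ᶜ
        ⟪ ⟪ π₂ᶜ ∙ π₁ᶜ ∙ D , ⟪ π₁ᶜ ∙ π₂ᶜ ∙ D , Y ⟫ᶜ ⟫ᶜ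
        , consᶜ (π₁ᶜ ∙ π₁ᶜ ∙ D) (consᶜ ⟪ constᶜ 11 , ⟪ π₁ᶜ ∙ D , ⟪ sucᶜ ∙ π₁ᶜ ∙ π₂ᶜ ∙ D , predᶜ ∙ π₂ᶜ ∙ π₂ᶜ ∙ D ⟫ᶜ ⟫ᶜ ⟫ᶜ K) ⟫ᶜ) $
    ifzᶜ Y ⟪ π₂ᶜ ∙ D , K ⟫ᶜ
      ⟪ ⟪ π₂ᶜ ∙ π₁ᶜ ∙ D , sucᶜ ∙ π₂ᶜ ∙ D ⟫ᶜ
      , consᶜ (π₁ᶜ ∙ π₁ᶜ ∙ D) (consᶜ ⟪ constᶜ 12 , ⟪ π₁ᶜ ∙ D , sucᶜ ∙ π₂ᶜ ∙ D ⟫ᶜ ⟫ᶜ K) ⟫ᶜ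

opaque
  run : (ℕ → ℕ) → ℕ → ℕ → ℕ
  run o s p = iter (step o) p s

  runᶜ : ∀ {β s p} → Comp gs β → Comp gs s → Comp gs p → Comp gs (λ x → run (nthN (β x)) (s x) (p x))
  runᶜ {gs = gs} B S P = iterᶜ {f₂ = λ β → step (nthN β)} (curried stepᶜ) B P S
    where
    stepᶜ : Comp gs (λ q → step (nthN (π₁ q)) (π₂ q))
    stepᶜ = ifzᶜ (π₂ᶜ ∙ π₂ᶜ) π₂ᶜ $
      execᶜ (nthNᶜ π₁ᶜ (π₁ᶜ ∙ π₂ᶜ)) (π₁ᶜ ∙ hdᶜ ∙ π₂ᶜ ∙ π₂ᶜ) (π₂ᶜ ∙ hdᶜ ∙ π₂ᶜ ∙ π₂ᶜ) (π₁ᶜ ∙ π₂ᶜ) (tlᶜ ∙ π₂ᶜ ∙ π₂ᶜ)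

module _ (o : ℕ → ℕ) where

  opaque
    unfolding run

    run-+ : ∀ s s′ p → run o (s + s′) p ≡ run o s (run o s′ p)
    run-+ zero    s′ p = refl
    run-+ (suc s) s′ p = cong (step o) (run-+ s s′ p)

    step-halted : ∀ {p} → π₂ p ≡ 0 → step o p ≡ p
    step-halted = ifz-≡

    run-halted : ∀ s {p} → π₂ p ≡ 0 → run o s p ≡ p
    run-halted zero    h = refl
    run-halted (suc s) h = trans (cong (step o) (run-halted s h)) (step-halted h)

    halted-≤ : ∀ {s s′ p} → s ≤ s′ → π₂ (run o s p) ≡ 0 → run o s′ p ≡ run o s p
    halted-≤ {s} {s′} {p} le h =
      trans (cong (λ s → run o s p) (sym (m∸n+n≡m le))) (trans (run-+ (s′ ∸ s) s p) (run-halted (s′ ∸ s) h))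

    halted-unique : ∀ {s s′ p} → π₂ (run o s p) ≡ 0 → π₂ (run o s′ p) ≡ 0 → run o s p ≡ run o s′ p
    halted-unique {s} {s′} h h′ with ≤-total s s′
    ... | inj₁ le = sym (halted-≤ le h)
    ... | inj₂ le = halted-≤ le h′

  step-frame : ∀ t d y K → step o ⟪ y , cons ⟨ t , d ⟩ K ⟫ ≡ exec (o y) t d y K
  step-frame t d y K rewrite ⟨,⟩-⟪,⟫ t d | π₂-⟪,⟫ y (cons ⟪ t , d ⟫ K) | π₁-⟪,⟫ y (cons ⟪ t , d ⟫ K)
                           | hd-cons ⟪ t , d ⟫ K | tl-cons ⟪ t , d ⟫ K | π₁-⟪,⟫ t d | π₂-⟪,⟫ t d = ifz-≢ cons≢0

  _⟶_ : ℕ → ℕ → Set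
  p ⟶ q = ∃[ s ] run o s p ≡ q

  opaque
    unfolding run

    ⟶-refl : ∀ {p} → p ⟶ p
    ⟶-refl = 0 , refl

    ⟶-≡ : ∀ {p q} → p ≡ q → p ⟶ q
    ⟶-≡ eq = 0 , eq

    ⟶-step : ∀ {p q} → step o p ≡ q → p ⟶ q
    ⟶-step eq = 1 , eq

  ⟶-trans : ∀ {p q r} → p ⟶ q → q ⟶ r → p ⟶ r
  ⟶-trans {p} (s , refl) (s′ , e) = s′ + s , trans (run-+ s′ s p) e

  first : ∀ {y} t d {K q r} → exec (o y) t d y K ≡ q → q ⟶ r → ⟪ y , cons ⟨ t , d ⟩ K ⟫ ⟶ r
  first {y} t d {K} eq p = ⟶-trans (⟶-step (trans (step-frame t d y K) eq)) p

  first′ : ∀ {y} t d {K q r} → exec (o y) t d y K ≡ q → q ⟶ r → ⟪ y , cons ⟪ t , d ⟫ K ⟫ ⟶ r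
  first′ {y} t d {K} {r = r} eq p = subst (λ w → ⟪ y , cons w K ⟫ ⟶ r) (⟨,⟩-⟪,⟫ t d) (first t d eq p)

  opaque
    unfolding exec
    -- The stack `K` is arbitrary so that a subprogram can run on top of the frame that resumes its
    -- parent. The machine has a single oracle and ignores oracle numbers, hence the hypothesis on
    -- `gs`: it is vacuous for `k` equal to 0 and fixes `o` for `k` equal to 1.
    complete : ∀ {gs : Vec Baire k} → (∀ i q → o q ≡ suc (lookup gs i q)) →
               ∀ (c : Code k) {x y} → ⟦ c ⟧ gs x y → ∀ K → ⟪ x , cons (encode c) K ⟫ ⟶ ⟪ y , K ⟫
    complete O zer refl K = first 0 0 refl ⟶-refl
    complete O suc refl K = first 1 0 refl ⟶-refl
    complete O fst refl K = first 2 0 refl (⟶-≡ (cong (λ z → ⟪ z , K ⟫) π₁-unpair))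
      where
      opaque
        unfolding π₁
        π₁-unpair : ∀ {x} → π₁ x ≡ proj₁ (unpair x)
        π₁-unpair = refl
    complete O snd refl K = first 3 0 refl (⟶-≡ (cong (λ z → ⟪ z , K ⟫) π₂-unpair))
      where
      opaque
        unfolding π₂
        π₂-unpair : ∀ {x} → π₂ x ≡ proj₂ (unpair x)
        π₂-unpair = refl
    complete O (oracle i) {x} refl K = first 4 (toℕ i) (cong (λ a → exec a 4 (toℕ i) x K) (O i x)) ⟶-refl
    complete O (pair c d) {x} (a , b , p , q , refl) K =
      first 5 _ eq₁ $ ⟶-trans (complete O c p _) $
      first′ 9 _ eq₂ $ ⟶-trans (complete O d q _) $
      first′ 10 a refl (⟶-≡ (cong (λ z → ⟪ z , K ⟫) (sym (⟨,⟩-⟪,⟫ a b))))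
      where
      eq₁ : exec (o x) 5 ⟨ encode c , encode d ⟩ x K ≡ ⟪ x , cons (encode c) (cons ⟪ 9 , ⟪ encode d , x ⟫ ⟫ K) ⟫
      eq₁ rewrite ⟨,⟩-⟪,⟫ (encode c) (encode d) | π₁-⟪,⟫ (encode c) (encode d) | π₂-⟪,⟫ (encode c) (encode d) = refl
      eq₂ : exec (o a) 9 ⟪ encode d , x ⟫ a K ≡ ⟪ x , cons (encode d) (cons ⟪ 10 , a ⟫ K) ⟫
      eq₂ rewrite π₁-⟪,⟫ (encode d) x | π₂-⟪,⟫ (encode d) x = refl
    complete O (comp c d) {x} (z , p , q) K = first 6 _ eq $ ⟶-trans (complete O d p _) (complete O c q K)
      where
      eq : exec (o x) 6 ⟨ encode c , encode d ⟩ x K ≡ ⟪ x , cons (encode d) (cons (encode c) K) ⟫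
      eq rewrite ⟨,⟩-⟪,⟫ (encode c) (encode d) | π₁-⟪,⟫ (encode c) (encode d) | π₂-⟪,⟫ (encode c) (encode d) = refl
    complete {gs = gs} O (prec c d) {x} {y} graph K =
      first 7 _ start (⟶-trans (subst (λ n → ⟪ π₁ x , cons (encode c) (cons (frame 0 n) K) ⟫ ⟶ ⟪ y , cons (frame (π₂ x) 0) K ⟫)
                             (+-identityʳ (π₂ x)) (to (π₂ x) 0 (prec-graph⁻ x graph)))
                   (first′ 11 _ stop ⟶-refl))
      where
      frame : ℕ → ℕ → ℕ
      frame j r = ⟪ 11 , ⟪ ⟪ encode d , π₁ x ⟫ , ⟪ j , r ⟫ ⟫ ⟫
      start : exec (o x) 7 ⟨ encode c , encode d ⟩ x K ≡ ⟪ π₁ x , cons (encode c) (cons (frame 0 (π₂ x)) K) ⟫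
      start rewrite ⟨,⟩-⟪,⟫ (encode c) (encode d) | π₁-⟪,⟫ (encode c) (encode d) | π₂-⟪,⟫ (encode c) (encode d) = refl
      opaque
        unfolding π₁ π₂
        prec-graph⁻ : ∀ p → ⟦ prec c d ⟧ gs p y → PrecGraph c d gs (π₁ p) (π₂ p) y
        prec-graph⁻ p graph = graph
      again : ∀ {z j r} → exec (o z) 11 ⟪ ⟪ encode d , π₁ x ⟫ , ⟪ j , suc r ⟫ ⟫ z K ≡
              ⟪ ⟪ π₁ x , ⟪ j , z ⟫ ⟫ , cons (encode d) (cons (frame (suc j) r) K) ⟫
      again {z} {j} {r} rewrite π₁-⟪,⟫ ⟪ encode d , π₁ x ⟫ ⟪ j , suc r ⟫ | π₂-⟪,⟫ ⟪ encode d , π₁ x ⟫ ⟪ j , suc r ⟫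
        | π₁-⟪,⟫ (encode d) (π₁ x) | π₂-⟪,⟫ (encode d) (π₁ x) | π₁-⟪,⟫ j (suc r) | π₂-⟪,⟫ j (suc r) = refl
      stop : ∀ {z j} → exec (o z) 11 ⟪ ⟪ encode d , π₁ x ⟫ , ⟪ j , 0 ⟫ ⟫ z K ≡ ⟪ z , K ⟫
      stop {z} {j} rewrite π₂-⟪,⟫ ⟪ encode d , π₁ x ⟫ ⟪ j , 0 ⟫ | π₂-⟪,⟫ j 0 = refl
      to : ∀ j r {z} → PrecGraph c d gs (π₁ x) j z →
           ⟪ π₁ x , cons (encode c) (cons (frame 0 (j + r)) K) ⟫ ⟶ ⟪ z , cons (frame j r) K ⟫
      to zero    r p = complete O c p _
      to (suc j) r {z} (w , p , q) =
        ⟶-trans (subst (λ n → ⟪ π₁ x , cons (encode c) (cons (frame 0 n) K) ⟫ ⟶ ⟪ w , cons (frame j (suc r)) K ⟫)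
                        (+-suc j r) (to j (suc r) p)) $
        first′ 11 _ (trans again (cong (λ v → ⟪ v , cons (encode d) (cons (frame (suc j) r) K) ⟫)
                              (sym (trans (⟨,⟩-⟪,⟫ (π₁ x) _) (cong (⟪ π₁ x ,_⟫) (⟨,⟩-⟪,⟫ j w)))))) $
        complete O d q _
    complete {gs = gs} O (min c) {x} {y} (p , q) K = first 8 (encode c) refl (loop y 0 (+-identityʳ y))
      where
      frame : ℕ → ℕ
      frame m = ⟪ 12 , ⟪ ⟪ encode c , x ⟫ , m ⟫ ⟫
      again : ∀ {z m} → exec (o (suc z)) 12 ⟪ ⟪ encode c , x ⟫ , m ⟫ (suc z) K ≡
              ⟪ ⟪ x , suc m ⟫ , cons (encode c) (cons (frame (suc m)) K) ⟫
      again {z} {m} rewrite π₁-⟪,⟫ ⟪ encode c , x ⟫ m | π₂-⟪,⟫ ⟪ encode c , x ⟫ m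
        | π₁-⟪,⟫ (encode c) x | π₂-⟪,⟫ (encode c) x = refl
      loop : ∀ n m → n + m ≡ y → ⟪ ⟪ x , m ⟫ , cons (encode c) (cons (frame m) K) ⟫ ⟶ ⟪ y , K ⟫
      loop zero    m refl =
        subst (λ v → ⟪ v , cons (encode c) (cons (frame m) K) ⟫ ⟶ ⟪ m , K ⟫) (⟨,⟩-⟪,⟫ x m) $
        ⟶-trans (complete O c p _) $ first′ 12 _ refl (⟶-≡ (cong (λ v → ⟪ v , K ⟫) (π₂-⟪,⟫ ⟪ encode c , x ⟫ m)))
      loop (suc n) m e =
        subst (λ v → ⟪ v , cons (encode c) (cons (frame m) K) ⟫ ⟶ ⟪ y , K ⟫) (⟨,⟩-⟪,⟫ x m) $
        ⟶-trans (complete O c (proj₂ (q m m<y)) _) $ first′ 12 _ (again {proj₁ (q m m<y)}) $ loop n (suc m) (trans (+-suc n m) e)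
        where
        m<y : m < y
        m<y = subst (m <_) e (s≤s (m≤n+m m n))

_⊑ᵒ_ : (ℕ → ℕ) → (ℕ → ℕ) → Set
o ⊑ᵒ o′ = ∀ q {v} → o q ≡ suc v → o′ q ≡ suc v

opaque
  unfolding exec
  exec-undefined : ∀ t {d y K} a → exec a t d y K ≡ exec 0 t d y K ⊎ t ≡ 4
  exec-undefined 0 _ = inj₁ refl
  exec-undefined 1 _ = inj₁ refl
  exec-undefined 2 _ = inj₁ refl
  exec-undefined 3 _ = inj₁ refl
  exec-undefined 4 _ = inj₂ refl
  exec-undefined (suc (suc (suc (suc (suc t))))) _ = inj₁ refl

  exec-stuck : ∀ d y K → exec 0 4 d y K ≡ ⟪ y , cons ⟪ 4 , d ⟫ K ⟫
  exec-stuck d y K = refl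

-- Enlarging the oracle can alter a step only at a query of an undefined value, and there the
-- smaller oracle is stuck in a configuration that has not halted.
step-mono : ∀ {o o′} → o ⊑ᵒ o′ → ∀ p → step o′ p ≡ step o p ⊎ (step o p ≡ p × π₂ p ≢ 0)
step-mono {o} {o′} ext p with π₂ p ≟ 0
... | yes h = inj₁ (trans (step-halted o′ h) (sym (step-halted o h)))
... | no nh with o (π₁ p) in eq
...   | suc v rewrite ext (π₁ p) eq = inj₁ refl
...   | zero with exec-undefined (π₁ (hd (π₂ p))) {π₂ (hd (π₂ p))} {π₁ p} {tl (π₂ p)} (o′ (π₁ p))
...     | inj₁ same = inj₁ (trans (ifz-≢ nh) (trans same (sym (ifz-≢ nh))))
...     | inj₂ t≡4  = inj₂ (trans (ifz-≢ nh) stuck , nh)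
  where
  K = π₂ p
  stuck : exec 0 (π₁ (hd K)) (π₂ (hd K)) (π₁ p) (tl K) ≡ p
  stuck = begin
    exec 0 (π₁ (hd K)) (π₂ (hd K)) (π₁ p) (tl K)
      ≡⟨ cong (λ t → exec 0 t (π₂ (hd K)) (π₁ p) (tl K)) t≡4 ⟩
    exec 0 4 (π₂ (hd K)) (π₁ p) (tl K)
      ≡⟨ exec-stuck (π₂ (hd K)) (π₁ p) (tl K) ⟩
    ⟪ π₁ p , cons ⟪ 4 , π₂ (hd K) ⟫ (tl K) ⟫
      ≡⟨ cong (λ t → ⟪ π₁ p , cons ⟪ t , π₂ (hd K) ⟫ (tl K) ⟫) (sym t≡4) ⟩
    ⟪ π₁ p , cons ⟪ π₁ (hd K) , π₂ (hd K) ⟫ (tl K) ⟫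
      ≡⟨ cong (λ w → ⟪ π₁ p , cons w (tl K) ⟫) (⟪π₁,π₂⟫ (hd K)) ⟩
    ⟪ π₁ p , cons (hd K) (tl K) ⟫
      ≡⟨ cong (λ w → ⟪ π₁ p , w ⟫) (cons-hd-tl nh) ⟩
    ⟪ π₁ p , K ⟫ ≡⟨ ⟪π₁,π₂⟫ p ⟩
    p ∎
    where open ≡-Reasoning

opaque
  unfolding run

  -- A run that halts never meets an undefined query, for it would stay there forever.
  run-mono : ∀ {o o′} → o ⊑ᵒ o′ → ∀ s p → π₂ (run o s p) ≡ 0 → run o′ s p ≡ run o s p
  run-mono ext zero    p h = refl
  run-mono {o} {o′} ext (suc s) p h with step-mono ext p
  ... | inj₁ same = begin
    run o′ (suc s) p    ≡⟨ iter-suc (step o′) p s ⟩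
    run o′ s (step o′ p) ≡⟨ cong (run o′ s) same ⟩
    run o′ s (step o p)  ≡⟨ run-mono ext s (step o p) (trans (cong π₂ (sym (iter-suc (step o) p s))) h) ⟩
    run o s (step o p)   ≡⟨ sym (iter-suc (step o) p s) ⟩
    run o (suc s) p      ∎
    where open ≡-Reasoning
  ... | inj₂ (stuck , nh) = contradiction (trans (cong π₂ (sym (stays (suc s)))) h) nh
    where
    stays : ∀ s → run o s p ≡ p
    stays zero    = refl
    stays (suc s) = trans (cong (step o) (stays s)) stuck

  -- The use principle. Every step looks up the oracle at the current value, whether or not its
  -- frame is a query, so the bound is taken over the values of all configurations of the run.
  run-use : ∀ o s p → ∃[ L ] ∀ o′ → (∀ q → q < L → o′ q ≡ o q) → run o′ s p ≡ run o s p
  run-use o zero    p = 0 , λ _ _ → refl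
  run-use o (suc s) p with L , use ← run-use o s p =
    L ⊔ suc (π₁ (run o s p)) , λ o′ agree →
      trans (cong (step o′) (use o′ λ q lt → agree q (<-≤-trans lt (m≤m⊔n L _))))
            (cong (λ a → ifz K r (exec a (π₁ (hd K)) (π₂ (hd K)) (π₁ r) (tl K))) (agree _ (m≤n⊔m L _)))
    where
    r K : ℕ
    r = run o s p
    K = π₂ r

opaque
  start : ℕ → ℕ → ℕ
  start n x = ⟪ x , cons n 0 ⟫

  startᶜ : Comp gs f → Comp gs φ → Comp gs (λ x → start (f x) (φ x))
  startᶜ F G = ⟪ G , consᶜ F (constᶜ 0) ⟫ᶜ

  start-running : ∀ n x → π₂ (start n x) ≢ 0
  start-running n x z = cons≢0 (trans (sym (π₂-⟪,⟫ x (cons n 0))) z)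

  program-halts : ∀ {o} {gs : Vec Baire k} → (∀ i q → o q ≡ suc (lookup gs i q)) →
                  ∀ (c : Code k) {x y} → ⟦ c ⟧ gs x y → ∃[ s ] run o s (start (encode c) x) ≡ ⟪ y , 0 ⟫
  program-halts {o = o} O c p = complete o O c p 0

opaque
  unfolding run

  run-zero : ∀ o p → run o 0 p ≡ p
  run-zero o p = refl

-- Initial segments of lists and their limits

take-↾ : ∀ {A : Set} (x : ℕ → A) {n L} → n ≤ L → take n (applyUpTo x L) ≡ applyUpTo x n
take-↾ x z≤n      = refl
take-↾ x (s≤s le) = cong (x 0 ∷_) (take-↾ (x ∘ suc) le)

take-++ : ∀ {A : Set} (σ : List A) {γ n} → n ≤ length σ → take n (σ ++ γ) ≡ take n σ
take-++ σ       {n = zero}  _        = refl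
take-++ (v ∷ σ) {n = suc n} (s≤s le) = cong (v ∷_) (take-++ σ le)

length-middle : ∀ {A : Set} (xs : List A) {y ys} → length (xs ++ y ∷ ys) ≡ suc (length (xs ++ ys))
length-middle []       = refl
length-middle (_ ∷ xs) = cong suc (length-middle xs)

length-≤ : ∀ {A : Set} {σ σ′ γ : List A} → σ′ ≡ σ ++ γ → length σ ≤ length σ′
length-≤ {σ = σ} refl = ≤-trans (m≤m+n (length σ) _) (≤-reflexive (sym (length-++ σ)))

↾-++ : ∀ (x : Baire) {n L} → n ≤ L → ∃[ γ ] x ↾ L ≡ (x ↾ n) ++ γ
↾-++ x {n} {L} le = drop n (x ↾ L) , trans (sym (take++drop≡id n (x ↾ L))) (cong (_++ drop n (x ↾ L)) (take-↾ x le))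

nthN-defined : ∀ σ {n} → n < length σ → ∃[ v ] nthN ⌜ σ ⌝ n ≡ suc v
nthN-defined (v ∷ σ) {zero}  _        = v , nthN-zero v σ
nthN-defined (v ∷ σ) {suc n} (s≤s lt) with w , e ← nthN-defined σ lt = w , trans (nthN-suc v σ n) e

nthN-↾⁺ : ∀ (x : Baire) σ → (∀ n → n < length σ → nthN ⌜ σ ⌝ n ≡ suc (x n)) → σ ≡ x ↾ length σ
nthN-↾⁺ x []      e = refl
nthN-↾⁺ x (v ∷ σ) e = cong₂ _∷_ (suc-injective (trans (sym (nthN-zero v σ)) (e 0 (s≤s z≤n))))
  (nthN-↾⁺ (x ∘ suc) σ λ n lt → trans (sym (nthN-suc v σ n)) (e (suc n) (s≤s lt)))

module _ (s : ℕ → List ℕ) (grow : ∀ j → ∃[ γ ] s (suc j) ≡ s j ++ γ) (long : ∀ j → j ≤ length (s j)) where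

  limit-↾ : ∃[ x ] ∀ j → s j ≡ x ↾ length (s j)
  limit-↾ = x , λ j → nthN-↾⁺ x (s j) (agree j)
    where
    x : Baire
    x n = proj₁ (nthN-defined (s (suc n)) (long (suc n)))
    grow′ : ∀ {i j} → i ≤′ j → ∀ n {v} → nthN ⌜ s i ⌝ n ≡ suc v → nthN ⌜ s j ⌝ n ≡ suc v
    grow′ ≤′-refl n e = e
    grow′ (≤′-step {j} p) n e with γ , eq ← grow j =
      trans (cong (λ σ → nthN ⌜ σ ⌝ n) eq) (nthN-++ (s j) γ n (grow′ p n e))
    agree : ∀ j n → n < length (s j) → nthN ⌜ s j ⌝ n ≡ suc (x n)
    agree j n lt with v , e ← nthN-defined (s j) lt with w , e′ ← nthN-defined (s (suc n)) (long (suc n))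
      with ≤-total j (suc n)
    ... | inj₁ le = trans e (trans (sym (grow′ (≤⇒≤′ le) n e)) e′)
    ... | inj₂ le = grow′ (≤⇒≤′ le) n e′

-- Items and histories

-- An item carries a bound c on all levels (cap), its level ℓ, the number n of an
-- oracle-free program, a running time t (0 for commits), a string κ of the
-- tree of P and a string τ of the tree of Q.  A history is a string of items.

opaque
  item : (c ℓ n t κ τ : ℕ) → ℕ
  item c ℓ n t κ τ = ⟪ c , ⟪ ℓ , ⟪ n , ⟪ t , ⟪ κ , τ ⟫ ⟫ ⟫ ⟫ ⟫

  cap lev prog time κ⟨_⟩ τ⟨_⟩ : ℕ → ℕ
  cap m   = π₁ m
  lev m   = π₁ (π₂ m)
  prog m  = π₁ (π₂ (π₂ m))
  time m  = π₁ (π₂ (π₂ (π₂ m)))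
  κ⟨ m ⟩ = π₁ (π₂ (π₂ (π₂ (π₂ m))))
  τ⟨ m ⟩ = π₂ (π₂ (π₂ (π₂ (π₂ m))))

  item-η : ∀ m → item (cap m) (lev m) (prog m) (time m) κ⟨ m ⟩ τ⟨ m ⟩ ≡ m
  item-η m rewrite ⟪π₁,π₂⟫ (π₂ (π₂ (π₂ (π₂ m)))) | ⟪π₁,π₂⟫ (π₂ (π₂ (π₂ m))) | ⟪π₁,π₂⟫ (π₂ (π₂ m))
                 | ⟪π₁,π₂⟫ (π₂ m) = ⟪π₁,π₂⟫ m

module _ (c ℓ n t κ τ : ℕ) where
  opaque
    unfolding item cap
    private
      m : ℕ
      m = item c ℓ n t κ τ
      e₁ : π₂ m ≡ ⟪ ℓ , ⟪ n , ⟪ t , ⟪ κ , τ ⟫ ⟫ ⟫ ⟫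
      e₁ = π₂-⟪,⟫ c _
      e₂ : π₂ (π₂ m) ≡ ⟪ n , ⟪ t , ⟪ κ , τ ⟫ ⟫ ⟫
      e₂ = trans (cong π₂ e₁) (π₂-⟪,⟫ ℓ _)
      e₃ : π₂ (π₂ (π₂ m)) ≡ ⟪ t , ⟪ κ , τ ⟫ ⟫
      e₃ = trans (cong π₂ e₂) (π₂-⟪,⟫ n _)
      e₄ : π₂ (π₂ (π₂ (π₂ m))) ≡ ⟪ κ , τ ⟫
      e₄ = trans (cong π₂ e₃) (π₂-⟪,⟫ t _)

    cap-item : cap (item c ℓ n t κ τ) ≡ c
    cap-item = π₁-⟪,⟫ c _

    lev-item : lev (item c ℓ n t κ τ) ≡ ℓ
    lev-item = trans (cong π₁ e₁) (π₁-⟪,⟫ ℓ _)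

    prog-item : prog (item c ℓ n t κ τ) ≡ n
    prog-item = trans (cong π₁ e₂) (π₁-⟪,⟫ n _)

    time-item : time (item c ℓ n t κ τ) ≡ t
    time-item = trans (cong π₁ e₃) (π₁-⟪,⟫ t _)

    κ-item : κ⟨ item c ℓ n t κ τ ⟩ ≡ κ
    κ-item = trans (cong π₁ e₄) (π₁-⟪,⟫ κ τ)

    τ-item : τ⟨ item c ℓ n t κ τ ⟩ ≡ τ
    τ-item = trans (cong π₂ e₄) (π₂-⟪,⟫ κ τ)

opaque
  unfolding item cap

  κ-0 : κ⟨ 0 ⟩ ≡ 0
  κ-0 rewrite π₂-0 | π₂-0 | π₂-0 | π₂-0 = π₁-0

  itemᶜ : ∀ {c ℓ n t κ τ} → Comp gs c → Comp gs ℓ → Comp gs n → Comp gs t → Comp gs κ → Comp gs τ →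
          Comp gs (λ x → item (c x) (ℓ x) (n x) (t x) (κ x) (τ x))
  itemᶜ C L N T K U = ⟪ C , ⟪ L , ⟪ N , ⟪ T , ⟪ K , U ⟫ᶜ ⟫ᶜ ⟫ᶜ ⟫ᶜ ⟫ᶜ

  capᶜ : Comp gs cap
  capᶜ = π₁ᶜ

  levᶜ : Comp gs lev
  levᶜ = π₁ᶜ ∙ π₂ᶜ

  progᶜ : Comp gs prog
  progᶜ = π₁ᶜ ∙ π₂ᶜ ∙ π₂ᶜ

  timeᶜ : Comp gs time
  timeᶜ = π₁ᶜ ∙ π₂ᶜ ∙ π₂ᶜ ∙ π₂ᶜ

  κᶜ : Comp gs κ⟨_⟩
  κᶜ = π₁ᶜ ∙ π₂ᶜ ∙ π₂ᶜ ∙ π₂ᶜ ∙ π₂ᶜ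

  τᶜ : Comp gs τ⟨_⟩
  τᶜ = π₂ᶜ ∙ π₂ᶜ ∙ π₂ᶜ ∙ π₂ᶜ ∙ π₂ᶜ

dropStep : ℕ → ℕ → ℕ
dropStep ℓ h = ifz (suc ℓ ∸ lev (hd h)) (tl h) h

data Drops (ℓ : ℕ) : ℕ → ℕ → Set where
  nil  : Drops ℓ 0 0
  stop : ∀ {m h} → lev m ≤ ℓ → Drops ℓ (cons m h) (cons m h)
  skip : ∀ {m h g} → ℓ < lev m → Drops ℓ h g → Drops ℓ (cons m h) g

opaque
  -- A history has at most as many items as its code, so `h` rounds reach the fixed point of
  -- `dropStep`.
  dropN : ℕ → ℕ → ℕ
  dropN ℓ h = iter (dropStep ℓ) h h

  dropNᶜ : Comp gs f → Comp gs φ → Comp gs (λ x → dropN (f x) (φ x))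
  dropNᶜ L H = iterᶜ {f₂ = dropStep}
    (curried (ifzᶜ ((sucᶜ ∙ π₁ᶜ) ∸ᶜ (levᶜ ∙ hdᶜ ∙ π₂ᶜ)) (tlᶜ ∙ π₂ᶜ) π₂ᶜ)) L H H

  Drops⇒dropN : ∀ {ℓ h g} → Drops ℓ h g → dropN ℓ h ≡ g
  Drops⇒dropN {ℓ} {h} drops = go drops h ≤-refl
    where
    fixed : ∀ {h} → dropStep ℓ h ≡ h → ∀ n → iter (dropStep ℓ) h n ≡ h
    fixed e zero    = refl
    fixed e (suc n) = trans (cong (dropStep ℓ) (fixed e n)) e
    go : ∀ {h g} → Drops ℓ h g → ∀ n → h ≤ n → iter (dropStep ℓ) h n ≡ g
    go nil n _ = fixed (lemma (suc ℓ ∸ lev (hd 0))) n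
      where
      lemma : ∀ d → ifz d (tl 0) 0 ≡ 0
      lemma zero    = tl-0
      lemma (suc _) = refl
    go (stop {m} {h} le) n _ = fixed (ifz-≢ neq) n
      where
      neq : suc ℓ ∸ lev (hd (cons m h)) ≢ 0
      neq e rewrite hd-cons m h = <⇒≱ (s≤s le) (m∸n≡0⇒m≤n e)
    go (skip {m} {h} lt drops) zero    le = contradiction (n≤0⇒n≡0 le) cons≢0
    go (skip {m} {h} lt drops) (suc n) le =
      trans (iter-suc (dropStep ℓ) (cons m h) n)
        (trans (cong (λ z → iter (dropStep ℓ) z n) (trans (ifz-≡ eq) (tl-cons m h)))
          (go drops n (≤-pred (≤-trans (z<cons m h) le))))
      where
      eq : suc ℓ ∸ lev (hd (cons m h)) ≡ 0
      eq rewrite hd-cons m h = m≤n⇒m∸n≡0 lt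

drops : ∀ ℓ h → ∃[ g ] Drops ℓ h g
drops ℓ = cons-ind (λ h → ∃[ g ] Drops ℓ h g) (0 , nil) λ m h (g , d) → case m h g d (≤-<-connex (lev m) ℓ)
  where
  case : ∀ m h g → Drops ℓ h g → lev m ≤ ℓ ⊎ ℓ < lev m → ∃[ g ] Drops ℓ (cons m h) g
  case m h g d (inj₁ le) = cons m h , stop le
  case m h g d (inj₂ gt) = g , skip gt d

dropN-Drops : ∀ ℓ h → Drops ℓ h (dropN ℓ h)
dropN-Drops ℓ h with g , d ← drops ℓ h = subst (Drops ℓ h) (sym (Drops⇒dropN d)) d

0≢suc : ∀ {n} → 0 ≡ suc n → ⊥
0≢suc ()

sum≡0 : ∀ {m n} → m + n ≡ 0 → m ≡ 0 × n ≡ 0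
sum≡0 {m} e = m+n≡0⇒m≡0 m e , m+n≡0⇒n≡0 m e

sum≡0⁻ : ∀ {m n} → m ≡ 0 → n ≡ 0 → m + n ≡ 0
sum≡0⁻ refl refl = refl

ifz-1-0⁻ : ∀ {n} → n ≢ 0 → ifz n 1 0 ≡ 0
ifz-1-0⁻ = ifz-≢

-- The set of points that parse into legal items

module Construction (tP tQ : ℕ → ℕ) (tPᶜ : Comp Vec.[] tP) (tQᶜ : Comp Vec.[] tQ) where

  o∅ : ℕ → ℕ
  o∅ = nthN 0

  -- The program is handed the base as an argument. With the base built in, it would have to contain
  -- its own number, because the last item of the base names the program.
  input : ℕ → ℕ
  input g = ⟪ g , τ⟨ hd g ⟩ ⟫

  -- A commit adds an entry to κ and installs a program at its level.  A reset of
  -- level ℓ restores the κ of the base g, the history up to the last item of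
  -- level at most ℓ.  Its certificate is that the program installed at g outputs
  -- the current history h and one more entry of τ.  As t is the exact halting
  -- time, the item is determined by g.

  record Commit (m h : ℕ) : Set where
    constructor mkCommit
    field
      time≡0 : time m ≡ 0
      κ≢0    : κ⟨ m ⟩ ≢ 0
      κ-tail : tl κ⟨ m ⟩ ≡ κ⟨ hd h ⟩
      κ∈P    : tP κ⟨ m ⟩ ≡ 0
      τ≡0    : τ⟨ m ⟩ ≡ 0

  record Reset (m h g : ℕ) : Set where
    constructor mkReset
    field
      time≢0   : time m ≢ 0
      same-n   : prog m ≡ prog (hd g)
      same-κ   : κ⟨ m ⟩ ≡ κ⟨ hd g ⟩
      τ≢0      : τ⟨ m ⟩ ≢ 0
      τ-tail   : tl τ⟨ m ⟩ ≡ τ⟨ hd g ⟩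
      τ∈Q      : tQ τ⟨ m ⟩ ≡ 0
      halts    : run o∅ (time m) (start (prog m) (input g)) ≡ ⟪ ⟪ h , hd τ⟨ m ⟩ ⟫ , 0 ⟫
      halts-at : π₂ (run o∅ (pred (time m)) (start (prog m) (input g))) ≢ 0

  record Check (m h : ℕ) : Set where
    constructor mkCheck
    field
      same-cap : h ≢ 0 → cap m ≡ cap (hd h)
      lev≤cap  : lev m ≤ cap m
      kind     : Commit m h ⊎ Reset m h (dropN (lev m) h)

  private
    commitTest : ℕ → ℕ → ℕ
    commitTest m h = ifz κ⟨ m ⟩ 1 0 + dist (tl κ⟨ m ⟩) κ⟨ hd h ⟩ + tP κ⟨ m ⟩ + τ⟨ m ⟩

    resetTest : ℕ → ℕ → ℕ → ℕ
    resetTest m h g =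
      dist (prog m) (prog (hd g)) + dist κ⟨ m ⟩ κ⟨ hd g ⟩ + ifz τ⟨ m ⟩ 1 0 + dist (tl τ⟨ m ⟩) τ⟨ hd g ⟩ + tQ τ⟨ m ⟩ +
      dist (run o∅ (time m) (start (prog m) (input g))) ⟪ ⟪ h , hd τ⟨ m ⟩ ⟫ , 0 ⟫ +
      ifz (π₂ (run o∅ (pred (time m)) (start (prog m) (input g)))) 1 0

  opaque
    check : ℕ → ℕ → ℕ
    check m h = ifz h 0 (dist (cap m) (cap (hd h))) + (lev m ∸ cap m) +
                ifz (time m) (commitTest m h) (resetTest m h (dropN (lev m) h))

    checkᶜ : Comp Vec.[] f → Comp Vec.[] φ → Comp Vec.[] (λ x → check (f x) (φ x))
    checkᶜ {f = f} {φ} M H =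
      ifzᶜ H (constᶜ 0) (distᶜ (capᶜ ∙ M) (capᶜ ∙ hdᶜ ∙ H)) +ᶜ ((levᶜ ∙ M) ∸ᶜ (capᶜ ∙ M)) +ᶜ
      ifzᶜ (timeᶜ ∙ M)
        (ifzᶜ (κᶜ ∙ M) (constᶜ 1) (constᶜ 0) +ᶜ distᶜ (tlᶜ ∙ κᶜ ∙ M) (κᶜ ∙ hdᶜ ∙ H) +ᶜ tPᶜ ∙ κᶜ ∙ M +ᶜ τᶜ ∙ M)
        (distᶜ (progᶜ ∙ M) (progᶜ ∙ hdᶜ ∙ G) +ᶜ distᶜ (κᶜ ∙ M) (κᶜ ∙ hdᶜ ∙ G) +ᶜ ifzᶜ (τᶜ ∙ M) (constᶜ 1) (constᶜ 0) +ᶜ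
         distᶜ (tlᶜ ∙ τᶜ ∙ M) (τᶜ ∙ hdᶜ ∙ G) +ᶜ tQᶜ ∙ τᶜ ∙ M +ᶜ
         distᶜ (runᶜ (constᶜ 0) (timeᶜ ∙ M) S) ⟪ ⟪ H , hdᶜ ∙ τᶜ ∙ M ⟫ᶜ , constᶜ 0 ⟫ᶜ +ᶜ
         ifzᶜ (π₂ᶜ ∙ runᶜ (constᶜ 0) (predᶜ ∙ timeᶜ ∙ M) S) (constᶜ 1) (constᶜ 0))
      where
      G : Comp Vec.[] (λ x → dropN (lev (f x)) (φ x))
      G = dropNᶜ (levᶜ ∙ M) H
      S : Comp Vec.[] (λ x → start (prog (f x)) (input (dropN (lev (f x)) (φ x))))
      S = startᶜ (progᶜ ∙ M) ⟪ G , τᶜ ∙ hdᶜ ∙ G ⟫ᶜ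

    check⇒ : ∀ {m h} → check m h ≡ 0 → Check m h
    check⇒ {m} {h} e with e₁₂ , e₃ ← sum≡0 e with e₁ , e₂ ← sum≡0 e₁₂ =
      mkCheck (λ h≢0 → dist≡0 (trans (sym (ifz-≢ h≢0)) e₁)) (m∸n≡0⇒m≤n e₂) (kind (time m ≟ 0))
      where
      b : ℕ
      b = dropN (lev m) h
      kind : Dec (time m ≡ 0) → Commit m h ⊎ Reset m h b
      kind (yes t≡0)
        with ek , e₄ ← sum≡0 {ifz κ⟨ m ⟩ 1 0 + dist (tl κ⟨ m ⟩) κ⟨ hd h ⟩ + tP κ⟨ m ⟩} (trans (sym (ifz-≡ t≡0)) e₃)
        with ej , e₃ ← sum≡0 {ifz κ⟨ m ⟩ 1 0 + dist (tl κ⟨ m ⟩) κ⟨ hd h ⟩} ek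
        with e₁ , e₂ ← sum≡0 {ifz κ⟨ m ⟩ 1 0} ej = inj₁ (mkCommit t≡0 (ifz-1-0 _ e₁) (dist≡0 e₂) e₃ e₄)
      kind (no t≢0)
        with ek , e₇ ← sum≡0 {dist (prog m) (prog (hd b)) + dist κ⟨ m ⟩ κ⟨ hd b ⟩ + ifz τ⟨ m ⟩ 1 0 + dist (tl τ⟨ m ⟩) τ⟨ hd b ⟩ + tQ τ⟨ m ⟩ +
                               dist (run o∅ (time m) (start (prog m) (input b))) ⟪ ⟪ h , hd τ⟨ m ⟩ ⟫ , 0 ⟫} (trans (sym (ifz-≢ t≢0)) e₃)
        with ej , e₆ ← sum≡0 {dist (prog m) (prog (hd b)) + dist κ⟨ m ⟩ κ⟨ hd b ⟩ + ifz τ⟨ m ⟩ 1 0 + dist (tl τ⟨ m ⟩) τ⟨ hd b ⟩ + tQ τ⟨ m ⟩} ek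
        with ei , e₅ ← sum≡0 {dist (prog m) (prog (hd b)) + dist κ⟨ m ⟩ κ⟨ hd b ⟩ + ifz τ⟨ m ⟩ 1 0 + dist (tl τ⟨ m ⟩) τ⟨ hd b ⟩} ej
        with eh , e₄ ← sum≡0 {dist (prog m) (prog (hd b)) + dist κ⟨ m ⟩ κ⟨ hd b ⟩ + ifz τ⟨ m ⟩ 1 0} ei
        with eg , e₃ ← sum≡0 {dist (prog m) (prog (hd b)) + dist κ⟨ m ⟩ κ⟨ hd b ⟩} eh
        with e₁ , e₂ ← sum≡0 {dist (prog m) (prog (hd b))} eg =
        inj₂ (mkReset t≢0 (dist≡0 e₁) (dist≡0 e₂) (ifz-1-0 _ e₃) (dist≡0 e₄) e₅ (dist≡0 e₆) (ifz-1-0 _ e₇))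

    check⇐ : ∀ {m h} → Check m h → check m h ≡ 0
    check⇐ {m} {h} (mkCheck e₁ e₂ e₃) = sum≡0⁻ (sum≡0⁻ (cap-ok (h ≟ 0)) (m≤n⇒m∸n≡0 e₂)) (kind-ok e₃)
      where
      cap-ok : Dec (h ≡ 0) → ifz h 0 (dist (cap m) (cap (hd h))) ≡ 0
      cap-ok (yes h≡0) = ifz-≡ h≡0
      cap-ok (no h≢0)  = trans (ifz-≢ h≢0) (dist-refl (e₁ h≢0))
      kind-ok : Commit m h ⊎ Reset m h (dropN (lev m) h) →
                ifz (time m) (commitTest m h) (resetTest m h (dropN (lev m) h)) ≡ 0
      kind-ok (inj₁ (mkCommit t≡0 a b c d)) =
        trans (ifz-≡ t≡0) (sum≡0⁻ (sum≡0⁻ (sum≡0⁻ (ifz-1-0⁻ a) (dist-refl b)) c) d)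
      kind-ok (inj₂ (mkReset t≢0 a b c d e f g)) =
        trans (ifz-≢ t≢0) (sum≡0⁻ (sum≡0⁻ (sum≡0⁻ (sum≡0⁻ (sum≡0⁻ (sum≡0⁻ (dist-refl a) (dist-refl b)) (ifz-1-0⁻ c))
          (dist-refl d)) e) (dist-refl f)) (ifz-1-0⁻ g))

  -- The parser reads bits.  Each minimal non-member (exit) of the tree of P that it
  -- completes codes the item given by the rank of the exit among all exits.

  opaque
    exit : ℕ → ℕ
    exit z = ifz z 1 0 + tP (tl z) + ifz (tP z) 1 0 + (hd z ∸ 1)

    exit⇒ : ∀ {i η} → exit (cons i η) ≡ 0 → i ≤ 1 × tP η ≡ 0 × tP (cons i η) ≢ 0
    exit⇒ {i} {η} e rewrite hd-cons i η | tl-cons i η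
      with e₁₂₃ , e₄ ← sum≡0 {ifz (cons i η) 1 0 + tP η + ifz (tP (cons i η)) 1 0} e
      with e₁₂ , e₃ ← sum≡0 {ifz (cons i η) 1 0 + tP η} e₁₂₃
      with _ , e₂ ← sum≡0 {ifz (cons i η) 1 0} e₁₂ = m∸n≡0⇒m≤n e₄ , e₂ , ifz-1-0 _ e₃

    exit⇐ : ∀ {i η} → i ≤ 1 → tP η ≡ 0 → tP (cons i η) ≢ 0 → exit (cons i η) ≡ 0
    exit⇐ {i} {η} e₁ e₂ e₃ rewrite hd-cons i η | tl-cons i η =
      sum≡0⁻ (sum≡0⁻ (sum≡0⁻ (ifz-1-0⁻ cons≢0) e₂) (ifz-1-0⁻ e₃)) (m≤n⇒m∸n≡0 e₁)

    exit-0 : exit 0 ≢ 0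
    exit-0 ()

    rank : ℕ → ℕ
    rank = natrec 0 (λ i r → ifz (exit i) (suc r) r)

    rank-exit : ∀ {z} → exit z ≡ 0 → rank (suc z) ≡ suc (rank z)
    rank-exit = ifz-≡

    rank-step : ∀ z → rank z ≤ rank (suc z)
    rank-step z with exit z
    ... | zero  = n≤1+n _
    ... | suc _ = ≤-refl

    rank-onto : ∀ z {m} → m < rank z → ∃[ w ] exit w ≡ 0 × rank w ≡ m
    rank-onto (suc z) lt with exit z in eq
    ... | suc _ = rank-onto z lt
    ... | zero  with m≤n⇒m<n∨m≡n (≤-pred lt)
    ...   | inj₁ lt′  = rank-onto z lt′
    ...   | inj₂ refl = z , eq , refl

    rankᶜ : Comp Vec.[] rank
    rankᶜ = Comp-cong (λ _ → refl) (ap₂ R (constᶜ 0) idᶜ)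
      where
      exitᶜ : Comp Vec.[] exit
      exitᶜ = ifzᶜ idᶜ (constᶜ 1) (constᶜ 0) +ᶜ tPᶜ ∙ tlᶜ +ᶜ ifzᶜ tPᶜ (constᶜ 1) (constᶜ 0) +ᶜ (hdᶜ ∸ᶜ constᶜ 1)
      R : Comp₂ Vec.[] (λ _ → natrec 0 (λ i r → ifz (exit i) (suc r) r))
      R = natrecᶜ {f₃ = λ _ i r → ifz (exit i) (suc r) r} (constᶜ 0)
            (curried (ifzᶜ (exitᶜ ∙ π₁ᶜ ∙ π₂ᶜ) (sucᶜ ∙ π₂ᶜ ∙ π₂ᶜ) (π₂ᶜ ∙ π₂ᶜ)))

  rank-mono : ∀ {z w} → z ≤ w → rank z ≤ rank w
  rank-mono le = go (≤⇒≤′ le)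
    where
    go : ∀ {z w} → z ≤′ w → rank z ≤ rank w
    go ≤′-refl     = ≤-refl
    go (≤′-step p) = ≤-trans (go p) (rank-step _)

  rank-injective : ∀ {z w} → exit z ≡ 0 → exit w ≡ 0 → rank z ≡ rank w → z ≡ w
  rank-injective {z} {w} ez ew e with <-cmp z w
  ... | tri< z<w _ _ = contradiction e (<⇒≢ (≤-trans (≤-reflexive (sym (rank-exit ez))) (rank-mono z<w)))
  ... | tri≈ _ z≡w _ = z≡w
  ... | tri> _ _ w<z = contradiction (sym e) (<⇒≢ (≤-trans (≤-reflexive (sym (rank-exit ew))) (rank-mono w<z)))

  -- The parser state: a count of violations, the part of the current block read so far, and the
  -- items completed before it. The count never decreases, which is why the unspoiled strings form a
  -- tree.
  bad rest hist : ℕ → ℕ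
  bad s  = π₁ s
  rest s = π₁ (π₂ s)
  hist s = π₂ (π₂ s)

  opaque
    δ : ℕ → ℕ → ℕ
    δ s i =
      ifz (tP (cons i (π₁ (π₂ s))))
        ⟪ π₁ s + (i ∸ 1) , ⟪ cons i (π₁ (π₂ s)) , π₂ (π₂ s) ⟫ ⟫
        ⟪ π₁ s + (i ∸ 1) + check (rank (cons i (π₁ (π₂ s)))) (π₂ (π₂ s))
        , ⟪ 0 , cons (rank (cons i (π₁ (π₂ s)))) (π₂ (π₂ s)) ⟫ ⟫

    δᶜ : Comp₂ Vec.[] δ
    δᶜ = curried (ifzᶜ (tPᶜ ∙ E) ⟪ B , ⟪ E , H ⟫ᶜ ⟫ᶜ ⟪ B +ᶜ checkᶜ (rankᶜ ∙ E) H , ⟪ constᶜ 0 , consᶜ (rankᶜ ∙ E) H ⟫ᶜ ⟫ᶜ)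
      where
      E : Comp Vec.[] (λ p → cons (π₂ p) (π₁ (π₂ (π₁ p))))
      E = consᶜ π₂ᶜ (π₁ᶜ ∙ π₂ᶜ ∙ π₁ᶜ)
      H : Comp Vec.[] (λ p → π₂ (π₂ (π₁ p)))
      H = π₂ᶜ ∙ π₂ᶜ ∙ π₁ᶜ
      B : Comp Vec.[] (λ p → π₁ (π₁ p) + (π₂ p ∸ 1))
      B = π₁ᶜ ∙ π₁ᶜ +ᶜ (π₂ᶜ ∸ᶜ constᶜ 1)

    δ-stay : ∀ s i → tP (cons i (rest s)) ≡ 0 → δ s i ≡ ⟪ bad s + (i ∸ 1) , ⟪ cons i (rest s) , hist s ⟫ ⟫
    δ-stay s i = ifz-≡

    δ-emit : ∀ s i → tP (cons i (rest s)) ≢ 0 →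
             δ s i ≡ ⟪ bad s + (i ∸ 1) + check (rank (cons i (rest s))) (hist s) , ⟪ 0 , cons (rank (cons i (rest s))) (hist s) ⟫ ⟫
    δ-emit s i = ifz-≢

  s₀ : ℕ
  s₀ = ⟪ 0 , ⟪ 0 , 0 ⟫ ⟫

  opaque
    parse : List ℕ → ℕ
    parse = foldl δ s₀

    parse-[] : parse [] ≡ s₀
    parse-[] = refl

    parse-∷ʳ : ∀ σ i → parse (σ ∷ʳ i) ≡ δ (parse σ) i
    parse-∷ʳ σ i = foldl-∷ʳ δ s₀ i σ

    parse-++ : ∀ σ τ → parse (σ ++ τ) ≡ foldl δ (parse σ) τ
    parse-++ = foldl-++ δ s₀

    parse-code : ∀ σ → foldN δ s₀ ⌜ σ ⌝ ≡ parse σ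
    parse-code = foldN-code δ s₀

  -- At σ η h: the string σ parses into the items of h followed by the member η of the tree.
  data At : List ℕ → ℕ → ℕ → Set where
    empty : At [] 0 0
    stay  : ∀ {σ η h i} → At σ η h → i ≤ 1 → tP (cons i η) ≡ 0 → At (σ ∷ʳ i) (cons i η) h
    emit  : ∀ {σ η h i} → At σ η h → i ≤ 1 → tP (cons i η) ≢ 0 → Check (rank (cons i η)) h →
            At (σ ∷ʳ i) 0 (cons (rank (cons i η)) h)

  bad-⟪⟫ : ∀ b η h → bad ⟪ b , ⟪ η , h ⟫ ⟫ ≡ b
  bad-⟪⟫ b η h = π₁-⟪,⟫ b _

  rest-⟪⟫ : ∀ b η h → rest ⟪ b , ⟪ η , h ⟫ ⟫ ≡ η
  rest-⟪⟫ b η h = trans (cong π₁ (π₂-⟪,⟫ b _)) (π₁-⟪,⟫ η h)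

  hist-⟪⟫ : ∀ b η h → hist ⟪ b , ⟪ η , h ⟫ ⟫ ≡ h
  hist-⟪⟫ b η h = trans (cong π₂ (π₂-⟪,⟫ b _)) (π₂-⟪,⟫ η h)

  bad-δ : ∀ s i → bad (δ s i) ≡ 0 → bad s ≡ 0
  bad-δ s i e with tP (cons i (rest s)) ≟ 0
  ... | yes t rewrite δ-stay s i t | bad-⟪⟫ (bad s + (i ∸ 1)) (cons i (rest s)) (hist s) = proj₁ (sum≡0 e)
  ... | no t rewrite δ-emit s i t
        | bad-⟪⟫ (bad s + (i ∸ 1) + check (rank (cons i (rest s))) (hist s)) 0 (cons (rank (cons i (rest s))) (hist s)) =
    proj₁ (sum≡0 (proj₁ (sum≡0 {bad s + (i ∸ 1)} e)))

  At⇒parse : ∀ {σ η h} → At σ η h → parse σ ≡ ⟪ 0 , ⟪ η , h ⟫ ⟫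
  At⇒parse empty = parse-[]
  At⇒parse (stay {σ} {η} {h} {i} p i≤1 t) rewrite parse-∷ʳ σ i | At⇒parse p =
    trans (δ-stay s i (trans (cong (λ η → tP (cons i η)) r) t))
      (cong₂ ⟪_,_⟫ (sum≡0⁻ (bad-⟪⟫ 0 η h) (m≤n⇒m∸n≡0 i≤1)) (cong₂ (λ η → ⟪ cons i η ,_⟫) r (hist-⟪⟫ 0 η h)))
    where
    s : ℕ
    s = ⟪ 0 , ⟪ η , h ⟫ ⟫
    r : rest s ≡ η
    r = rest-⟪⟫ 0 η h
  At⇒parse (emit {σ} {η} {h} {i} p i≤1 t c) rewrite parse-∷ʳ σ i | At⇒parse p =
    trans (δ-emit s i (λ e → t (trans (cong (λ η → tP (cons i η)) (sym r)) e)))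
      (cong₂ ⟪_,_⟫
        (sum≡0⁻ (sum≡0⁻ (bad-⟪⟫ 0 η h) (m≤n⇒m∸n≡0 i≤1))
          (trans (cong₂ (λ η → check (rank (cons i η))) r r′) (check⇐ c)))
        (cong₂ (λ η h → ⟪ 0 , cons (rank (cons i η)) h ⟫) r r′))
    where
    s : ℕ
    s = ⟪ 0 , ⟪ η , h ⟫ ⟫
    r : rest s ≡ η
    r = rest-⟪⟫ 0 η h
    r′ : hist s ≡ h
    r′ = hist-⟪⟫ 0 η h

  δ-bits : ∀ s i → bad (δ s i) ≡ 0 → i ≤ 1
  δ-bits s i e with tP (cons i (rest s)) ≟ 0
  ... | yes t rewrite δ-stay s i t | bad-⟪⟫ (bad s + (i ∸ 1)) (cons i (rest s)) (hist s) =
    m∸n≡0⇒m≤n (proj₂ (sum≡0 {bad s} e))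
  ... | no t rewrite δ-emit s i t
        | bad-⟪⟫ (bad s + (i ∸ 1) + check (rank (cons i (rest s))) (hist s)) 0 (cons (rank (cons i (rest s))) (hist s)) =
    m∸n≡0⇒m≤n (proj₂ (sum≡0 {bad s} (proj₁ (sum≡0 {bad s + (i ∸ 1)} e))))

  At-δ : ∀ {σ} s i → At σ (rest s) (hist s) → bad (δ s i) ≡ 0 → At (σ ∷ʳ i) (rest (δ s i)) (hist (δ s i))
  At-δ {σ} s i p e with δ-bits s i e | tP (cons i (rest s)) ≟ 0
  ... | i≤1 | yes t rewrite δ-stay s i t =
    subst₂ (At (σ ∷ʳ i)) (sym (rest-⟪⟫ _ _ _)) (sym (hist-⟪⟫ _ _ _)) (stay p i≤1 t)
  ... | i≤1 | no t rewrite δ-emit s i t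
        | bad-⟪⟫ (bad s + (i ∸ 1) + check (rank (cons i (rest s))) (hist s)) 0 (cons (rank (cons i (rest s))) (hist s)) =
    subst₂ (At (σ ∷ʳ i)) (sym (rest-⟪⟫ _ _ _)) (sym (hist-⟪⟫ _ _ _))
      (emit p i≤1 t (check⇒ (proj₂ (sum≡0 {bad s + (i ∸ 1)} e))))

  parse⇒At : ∀ σ → bad (parse σ) ≡ 0 → At σ (rest (parse σ)) (hist (parse σ))
  parse⇒At σ = go (reverseView σ)
    where
    go : ∀ {σ} → Reverse σ → bad (parse σ) ≡ 0 → At σ (rest (parse σ)) (hist (parse σ))
    go [] e = subst₂ (At []) (sym (trans (cong rest parse-[]) (rest-⟪⟫ 0 0 0)))
                             (sym (trans (cong hist parse-[]) (hist-⟪⟫ 0 0 0))) empty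
    go (σ ∶ v ∶ʳ i) e rewrite parse-∷ʳ σ i = At-δ (parse σ) i (go v (bad-δ (parse σ) i e)) e

  rest∈P : tP 0 ≡ 0 → ∀ {σ η h} → At σ η h → tP η ≡ 0
  rest∈P t₀ empty          = t₀
  rest∈P t₀ (stay _ _ t)   = t
  rest∈P t₀ (emit _ _ _ _) = t₀

  -- Parsing can be run backwards. If `η` is nonempty, its head is the last bit read; if it is empty
  -- and `h` is not, the last item determines its exit by `rank-injective`, and the head of that
  -- exit is the last bit.
  At-unique : tP 0 ≡ 0 → ∀ {σ η h σ′ η′ h′} → At σ η h → At σ′ η′ h′ → η ≡ η′ → h ≡ h′ → σ ≡ σ′
  At-unique t₀ empty          empty             eη eh = refl
  At-unique t₀ empty          (stay _ _ _)      eη eh = contradiction (sym eη) cons≢0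
  At-unique t₀ empty          (emit _ _ _ _)    eη eh = contradiction (sym eh) cons≢0
  At-unique t₀ (stay _ _ _)   empty             eη eh = contradiction eη cons≢0
  At-unique t₀ (stay p _ _)   (stay q _ _)      eη eh with refl , e ← cons-injective eη =
    cong (_∷ʳ _) (At-unique t₀ p q e eh)
  At-unique t₀ (stay _ _ _)   (emit _ _ _ _)    eη eh = contradiction eη cons≢0
  At-unique t₀ (emit _ _ _ _) empty             eη eh = contradiction eh cons≢0
  At-unique t₀ (emit _ _ _ _) (stay _ _ _)      eη eh = contradiction (sym eη) cons≢0
  At-unique t₀ (emit p a b _) (emit q c d _)    eη eh
    with er , e ← cons-injective eh
    with refl , e′ ← cons-injective (rank-injective (exit⇐ a (rest∈P t₀ p) b) (exit⇐ c (rest∈P t₀ q) d) er) =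
    cong (_∷ʳ _) (At-unique t₀ p q e′ e)

  -- Extensions of histories and of the strings that code them

  data Ext (ℓ g : ℕ) : ℕ → Set where
    refl : Ext ℓ g g
    snoc : ∀ {h} m → Ext ℓ g h → ℓ ≤ lev m → Check m h → Ext ℓ g (cons m h)

  Ext-trans : ∀ {ℓ g h k} → Ext ℓ g h → Ext ℓ h k → Ext ℓ g k
  Ext-trans p refl           = p
  Ext-trans p (snoc m q l c) = snoc m (Ext-trans p q) l c

  Ext-weaken : ∀ {ℓ ℓ′ g h} → ℓ ≤ ℓ′ → Ext ℓ′ g h → Ext ℓ g h
  Ext-weaken le refl           = refl
  Ext-weaken le (snoc m q l c) = snoc m (Ext-weaken le q) (≤-trans le l) c

  Ext-inv : ∀ {ℓ g h} → Ext ℓ g h → g ≡ h ⊎ ∃[ m ] ∃[ h′ ] h ≡ cons m h′ × Ext ℓ g h′ × Check m h′ × ℓ ≤ lev m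
  Ext-inv refl           = inj₁ refl
  Ext-inv (snoc m p l c) = inj₂ (m , _ , refl , p , c , l)

  Ext-cap : ∀ {ℓ g h} → Ext ℓ g h → g ≢ 0 → h ≢ 0 × cap (hd h) ≡ cap (hd g)
  Ext-cap refl               g≢0 = g≢0 , refl
  Ext-cap (snoc {h} m p l c) g≢0 with h≢0 , e ← Ext-cap p g≢0 =
    cons≢0 , trans (cong cap (hd-cons m h)) (trans (Check.same-cap c h≢0) e)

  At⇒Ext : ∀ {σ η h} → At σ η h → Ext 0 0 h
  At⇒Ext empty          = refl
  At⇒Ext (stay p _ _)   = At⇒Ext p
  At⇒Ext (emit p _ _ c) = snoc _ (At⇒Ext p) z≤n c

  At-prefix : ∀ {σ η h ℓ g} → At σ η h → Ext ℓ g h → ∃[ α ] ∃[ γ ] σ ≡ α ++ γ × At α 0 g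
  At-prefix {g = g} empty e with Ext-inv e
  ... | inj₁ refl             = [] , [] , refl , empty
  ... | inj₂ (m , h , z , _) = contradiction (sym z) cons≢0
  At-prefix (stay {i = i} p _ _) e with α , γ , refl , q ← At-prefix p e = α , γ ∷ʳ i , ++-assoc α γ _ , q
  At-prefix (emit {i = i} p a b c) e with Ext-inv e
  ... | inj₁ refl = _ , [] , sym (++-identityʳ _) , emit p a b c
  ... | inj₂ (m , h , z , e′ , _) with refl , refl ← cons-injective z
    with α , γ , refl , q ← At-prefix p e′ = α , γ ∷ʳ i , ++-assoc α γ _ , q

  -- Turns extension of histories into extension of strings: some prefix of `β` parses to `h` with
  -- nothing left over, and by uniqueness of parsing that prefix is `σ`.
  At-++ : tP 0 ≡ 0 → ∀ {σ h β ℓ h′} → At σ 0 h → At β 0 h′ → Ext ℓ h h′ → ∃[ γ ] β ≡ σ ++ γ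
  At-++ t₀ p q e with α , γ , eq , r ← At-prefix q e with refl ← At-unique t₀ p r refl refl = γ , eq

  Drops⇒Ext : ∀ {ℓ h g} → Drops ℓ h g → Ext 0 0 h → Ext (suc ℓ) g h
  Drops⇒Ext nil          e = refl
  Drops⇒Ext (stop _)     e = refl
  Drops⇒Ext (skip lt d)  e with Ext-inv e
  ... | inj₁ z = contradiction (sym z) cons≢0
  ... | inj₂ (m , h , z , e′ , c , _) with refl , refl ← cons-injective z = snoc m (Drops⇒Ext d e′) lt c

  module Tree (tP-tail : ∀ {i η} → tP (cons i η) ≡ 0 → tP η ≡ 0)
              (tP-bits : ∀ {i η} → tP (cons i η) ≡ 0 → i ≤ 1)
              (exits : ∀ N → ∃[ z ] N ≤ z × exit z ≡ 0) where

    rank-unbounded : ∀ m → ∃[ z ] m < rank z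
    rank-unbounded zero    with z , _ , e ← exits 0 = suc z , subst (0 <_) (sym (rank-exit e)) (s≤s z≤n)
    rank-unbounded (suc m) with z , lt ← rank-unbounded m with w , z≤w , e ← exits z =
      suc w , subst (suc m <_) (sym (rank-exit e)) (s≤s (≤-trans lt (rank-mono z≤w)))

    At-rest : ∀ {σ h} η → tP η ≡ 0 → At σ 0 h → ∃[ ρ ] At (σ ++ ρ) η h
    At-rest {σ} {h} = cons-ind (λ η → tP η ≡ 0 → At σ 0 h → ∃[ ρ ] At (σ ++ ρ) η h)
      (λ _ p → [] , subst (λ σ → At σ 0 h) (sym (++-identityʳ σ)) p)
      λ i η ih t p → let ρ , q = ih (tP-tail t) p in
        ρ ∷ʳ i , subst (λ σ → At σ (cons i η) h) (++-assoc σ ρ _) (stay q (tP-bits t) t)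

    -- Every number is the rank of an exit. Appending the tail of the exit of rank `m` stays inside
    -- the tree, and its head then leaves the tree and emits `m`.
    At-snoc : ∀ {σ h m} → At σ 0 h → Check m h → ∃[ ρ ] length σ < length (σ ++ ρ) × At (σ ++ ρ) 0 (cons m h)
    At-snoc {σ} {h} {m} p c
      with z , lt ← rank-unbounded m
      with w , e , refl ← rank-onto z lt
      with w ≟ 0
    ... | yes refl = contradiction e exit-0
    ... | no w≢0 with i≤1 , t , t′ ← exit⇒ (subst (λ w → exit w ≡ 0) (sym (cons-hd-tl w≢0)) e)
      with ρ , q ← At-rest (tl w) t p =
      ρ ∷ʳ hd w ,
      subst (λ σ′ → length σ < length σ′) (++-assoc σ ρ _)
        (subst (length σ <_) (sym (length-++ (σ ++ ρ)))
          (subst (length σ <_) (sym (+-comm (length (σ ++ ρ)) 1)) (s≤s (subst (length σ ≤_) (sym (length-++ σ)) (m≤m+n _ _))))) ,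
      subst₂ (λ σ′ v → At σ′ 0 (cons (rank v) h)) (++-assoc σ ρ _) (cons-hd-tl w≢0)
        (emit q i≤1 t′ (subst (λ v → Check (rank v) h) (sym (cons-hd-tl w≢0)) c))

  -- Computing a member of P from a point

  module Chains (tQ-tail : ∀ {i η} → tQ (cons i η) ≡ 0 → tQ η ≡ 0)
                (Q-noncomputable : ∀ y → (∀ n → tQ (rcode y n) ≡ 0) → ¬ Comp Vec.[] y) where

    -- The time and hence the next history are computable from the base, by search.
    no-infinite-chain : ∀ (G : ℕ → ℕ) c ℓ →
      (∀ j → ∃[ m ] ∃[ h ] G (suc j) ≡ cons m h × cap m ≡ c × lev m ≡ ℓ × Reset m h (G j)) → ⊥
    no-infinite-chain G c ℓ chain = Q-noncomputable (limit Z grow long) limit∈Q (limitᶜ Z grow long Zᶜ)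
      where
      open Reset

      halting : ℕ → ℕ → ℕ
      halting g t = π₂ (run o∅ t (start (prog (hd g)) (input g)))

      halting-at : ∀ j → let m , _ = chain j in halting (G j) (time m) ≡ 0 × (∀ t → t < time m → halting (G j) t ≢ 0)
      halting-at j with m , h , _ , _ , _ , r ← chain j rewrite sym (same-n r) =
        trans (cong π₂ (halts r)) (π₂-⟪,⟫ ⟪ h , hd τ⟨ m ⟩ ⟫ 0) ,
        λ t lt e → halts-at r (trans (cong π₂ (halted-≤ o∅ (lemma lt) e)) e)
        where
        lemma : ∀ {t n} → t < n → t ≤ pred n
        lemma (s≤s le) = le

      -- Nothing in a reset is left to choice: `t` is found by waiting, the program number, `κ` and
      -- the old part of `τ` are read off the base, and the output supplies the rest.
      after : ℕ → ℕ → ℕ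
      after g t = let out = π₁ (run o∅ t (start (prog (hd g)) (input g))) in
        cons (item c ℓ (prog (hd g)) t κ⟨ hd g ⟩ (cons (π₂ out) τ⟨ hd g ⟩)) (π₁ out)

      runᶜ′ : Comp Vec.[] (λ p → run o∅ (π₂ p) (start (prog (hd (π₁ p))) (input (π₁ p))))
      runᶜ′ = runᶜ (constᶜ 0) π₂ᶜ (startᶜ (progᶜ ∙ hdᶜ ∙ π₁ᶜ) ⟪ π₁ᶜ , τᶜ ∙ hdᶜ ∙ π₁ᶜ ⟫ᶜ)

      haltingᶜ : Comp₂ Vec.[] halting
      haltingᶜ = curried (π₂ᶜ ∙ runᶜ′)

      afterᶜ : Comp Vec.[] (λ p → after (π₁ p) (π₂ p))
      afterᶜ = consᶜ (itemᶜ (constᶜ c) (constᶜ ℓ) (progᶜ ∙ hdᶜ ∙ π₁ᶜ) π₂ᶜ (κᶜ ∙ hdᶜ ∙ π₁ᶜ)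
                       (consᶜ (π₂ᶜ ∙ π₁ᶜ ∙ runᶜ′) (τᶜ ∙ hdᶜ ∙ π₁ᶜ)))
                     (π₁ᶜ ∙ π₁ᶜ ∙ runᶜ′)

      after-chain : ∀ j → after (G j) (time (proj₁ (chain j))) ≡ G (suc j)
      after-chain j with m , h , eq , refl , refl , r ← chain j =
        trans (cong₂ (λ out n → cons (item (cap m) (lev m) n (time m) κ⟨ hd (G j) ⟩ (cons (π₂ out) τ⟨ hd (G j) ⟩)) (π₁ out))
                 out-eq (sym (same-n r)))
              (trans (cong₂ cons m-eq (π₁-⟪,⟫ h _)) (sym eq))
        where
        out-eq : π₁ (run o∅ (time m) (start (prog (hd (G j))) (input (G j)))) ≡ ⟪ h , hd τ⟨ m ⟩ ⟫
        out-eq = trans (cong π₁ (trans (cong (λ n → run o∅ (time m) (start n (input (G j)))) (sym (same-n r))) (halts r)))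
                       (π₁-⟪,⟫ ⟪ h , hd τ⟨ m ⟩ ⟫ 0)
        τ-eq : cons (π₂ ⟪ h , hd τ⟨ m ⟩ ⟫) τ⟨ hd (G j) ⟩ ≡ τ⟨ m ⟩
        τ-eq = trans (cong₂ cons (π₂-⟪,⟫ h _) (sym (τ-tail r))) (cons-hd-tl (τ≢0 r))
        m-eq : item (cap m) (lev m) (prog m) (time m) κ⟨ hd (G j) ⟩ (cons (π₂ ⟪ h , hd τ⟨ m ⟩ ⟫) τ⟨ hd (G j) ⟩) ≡ m
        m-eq = trans (cong₂ (item (cap m) (lev m) (prog m) (time m)) (sym (same-κ r)) τ-eq) (item-η m)

      Gᶜ : Comp Vec.[] G
      Gᶜ = seqᶜ (comp (code afterᶜ) (pair (code {gs = Vec.[]} idᶜ) (min (code (uncurried haltingᶜ))))) λ j →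
        let t = time (proj₁ (chain j)); z , least = halting-at j in
        ⟨ G j , t ⟩ ,
        (G j , t , graph (idᶜ {gs = Vec.[]}) (G j) , min-graph haltingᶜ (G j) z least , refl) ,
        subst₂ (⟦ code afterᶜ ⟧ Vec.[]) (sym (⟨,⟩-⟪,⟫ (G j) t))
          (trans (cong₂ after (π₁-⟪,⟫ (G j) t) (π₂-⟪,⟫ (G j) t)) (after-chain j)) (graph afterᶜ ⟪ G j , t ⟫)

      Z : ℕ → ℕ
      Z j = τ⟨ hd (G j) ⟩

      Zᶜ : Comp Vec.[] Z
      Zᶜ = τᶜ ∙ hdᶜ ∙ Gᶜ

      Z-suc : ∀ j → let m , _ = chain j in Z (suc j) ≡ cons (hd τ⟨ m ⟩) (Z j) × tQ (Z (suc j)) ≡ 0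
      Z-suc j with m , h , eq , _ , _ , r ← chain j rewrite eq | hd-cons m h =
        trans (sym (cons-hd-tl (τ≢0 r))) (cong (cons _) (τ-tail r)) , τ∈Q r

      grow : ∀ j → Z j ≼ Z (suc j)
      grow j = subst (Z j ≼_) (sym (proj₁ (Z-suc j))) (≼-cons _ ≼-refl)

      long : ∀ j → j ≤ len (Z j)
      long zero    = z≤n
      long (suc j) = subst (λ z → suc j ≤ len z) (sym (proj₁ (Z-suc j)))
        (≤-trans (s≤s (long j)) (≤-reflexive (sym (len-cons _ (Z j)))))

      limit∈Q : ∀ n → tQ (rcode (limit Z grow long) n) ≡ 0
      limit∈Q n = rcode-closed tQ tQ-tail _ (≤-trans (n≤1+n n) (long (suc n)))
        (trans (cong tQ (sym (limit-prefix Z grow long (suc n)))) (proj₂ (Z-suc n)))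

    -- Deletion down to level `ℓ′` stops at the latest at the last item of `g₀`, whose level is at
    -- most `ℓ`. So the base of a later item never lies before `g₀`. The numerical bound is what the
    -- recursion in `κ-Ext` descends along.
    Drops-between : ∀ {ℓ ℓ′ g₀ h g} → ℓ ≤ ℓ′ → lev (hd g₀) ≤ ℓ → g₀ ≢ 0 →
                    Ext ℓ g₀ h → Drops ℓ′ h g → Ext ℓ g₀ g × g ≤ h
    Drops-between le lv g₀≢0 e nil      = e , ≤-refl
    Drops-between le lv g₀≢0 e (stop _) = e , ≤-refl
    Drops-between {g₀ = g₀} le lv g₀≢0 e (skip {m} {h} lt d) with Ext-inv e
    ... | inj₁ refl =
      contradiction (subst (λ m → lev m ≤ _) (hd-cons m h) (≤-trans lv le)) (<⇒≱ lt)
    ... | inj₂ (m′ , h′ , eq , e′ , _) with refl , refl ← cons-injective eq =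
      let e″ , le′ = Drops-between le lv g₀≢0 e′ d in e″ , ≤-trans le′ (<⇒≤ (z<cons m h))

    -- A commit extends the `κ` of its predecessor, but a reset copies that of its base, which by
    -- `Drops-between` still extends `g`. As the base may lie far back, the recursion is on a bound
    -- for the history rather than on its items.
    κ-Ext : ∀ {ℓ g h} → lev (hd g) ≤ ℓ → g ≢ 0 → Ext ℓ g h → κ⟨ hd g ⟩ ≼ κ⟨ hd h ⟩
    κ-Ext {ℓ} {g} {h} lv g≢0 = go h h ≤-refl
      where
      go : ∀ N h → h ≤ N → Ext ℓ g h → κ⟨ hd g ⟩ ≼ κ⟨ hd h ⟩
      go N h le e with Ext-inv e
      ... | inj₁ refl = ≼-refl
      go zero    h le e | inj₂ (m , h′ , refl , _) = contradiction (n≤0⇒n≡0 le) cons≢0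
      go (suc N) h le e | inj₂ (m , h′ , refl , e′ , c , ℓ≤m) rewrite hd-cons m h′ with Check.kind c
      ... | inj₁ commit = subst (κ⟨ hd g ⟩ ≼_) (cons-hd-tl (Commit.κ≢0 commit))
            (≼-cons _ (subst (κ⟨ hd g ⟩ ≼_) (sym (Commit.κ-tail commit)) (go N h′ h′≤N e′)))
        where
        h′≤N : h′ ≤ N
        h′≤N = ≤-pred (≤-trans (z<cons m h′) le)
      ... | inj₂ reset = subst (κ⟨ hd g ⟩ ≼_) (sym (Reset.same-κ reset))
            (let e″ , le′ = Drops-between ℓ≤m lv g≢0 e′ (dropN-Drops (lev m) h′) in
             go N _ (≤-trans le′ (≤-pred (≤-trans (z<cons m h′) le))) e″)

    module Member (em : ExcludedMiddle 0ℓ) (tP-[] : tP 0 ≡ 0) (tP-tail : ∀ {i η} → tP (cons i η) ≡ 0 → tP η ≡ 0)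
                  (x : Baire) (good : ∀ n → bad (parse (x ↾ n)) ≡ 0) where

      S η h item-at : ℕ → ℕ
      S L = parse (x ↾ L)
      η L = rest (S L)
      h L = hist (S L)
      item-at L = rank (cons (x L) (η L))

      S-suc : ∀ L → S (suc L) ≡ δ (S L) (x L)
      S-suc L = trans (cong parse (sym (applyUpTo-∷ʳ x L))) (parse-∷ʳ (x ↾ L) (x L))

      xᶜ : Comp (x Vec.∷ Vec.[]) x
      xᶜ = oracle Fin.zero by λ _ → refl

      Sᶜ : Comp (x Vec.∷ Vec.[]) S
      Sᶜ = Comp-cong eq (ap₂ R (constᶜ 0) idᶜ)
        where
        R : Comp₂ (x Vec.∷ Vec.[]) (λ _ → natrec s₀ (λ L s → δ s (x L)))
        R = natrecᶜ {f₃ = λ _ L s → δ s (x L)} (constᶜ s₀)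
              (curried (ap₂ (liftᶜ₂ δᶜ) (π₂ᶜ ∙ π₂ᶜ) (xᶜ ∙ π₁ᶜ ∙ π₂ᶜ)))
        eq : ∀ n → natrec s₀ (λ L s → δ s (x L)) n ≡ S n
        eq zero    = sym parse-[]
        eq (suc n) = trans (cong (λ s → δ s (x n)) (eq n)) (sym (S-suc n))

      Emits : ℕ → Set
      Emits L = tP (cons (x L) (η L)) ≢ 0

      stays : ∀ {L} → ¬ Emits L → η (suc L) ≡ cons (x L) (η L) × h (suc L) ≡ h L
      stays {L} ¬e with tP (cons (x L) (η L)) ≟ 0
      ... | no e  = contradiction e ¬e
      ... | yes t rewrite S-suc L | δ-stay (S L) (x L) t = rest-⟪⟫ _ _ _ , hist-⟪⟫ _ _ _

      emits : ∀ {L} → Emits L → η (suc L) ≡ 0 × h (suc L) ≡ cons (item-at L) (h L) × Check (item-at L) (h L)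
      emits {L} t rewrite S-suc L | δ-emit (S L) (x L) t = rest-⟪⟫ _ _ _ , hist-⟪⟫ _ _ _ , check⇒ c
        where
        b : ℕ
        b = bad (S L) + (x L ∸ 1)
        c : check (item-at L) (h L) ≡ 0
        c = proj₂ (sum≡0 {b} (trans (sym (bad-⟪⟫ (b + check (item-at L) (h L)) 0 (cons (item-at L) (h L))))
              (trans (cong bad (sym (trans (S-suc L) (δ-emit (S L) (x L) t)))) (good (suc L)))))

      emits? : ∀ L → Emits L ⊎ ¬ Emits L
      emits? L with tP (cons (x L) (η L)) ≟ 0
      ... | yes t = inj₂ λ e → e t
      ... | no e  = inj₁ e

      Computes : Set
      Computes = ∃[ q ] (∀ n → tP (rcode q n) ≡ 0) × Comp (x Vec.∷ Vec.[]) q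

      limit-computes : ∀ Z → Comp (x Vec.∷ Vec.[]) Z → (∀ j → Z j ≼ Z (suc j)) → (∀ j → j ≤ len (Z j)) →
                       (∀ j → tP (Z j) ≡ 0) → Computes
      limit-computes Z Zᶜ grow long Z∈P = limit Z grow long , (λ n → rcode-closed tP tP-tail _ (long n)
        (trans (cong tP (sym (limit-prefix Z grow long n))) (Z∈P n))) , limitᶜ Z grow long Zᶜ

      -- With no further exit, the unfinished block grows by every bit and never leaves the tree of
      -- P, so it converges to a member of P.
      finitely-many : ∀ N → (∀ L → N ≤ L → ¬ Emits L) → Computes
      finitely-many N none =
        limit-computes (λ j → η (j + N)) (π₁ᶜ ∙ π₂ᶜ ∙ Sᶜ ∙ (idᶜ +ᶜ constᶜ N)) grow long
          (λ j → rest∈P tP-[] (parse⇒At (x ↾ (j + N)) (good (j + N))))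
        where
        next-η : ∀ j → η (suc j + N) ≡ cons (x (j + N)) (η (j + N))
        next-η j = proj₁ (stays (none (j + N) (m≤n+m N j)))
        grow : ∀ j → η (j + N) ≼ η (suc j + N)
        grow j = subst (η (j + N) ≼_) (sym (next-η j)) (≼-cons _ ≼-refl)
        long : ∀ j → j ≤ len (η (j + N))
        long zero    = z≤n
        long (suc j) = subst (λ z → suc j ≤ len z) (sym (next-η j))
          (≤-trans (s≤s (long j)) (≤-reflexive (sym (len-cons _ (η (j + N))))))

      module _ (ℓ L₀ : ℕ) (above : ∀ L → L₀ ≤ L → Emits L → ℓ ≤ lev (item-at L)) where

        Hit : ℕ → Set
        Hit L = Emits L × lev (item-at L) ≡ ℓ

        hist-Ext : ∀ {A B} → L₀ ≤ A → A ≤′ B → Ext ℓ (h A) (h B)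
        hist-Ext le ≤′-refl = refl
        hist-Ext {A} le (≤′-step {B} p) with emits? B
        ... | inj₂ ¬e = subst (Ext ℓ (h A)) (sym (proj₂ (stays ¬e))) (hist-Ext le p)
        ... | inj₁ e with _ , eq , c ← emits e =
          subst (Ext ℓ (h A)) (sym eq) (snoc _ (hist-Ext le p) (above B (≤-trans le (≤′⇒≤ p)) e) c)

        hd-hit : ∀ {A} → Hit A → hd (h (suc A)) ≡ item-at A × h (suc A) ≢ 0
        hd-hit {A} (e , _) with _ , eq , _ ← emits e =
          trans (cong hd eq) (hd-cons _ _) , λ z → cons≢0 (trans (sym eq) z)

        -- Comparing with the tail of the later string makes the growth strict: nothing of level at
        -- least `ℓ` undoes the entries committed at `A`, and the commit at `B` adds one.
        κ-hits : ∀ {A B} → L₀ ≤ A → Hit A → Hit B → time (item-at B) ≡ 0 → A < B →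
                 κ⟨ item-at A ⟩ ≼ tl κ⟨ item-at B ⟩ × κ⟨ item-at B ⟩ ≢ 0
        κ-hits {A} {B} le hA (eB , _) t≡0 A<B with a , nz ← hd-hit hA with _ , _ , c ← emits eB with Check.kind c
        ... | inj₂ r = contradiction t≡0 (Reset.time≢0 r)
        ... | inj₁ r =
          subst₂ _≼_ (cong κ⟨_⟩ a) (sym (Commit.κ-tail r))
            (κ-Ext (≤-reflexive (trans (cong lev a) (proj₂ hA))) nz
              (hist-Ext (≤-trans le (n≤1+n A)) (≤⇒≤′ A<B))) ,
          Commit.κ≢0 r

        -- The program has `ℓ` and `L₀` built in. They depend on `x`, which is where the reduction
        -- becomes nonuniform.
        commits : (∀ N → ∃[ L ] N ≤ L × Hit L × time (item-at L) ≡ 0) → Computes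
        commits often = limit-computes Z Zᶜ grow long Z∈P
          where
          test : ℕ → ℕ → ℕ
          test j L = (L₀ ∸ L) + ifz (tP (cons (x L) (η L))) 1 0 + dist (lev (item-at L)) ℓ + time (item-at L) +
                     (j ∸ len κ⟨ item-at L ⟩)

          record Good (j L : ℕ) : Set where
            constructor mkGood
            pattern
            field
              late  : L₀ ≤ L
              hit   : Hit L
              time0 : time (item-at L) ≡ 0
              κlong : j ≤ len κ⟨ item-at L ⟩
          open Good

          test⇒ : ∀ {j L} → test j L ≡ 0 → Good j L
          test⇒ {j} {L} e
            with e₁₂₃₄ , e₅ ← sum≡0 {(L₀ ∸ L) + ifz (tP (cons (x L) (η L))) 1 0 + dist (lev (item-at L)) ℓ + time (item-at L)} e
            with e₁₂₃ , e₄ ← sum≡0 {(L₀ ∸ L) + ifz (tP (cons (x L) (η L))) 1 0 + dist (lev (item-at L)) ℓ} e₁₂₃₄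
            with e₁₂ , e₃ ← sum≡0 {(L₀ ∸ L) + ifz (tP (cons (x L) (η L))) 1 0} e₁₂₃
            with e₁ , e₂ ← sum≡0 {L₀ ∸ L} e₁₂ =
            mkGood (m∸n≡0⇒m≤n e₁) (ifz-1-0 _ e₂ , dist≡0 e₃) e₄ (m∸n≡0⇒m≤n e₅)

          test⇐ : ∀ {j L} → Good j L → test j L ≡ 0
          test⇐ (mkGood l (e , v) t k) =
            sum≡0⁻ (sum≡0⁻ (sum≡0⁻ (sum≡0⁻ (m≤n⇒m∸n≡0 l) (ifz-1-0⁻ e)) (dist-refl v)) t) (m≤n⇒m∸n≡0 k)

          testᶜ : Comp₂ (x Vec.∷ Vec.[]) test
          testᶜ = curried ((constᶜ L₀ ∸ᶜ π₂ᶜ) +ᶜ ifzᶜ (liftᶜ tPᶜ ∙ E) (constᶜ 1) (constᶜ 0) +ᶜ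
                           distᶜ (levᶜ ∙ I) (constᶜ ℓ) +ᶜ timeᶜ ∙ I +ᶜ (π₁ᶜ ∸ᶜ (lenᶜ ∙ κᶜ ∙ I)))
            where
            E : Comp (x Vec.∷ Vec.[]) (λ p → cons (x (π₂ p)) (η (π₂ p)))
            E = consᶜ (xᶜ ∙ π₂ᶜ) (π₁ᶜ ∙ π₂ᶜ ∙ Sᶜ ∙ π₂ᶜ)
            I : Comp (x Vec.∷ Vec.[]) (λ p → item-at (π₂ p))
            I = liftᶜ rankᶜ ∙ E

          unbounded : ∀ j → ∃[ L ] Good j L
          unbounded zero with L , le , hit , t ← often L₀ = L , mkGood le hit t z≤n
          unbounded (suc j) with A , mkGood lA hA tA kA ← unbounded j with B , A<B , hB , tB ← often (suc A)
            with grows , nz ← κ-hits lA hA hB tB A<B =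
            B , mkGood (≤-trans lA (<⇒≤ A<B)) hB tB
              (subst (λ z → suc j ≤ len z) (cons-hd-tl nz)
                (≤-trans (s≤s (≤-trans kA (≼-len grows))) (≤-reflexive (sym (len-cons _ _)))))

          opaque
            search : ∃[ μ ] Comp (x Vec.∷ Vec.[]) μ × (∀ j → test j (μ j) ≡ 0 × (∀ L → L < μ j → test j L ≢ 0))
            search = minimize testᶜ λ j → let L , g = unbounded j in L , test⇐ g

          A : ℕ → ℕ
          A = proj₁ search

          A-good : ∀ j → Good j (A j)
          A-good j = test⇒ (proj₁ (proj₂ (proj₂ search) j))

          -- The condition for `suc j` implies the one for `j`, so least solutions can only
          -- increase. Hence the strings found are comparable.
          A-mono : ∀ j → A j ≤ A (suc j)
          A-mono j = ≮⇒≥ λ lt → let g = A-good (suc j) in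
            proj₂ (proj₂ (proj₂ search) j) _ lt (test⇐ (mkGood (late g) (hit g) (time0 g) (<⇒≤ (κlong g))))

          Z : ℕ → ℕ
          Z j = κ⟨ item-at (A j) ⟩

          Zᶜ : Comp (x Vec.∷ Vec.[]) Z
          Zᶜ = κᶜ ∙ liftᶜ rankᶜ ∙ consᶜ (xᶜ ∙ proj₁ (proj₂ search)) (π₁ᶜ ∙ π₂ᶜ ∙ Sᶜ ∙ proj₁ (proj₂ search))

          grow : ∀ j → Z j ≼ Z (suc j)
          grow j with m≤n⇒m<n∨m≡n (A-mono j)
          ... | inj₂ eq = subst (λ L → Z j ≼ κ⟨ item-at L ⟩) eq ≼-refl
          ... | inj₁ lt with g₁ ← A-good j | g₂ ← A-good (suc j)
            with grows , nz ← κ-hits (late g₁) (hit g₁) (hit g₂) (time0 g₂) lt =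
            subst (Z j ≼_) (cons-hd-tl nz) (≼-cons _ grows)

          long : ∀ j → j ≤ len (Z j)
          long j = κlong (A-good j)

          Z∈P : ∀ j → tP (Z j) ≡ 0
          Z∈P j with g ← A-good j with _ , _ , c ← emits (proj₁ (hit g)) with Check.kind c
          ... | inj₁ r = Commit.κ∈P r
          ... | inj₂ r = contradiction (time0 g) (Reset.time≢0 r)

        -- Between consecutive hits all items have level above `ℓ`, so the history just after one
        -- hit is the base of the next, and the hits form a chain.
        resets-only : ∀ L₁ → (∀ L → L₁ ≤ L → Hit L → time (item-at L) ≢ 0) → (∀ N → ∃[ L ] N ≤ L × Hit L) → ⊥
        resets-only L₁ resets often = no-infinite-chain G (cap (item-at (A 0))) ℓ chain
          where
          opaque
            least-hit : ∀ N → ∃[ L ] N ≤ L × Hit L × (∀ M → N ≤ M → M < L → ¬ Hit M)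
            least-hit N with L , N≤L , hit ← often N = go (L ∸ N) N (λ _ le lt → contradiction le (<⇒≱ lt)) ≤-refl
                                                         (subst Hit (sym (m∸n+n≡m N≤L)) hit)
              where
              go : ∀ d M → (∀ K → N ≤ K → K < M → ¬ Hit K) → N ≤ M → Hit (d + M) →
                   ∃[ L ] N ≤ L × Hit L × (∀ M → N ≤ M → M < L → ¬ Hit M)
              go zero    M none le hit = M , le , hit , none
              go (suc d) M none le hit with em {Hit M}
              ... | yes hitM = M , le , hitM , none
              ... | no ¬hitM = go d (suc M) none′ (≤-trans le (n≤1+n M)) (subst Hit (sym (+-suc d M)) hit)
                where
                none′ : ∀ K → N ≤ K → K < suc M → ¬ Hit K
                none′ K le (s≤s K≤M) with m≤n⇒m<n∨m≡n K≤M
                ... | inj₁ lt   = none K le lt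
                ... | inj₂ refl = ¬hitM

          A : ℕ → ℕ
          A zero    = proj₁ (least-hit (L₀ ⊔ L₁))
          A (suc j) = proj₁ (least-hit (suc (A j)))

          A-hit : ∀ j → L₀ ⊔ L₁ ≤ A j × Hit (A j)
          A-hit zero    = let _ , le , hit , _ = least-hit (L₀ ⊔ L₁) in le , hit
          A-hit (suc j) = let _ , le , hit , _ = least-hit (suc (A j)) in
            ≤-trans (proj₁ (A-hit j)) (≤-trans (n≤1+n _) le) , hit

          G : ℕ → ℕ
          G j = h (suc (A j))

          G≢0 : ∀ j → G j ≢ 0
          G≢0 j = proj₂ (hd-hit (proj₂ (A-hit j)))

          between : ∀ j {L} → suc (A j) ≤′ L → L ≤ A (suc j) → Drops ℓ (h L) (G j)
          between j ≤′-refl le with hit@(e , v) ← proj₂ (A-hit j) with _ , eq , _ ← emits e =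
            subst (λ z → Drops ℓ z z) (sym eq) (stop (≤-reflexive v))
          between j (≤′-step {L} p) le with emits? L
          ... | inj₂ ¬e = subst (λ z → Drops ℓ z (G j)) (sym (proj₂ (stays ¬e))) (between j p (<⇒≤ le))
          ... | inj₁ e with _ , eq , _ ← emits e =
            subst (λ z → Drops ℓ z (G j)) (sym eq) (skip (≤∧≢⇒< ℓ≤ λ z → not-hit (e , sym z)) (between j p (<⇒≤ le)))
            where
            not-hit : ¬ Hit L
            not-hit = let _ , _ , _ , none = least-hit (suc (A j)) in none L (≤′⇒≤ p) le
            ℓ≤ : ℓ ≤ lev (item-at L)
            ℓ≤ = above L (≤-trans (m≤m⊔n L₀ L₁) (≤-trans (proj₁ (A-hit j)) (≤-trans (n≤1+n _) (≤′⇒≤ p)))) e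

          chain : ∀ j → ∃[ m ] ∃[ h ] G (suc j) ≡ cons m h × cap m ≡ cap (item-at (A 0)) × lev m ≡ ℓ × Reset m h (G j)
          chain j with le , hit@(e , v) ← A-hit (suc j) with _ , eq , c ← emits e =
            item-at (A (suc j)) , h (A (suc j)) , eq , caps (suc j) , v , kind (Check.kind c)
            where
            caps : ∀ j → cap (item-at (A j)) ≡ cap (item-at (A 0))
            caps zero    = refl
            caps (suc j) =
              trans (sym (cong cap (proj₁ (hd-hit (proj₂ (A-hit (suc j)))))))
                (trans (proj₂ (Ext-cap (hist-Ext (≤-trans (m≤m⊔n L₀ L₁) (≤-trans (proj₁ (A-hit j)) (n≤1+n _)))
                                 (≤⇒≤′ (≤-trans (proj₁ (proj₂ (least-hit (suc (A j))))) (n≤1+n _)))) (G≢0 j)))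
                  (trans (cong cap (proj₁ (hd-hit (proj₂ (A-hit j))))) (caps j)))
            kind : Commit (item-at (A (suc j))) (h (A (suc j))) ⊎
                   Reset (item-at (A (suc j))) (h (A (suc j))) (dropN (lev (item-at (A (suc j)))) (h (A (suc j)))) →
                   Reset (item-at (A (suc j))) (h (A (suc j))) (G j)
            kind (inj₁ r) = contradiction (Commit.time≡0 r) (resets _ (≤-trans (m≤n⊔m L₀ L₁) le) hit)
            kind (inj₂ r) = subst (Reset _ _)
              (trans (cong (λ ℓ → dropN ℓ (h (A (suc j)))) v)
                (Drops⇒dropN (between j (≤⇒≤′ (proj₁ (proj₂ (least-hit (suc (A j)))))) ≤-refl))) r

      computes : Computes
      computes with em {∃[ N ] ∀ L → N ≤ L → ¬ Emits L}
      ... | yes (N , none) = finitely-many N none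
      ... | no many = liminf (suc c) 0 0 (+-identityʳ _) λ _ _ _ → z≤n
        where
        often : ∀ N → ∃[ L ] N ≤ L × Emits L
        often N with em {∃[ L ] N ≤ L × Emits L}
        ... | yes p = p
        ... | no ¬p = contradiction (N , λ L le e → ¬p (L , le , e)) many
        first-emission : ∃[ L ] 0 ≤ L × Emits L
        first-emission = often 0
        F : ℕ
        F = proj₁ first-emission
        c : ℕ
        c = cap (hd (h (suc F)))
        lev≤c : ∀ L → suc F ≤ L → Emits L → lev (item-at L) ≤ c
        lev≤c L le e with _ , eqF , _ ← emits (proj₂ (proj₂ first-emission)) with _ , eq , ch ← emits e =
          subst (lev (item-at L) ≤_) (trans (cong cap (sym (trans (cong hd eq) (hd-cons _ _))))
            (proj₂ (Ext-cap (hist-Ext 0 0 (λ _ _ _ → z≤n) z≤n (≤⇒≤′ (≤-trans le (n≤1+n L))))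
                     λ z → cons≢0 (trans (sym eqF) z)))) (Check.lev≤cap ch)
        -- Climbs to the least level that recurs: `above` says that from `L₀` on no level below `ℓ`
        -- occurs. The climb ends because level `suc c` would exceed the cap `c`, while items never
        -- cease.
        liminf : ∀ d ℓ L₀ → d + ℓ ≡ suc c → (∀ L → L₀ ≤ L → Emits L → ℓ ≤ lev (item-at L)) → Computes
        liminf zero ℓ L₀ refl above with L , le , e ← often (L₀ ⊔ suc F) =
          contradiction (lev≤c L (≤-trans (m≤n⊔m L₀ (suc F)) le) e) (<⇒≱ (above L (≤-trans (m≤m⊔n L₀ (suc F)) le) e))
        liminf (suc d) ℓ L₀ eq above with em {∃[ L₁ ] ∀ L → L₁ ≤ L → ¬ Hit ℓ L₀ above L}
        ... | yes (L₁ , none) = liminf d (suc ℓ) (L₀ ⊔ L₁) (trans (+-suc d ℓ) eq) λ L le e →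
                ≤∧≢⇒< (above L (≤-trans (m≤m⊔n L₀ L₁) le) e) λ z → none L (≤-trans (m≤n⊔m L₀ L₁) le) (e , sym z)
        ... | no hits with em {∃[ L₁ ] ∀ L → L₁ ≤ L → Hit ℓ L₀ above L → time (item-at L) ≢ 0}
        ...   | yes (L₁ , resets) = ⊥-elim (resets-only ℓ L₀ above L₁ resets hit-often)
          where
          hit-often : ∀ N → ∃[ L ] N ≤ L × Hit ℓ L₀ above L
          hit-often N with em {∃[ L ] N ≤ L × Hit ℓ L₀ above L}
          ... | yes p = p
          ... | no ¬p = contradiction (N , λ L le e → ¬p (L , le , e)) hits
        ...   | no ¬resets = commits ℓ L₀ above often-commit
          where
          often-commit : ∀ N → ∃[ L ] N ≤ L × Hit ℓ L₀ above L × time (item-at L) ≡ 0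
          often-commit N with em {∃[ L ] N ≤ L × Hit ℓ L₀ above L × time (item-at L) ≡ 0}
          ... | yes p = p
          ... | no ¬p = contradiction (N , λ L le e z → ¬p (L , le , e , z)) ¬resets

  bad-++ : ∀ σ γ → bad (parse (σ ++ γ)) ≡ 0 → bad (parse σ) ≡ 0
  bad-++ σ γ e rewrite parse-++ σ γ = go (parse σ) γ e
    where
    go : ∀ s γ → bad (foldl δ s γ) ≡ 0 → bad s ≡ 0
    go s []      e = e
    go s (i ∷ γ) e = bad-δ s i (go (δ s i) γ e)

  InP InQ : Baire → Set
  InP p = ∀ n → tP (rcode p n) ≡ 0
  InQ f = ∀ n → tQ (rcode f n) ≡ 0

  -- For special P this is not a computable property, for otherwise the extendible strings would
  -- yield a computable member. Legality of items therefore asks only for membership in the tree,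
  -- and the diagonal argument maintains extendibility itself.
  Extendible : ℕ → Set
  Extendible κ = ∃[ p ] InP p × κ ≡ rcode p (len κ)

  -- The program that searches for one more value

  module Search (e ℓ : ℕ) where

    -- By `drop-h`, the history of `β` exceeds `g` by items of level above `ℓ` only. Its `κ` may be
    -- a dead end, since the search cannot recognise one.
    record Wit (g : ℕ) : Set where
      constructor mkWit
      field
        β        : List ℕ
        {h y s}  : ℕ
        at-β     : At β 0 h
        drop-h   : dropN ℓ h ≡ g
        computed : run (nthN ⌜ β ⌝) s (start e (len τ⟨ hd g ⟩)) ≡ ⟪ y , 0 ⟫
        y∈Q      : tQ (cons y τ⟨ hd g ⟩) ≡ 0

    private
      res : ℕ → ℕ → ℕ
      res v w = run (nthN (π₁ w)) (π₂ w) (start e (len (π₂ v)))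

      stateN : ℕ → ℕ
      stateN w = foldN δ s₀ (π₁ w)

      test : ℕ → ℕ → ℕ
      test v w = bad (stateN w) + rest (stateN w) + dist (dropN ℓ (hist (stateN w))) (π₁ v) + π₂ (res v w) +
                 tQ (cons (π₁ (res v w)) (π₂ v))

      resᶜ : Comp Vec.[] (λ p → res (π₁ p) (π₂ p))
      resᶜ = runᶜ (π₁ᶜ ∙ π₂ᶜ) (π₂ᶜ ∙ π₂ᶜ) (startᶜ (constᶜ e) (lenᶜ ∙ π₂ᶜ ∙ π₁ᶜ))

      stateᶜ : Comp Vec.[] (λ p → stateN (π₂ p))
      stateᶜ = foldNᶜ δᶜ (constᶜ s₀) (π₁ᶜ ∙ π₂ᶜ)

      testᶜ : Comp₂ Vec.[] test
      testᶜ = curried (π₁ᶜ ∙ stateᶜ +ᶜ π₁ᶜ ∙ π₂ᶜ ∙ stateᶜ +ᶜ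
                       distᶜ (dropNᶜ (constᶜ ℓ) (π₂ᶜ ∙ π₂ᶜ ∙ stateᶜ)) (π₁ᶜ ∙ π₁ᶜ) +ᶜ π₂ᶜ ∙ resᶜ +ᶜ
                       tQᶜ ∙ consᶜ (π₁ᶜ ∙ resᶜ) (π₂ᶜ ∙ π₁ᶜ))

      outᶜ : Comp Vec.[] (λ p → ⟪ hist (stateN (π₂ p)) , π₁ (res (π₁ p) (π₂ p)) ⟫)
      outᶜ = ⟪ π₂ᶜ ∙ π₂ᶜ ∙ stateᶜ , π₁ᶜ ∙ resᶜ ⟫ᶜ

      opaque
        program : Code 0
        program = comp (code outᶜ) (pair (code {gs = Vec.[]} idᶜ) (min (code (uncurried testᶜ))))

        program-graph : ∀ v {w} → test v w ≡ 0 → (∀ j → j < w → test v j ≢ 0) →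
                        ⟦ program ⟧ Vec.[] v ⟪ hist (stateN w) , π₁ (res v w) ⟫
        program-graph v {w} z least =
          ⟨ v , w ⟩ , (v , w , graph (idᶜ {gs = Vec.[]}) v , min-graph testᶜ v z least , refl) ,
          subst₂ (⟦ code outᶜ ⟧ Vec.[]) (sym (⟨,⟩-⟪,⟫ v w))
            (cong₂ (λ v w → ⟪ hist (stateN w) , π₁ (res v w) ⟫) (π₁-⟪,⟫ v w) (π₂-⟪,⟫ v w)) (graph outᶜ ⟪ v , w ⟫)

      test⇐ : ∀ {g} (W : Wit g) → test (input g) ⟪ ⌜ Wit.β W ⌝ , Wit.s W ⟫ ≡ 0
      test⇐ {g} (mkWit β {h} {y} {s} a d c q)
        rewrite π₁-⟪,⟫ ⌜ β ⌝ s | π₂-⟪,⟫ ⌜ β ⌝ s | π₁-⟪,⟫ g τ⟨ hd g ⟩ | π₂-⟪,⟫ g τ⟨ hd g ⟩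
              | parse-code β | At⇒parse a | c | π₁-⟪,⟫ y 0 | π₂-⟪,⟫ y 0
              | bad-⟪⟫ 0 0 h | rest-⟪⟫ 0 0 h | hist-⟪⟫ 0 0 h = sum≡0⁻ (sum≡0⁻ (dist-refl d) refl) q

      test⇒ : ∀ {g} w → test (input g) w ≡ 0 → Σ[ W ∈ Wit g ]
              ⟪ hist (stateN w) , π₁ (res (input g) w) ⟫ ≡ ⟪ Wit.h W , Wit.y W ⟫
      test⇒ {g} w zero-test
        with e₁₂₃₄ , e₅ ← sum≡0 {bad (stateN w) + rest (stateN w) + dist (dropN ℓ (hist (stateN w))) (π₁ (input g)) + π₂ (res (input g) w)} zero-test
        with e₁₂₃ , e₄ ← sum≡0 {bad (stateN w) + rest (stateN w) + dist (dropN ℓ (hist (stateN w))) (π₁ (input g))} e₁₂₃₄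
        with e₁₂ , e₃ ← sum≡0 {bad (stateN w) + rest (stateN w)} e₁₂₃
        with e₁ , e₂ ← sum≡0 {bad (stateN w)} e₁₂
        with β , eq ← code-surjective (π₁ w) = mkWit β {s = π₂ w}
          (subst (λ η → At β η (hist (stateN w))) e₂
            (subst (λ s → At β (rest s) (hist s)) (sym state) (parse⇒At β (trans (cong bad (sym state)) e₁))))
          (trans (dist≡0 e₃) (π₁-⟪,⟫ g _))
          (trans (cong₂ (λ z τ → run (nthN z) (π₂ w) (start e (len τ))) eq (sym (π₂-⟪,⟫ g _)))
            (trans (sym (⟪π₁,π₂⟫ _)) (cong ⟪ π₁ (res (input g) w) ,_⟫ e₄)))
          (trans (cong (λ τ → tQ (cons (π₁ (res (input g) w)) τ)) (sym (π₂-⟪,⟫ g _))) e₅) , refl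
        where
        state : stateN w ≡ parse β
        state = trans (cong (foldN δ s₀) (sym eq)) (parse-code β)

    -- The program depends on `e` and `ℓ` but not on `g`, so its number is available to the commit
    -- that creates the first base, and the same number serves every base of the chain.
    search-program : ∃[ n ] ∀ g → Wit g → Σ[ W ∈ Wit g ] ∃[ t ]
      run o∅ (suc t) (start n (input g)) ≡ ⟪ ⟪ Wit.h W , Wit.y W ⟫ , 0 ⟫ ×
      π₂ (run o∅ t (start n (input g))) ≢ 0
    search-program = encode program , λ g W →
      let w , z , below = least (test (input g)) (test⇐ W)
          W′ , eq = test⇒ w z
          s , halts = program-halts {gs = Vec.[]} (λ ()) program (program-graph (input g) z below)
      in W′ , first-halt (encode program) (input g) s (trans halts (cong (λ v → ⟪ v , 0 ⟫) eq))
      where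
      first-halt : ∀ n v s {out} → run o∅ s (start n v) ≡ ⟪ out , 0 ⟫ →
                   ∃[ t ] run o∅ (suc t) (start n v) ≡ ⟪ out , 0 ⟫ × π₂ (run o∅ t (start n v)) ≢ 0
      first-halt n v s {out} eq = pick (least halting {s} z)
        where
        halting : ℕ → ℕ
        halting t = π₂ (run o∅ t (start n v))
        z : halting s ≡ 0
        z = trans (cong π₂ eq) (π₂-⟪,⟫ out 0)
        pick : ∃[ t ] halting t ≡ 0 × (∀ j → j < t → halting j ≢ 0) →
               ∃[ t ] run o∅ (suc t) (start n v) ≡ ⟪ out , 0 ⟫ × halting t ≢ 0
        -- The initial stack is nonempty, so the halting time is positive. This separates resets
        -- from commits, whose time is 0.
        pick (zero , z′ , _)      = contradiction (trans (sym (cong π₂ (run-zero o∅ (start n v)))) z′) (start-running n v)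
        pick (suc t , z′ , below) = t , trans (halted-unique o∅ {suc t} {s} z′ z) eq , below t ≤-refl

  -- Defeating finitely many learners at one point

  module Diagonal
    (em : ExcludedMiddle 0ℓ)
    (tP-[] : tP 0 ≡ 0)
    (tP-tail : ∀ {i η} → tP (cons i η) ≡ 0 → tP η ≡ 0)
    (tP-bits : ∀ {i η} → tP (cons i η) ≡ 0 → i ≤ 1)
    (exits : ∀ N → ∃[ z ] N ≤ z × exit z ≡ 0)
    (tQ-tail : ∀ {i η} → tQ (cons i η) ≡ 0 → tQ η ≡ 0)
    (Q-noncomputable : ∀ y → InQ y → ¬ Comp Vec.[] y)
    (b : ℕ)
    where

    open Tree tP-tail tP-bits exits
    open Chains tQ-tail Q-noncomputable

    -- The positions visited by the diagonal argument. The history is nonempty so that its cap is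
    -- already settled.
    record Pos (σ : List ℕ) (h : ℕ) : Set where
      constructor mkPos
      field
        at-σ  : At σ 0 h
        κ-ext : Extendible κ⟨ hd h ⟩
        h≢0   : h ≢ 0
        cap-h : cap (hd h) ≡ b
    open Pos

    pos-++ : ∀ {σ h σ′ h′ ℓ} → Pos σ h → Pos σ′ h′ → Ext ℓ h h′ → ∃[ γ ] σ′ ≡ σ ++ γ
    pos-++ p q e = At-++ tP-[] (at-σ p) (at-σ q) e

    -- The new entry is the next value of a member `p` through the current `κ`, so extendibility is
    -- preserved. The cap hypothesis is conditional so that the very first item is covered too.
    commit-check : ∀ {h ℓ} n p → InP p → κ⟨ hd h ⟩ ≡ rcode p (len κ⟨ hd h ⟩) → (h ≢ 0 → cap (hd h) ≡ b) → ℓ ≤ b →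
                   let m = item b ℓ n 0 (cons (p (len κ⟨ hd h ⟩)) κ⟨ hd h ⟩) 0 in
                   Check m h × Extendible κ⟨ m ⟩
    commit-check {h} {ℓ} n p p∈P eq same ℓ≤b =
      mkCheck (λ h≢0 → trans (cap-item b ℓ n 0 κ 0) (sym (same h≢0)))
              (subst₂ _≤_ (sym (lev-item b ℓ n 0 κ 0)) (sym (cap-item b ℓ n 0 κ 0)) ℓ≤b)
              (inj₁ (mkCommit (time-item b ℓ n 0 κ 0) (λ z → cons≢0 (trans (sym κ≡) z))
                              (trans (cong tl κ≡) (tl-cons _ _))
                              (trans (cong tP (trans κ≡ κ-rcode)) (p∈P (suc L))) (τ-item b ℓ n 0 κ 0))) ,
      p , p∈P , trans κ≡ (trans κ-rcode (cong (rcode p) (trans (sym (len-cons _ _)) (cong len (sym κ≡)))))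
      where
      L κ : ℕ
      L = len κ⟨ hd h ⟩
      κ = cons (p L) κ⟨ hd h ⟩
      κ≡ : κ⟨ item b ℓ n 0 κ 0 ⟩ ≡ κ
      κ≡ = κ-item b ℓ n 0 κ 0
      κ-rcode : κ ≡ rcode p (suc L)
      κ-rcode = cong (cons (p L)) eq

    commit : ∀ {σ h ℓ} n → ℓ ≤ b → Pos σ h → ∃[ m ] ∃[ σ′ ] Pos σ′ (cons m h) × Ext ℓ h (cons m h) ×
             length σ < length σ′ × prog m ≡ n × lev m ≡ ℓ × τ⟨ m ⟩ ≡ 0
    commit {σ} {h} {ℓ} n ℓ≤b (mkPos a (p , p∈P , eq) h≢0 c)
      with ch , ex ← commit-check n p p∈P eq (λ _ → c) ℓ≤b
      with ρ , lt , a′ ← At-snoc a ch =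
      _ , _ , mkPos a′ (subst (λ m → Extendible κ⟨ m ⟩) (sym (hd-cons _ h)) ex) cons≢0
                (trans (cong cap (hd-cons _ h)) (cap-item b ℓ n 0 _ 0)) ,
      snoc _ refl (≤-reflexive (sym (lev-item b ℓ n 0 _ 0))) ch , lt ,
      prog-item b ℓ n 0 _ 0 , lev-item b ℓ n 0 _ 0 , τ-item b ℓ n 0 _ 0

    Ray : ℕ → ℕ → Baire → Set
    Ray ℓ h x = ∀ N → ∃[ σ ] ∃[ h′ ] Pos σ h′ × Ext ℓ h h′ × N ≤ length σ × σ ≡ x ↾ length σ

    Ray-weaken : ∀ {ℓ ℓ′ h h′ x} → ℓ ≤ ℓ′ → Ext ℓ h h′ → Ray ℓ′ h′ x → Ray ℓ h x
    Ray-weaken le e ray N with σ , h″ , p , e′ , l , eq ← ray N = σ , h″ , p , Ext-trans e (Ext-weaken le e′) , l , eq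

    Learner : Set
    Learner = List ℕ → ℕ

    Beaten : Learner → Baire → Set
    Beaten ψ x = ∀ j f → Converges (λ n → ψ (x ↾ n)) j → Φ[ j ] x ≃ f → InQ f → ⊥

    Stable : Learner → ℕ → ℕ → List ℕ → ℕ → Set
    Stable ψ i ℓ σ h = ∀ {σ′ h′} → Pos σ′ h′ → Ext ℓ h h′ → ∀ n → length σ ≤ n → n ≤ length σ′ → ψ (take n σ′) ≡ i

    -- ψ guesses i forever.  The program searches above the current position for one
    -- more value of the functional i that stays in the tree of Q; by
    -- no-infinite-chain it gets stuck, and then the functional fails above.
    module Restrain (ψ : Learner) (i ℓ : ℕ) (ℓ≤b : ℓ ≤ b) {σ₀ h₀} (pos₀ : Pos σ₀ h₀) (stable : Stable ψ i ℓ σ₀ h₀) where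

      c : Code 1
      c = decode i

      opaque
        e : ℕ
        -- The machine runs on numbers of the form `encode c`, and `i` itself need not be of this
        -- form.
        e = encode c

        e-halts : ∀ x {n y} → ⟦ c ⟧ (x Vec.∷ Vec.[]) n y → ∃[ s ] run (λ q → suc (x q)) s (start e n) ≡ ⟪ y , 0 ⟫
        e-halts x = program-halts {gs = x Vec.∷ Vec.[]} (λ { Fin.zero q → refl }) c

      open Search e ℓ

      module WithProgram (n : ℕ) (works : ∀ g → Wit g → Σ[ W ∈ Wit g ] ∃[ t ]
                                    run o∅ (suc t) (start n (input g)) ≡ ⟪ ⟪ Wit.h W , Wit.y W ⟫ , 0 ⟫ ×
                                    π₂ (run o∅ t (start n (input g))) ≢ 0) where

        -- A position reached by a chain, together with the fact that every entry of `τ` is a value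
        -- of the functional with `σ` as partial oracle. Such values persist on all extensions of
        -- `σ`.
        record Base : Set where
          constructor mkBase
          field
            {σ}      : List ℕ
            {g}      : ℕ
            pos      : Pos σ g
            ext      : Ext ℓ h₀ g
            prog-g   : prog (hd g) ≡ n
            lev-g    : lev (hd g) ≡ ℓ
            computed : ∀ k → k < len τ⟨ hd g ⟩ → ∃[ s ] run (nthN ⌜ σ ⌝) s (start e k) ≡ ⟪ at τ⟨ hd g ⟩ k , 0 ⟫
        open Base

        -- The search may return a history whose `κ` is a dead end, but the reset goes back to the
        -- `κ` of the base, so the new position inherits extendibility from the old one.
        advance : (B : Base) → Wit (g B) → Σ[ B′ ∈ Base ] ∃[ m ] ∃[ h ]
                  g B′ ≡ cons m h × cap m ≡ b × lev m ≡ ℓ × Reset m h (g B)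
        advance (mkBase {σ} {g} pos ext pr lv computed) W₀
          with mkWit β {h} {y} {s} a d cy q , t , halts , halts-at ← works g W₀
          with refl ← d
          with ext-h ← Drops⇒Ext (dropN-Drops ℓ h) (At⇒Ext a)
          with γ , refl ← At-++ tP-[] (at-σ pos) a ext-h = go (At-snoc a chk)
          where
          τ κ m : ℕ
          τ = τ⟨ hd g ⟩
          κ = κ⟨ hd g ⟩
          m = item b ℓ n (suc t) κ (cons y τ)
          τ≡ : τ⟨ m ⟩ ≡ cons y τ
          τ≡ = τ-item b ℓ n (suc t) κ (cons y τ)
          t≡ : time m ≡ suc t
          t≡ = time-item b ℓ n (suc t) κ (cons y τ)
          n≡ : prog m ≡ n
          n≡ = prog-item b ℓ n (suc t) κ (cons y τ)
          ℓ≡ : lev m ≡ ℓ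
          ℓ≡ = lev-item b ℓ n (suc t) κ (cons y τ)
          c≡ : cap m ≡ b
          c≡ = cap-item b ℓ n (suc t) κ (cons y τ)
          κ≡ : κ⟨ m ⟩ ≡ κ
          κ≡ = κ-item b ℓ n (suc t) κ (cons y τ)
          reset : Reset m h g
          reset = mkReset (λ z → 0≢suc (trans (sym z) t≡)) (trans n≡ (sym pr)) κ≡ (λ z → cons≢0 (trans (sym τ≡) z))
            (trans (cong tl τ≡) (tl-cons y τ)) (trans (cong tQ τ≡) q)
            (trans (cong₂ (λ t n → run o∅ t (start n (input g))) t≡ n≡)
              (trans halts (cong (λ v → ⟪ ⟪ h , v ⟫ , 0 ⟫) (sym (trans (cong hd τ≡) (hd-cons y τ))))))
            (λ z → halts-at (trans (sym (cong₂ (λ t n → π₂ (run o∅ (pred t) (start n (input g)))) t≡ n≡)) z))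
          h≢ : h ≢ 0 × cap (hd h) ≡ cap (hd g)
          h≢ = Ext-cap ext-h (h≢0 pos)
          chk : Check m h
          chk = mkCheck (λ _ → trans c≡ (sym (trans (proj₂ h≢) (cap-h pos))))
                  (subst₂ _≤_ (sym ℓ≡) (sym c≡) ℓ≤b)
                  (inj₂ (subst (λ ℓ → Reset m h (dropN ℓ h)) (sym ℓ≡) reset))
          go : (∃[ ρ ] length (σ ++ γ) < length ((σ ++ γ) ++ ρ) × At ((σ ++ γ) ++ ρ) 0 (cons m h)) →
               Σ[ B′ ∈ Base ] ∃[ m ] ∃[ h′ ] Base.g B′ ≡ cons m h′ × cap m ≡ b × lev m ≡ ℓ × Reset m h′ g
          go (ρ , _ , a′) =
            mkBase (mkPos a′ (subst (λ κ → Extendible κ) (sym (trans (cong κ⟨_⟩ (hd-cons m h)) κ≡)) (κ-ext pos))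
                      cons≢0 (trans (cong cap (hd-cons m h)) c≡))
                   (Ext-trans ext (snoc m (Ext-weaken (n≤1+n ℓ) ext-h) (≤-reflexive (sym ℓ≡)) chk))
                   (trans (cong prog (hd-cons m h)) n≡) (trans (cong lev (hd-cons m h)) ℓ≡)
                   (λ k lt → subst (λ z → ∃[ s ] run (nthN ⌜ (σ ++ γ) ++ ρ ⌝) s (start e k) ≡ ⟪ at z k , 0 ⟫)
                     (sym τ-head) (computed′ k (subst (λ z → k < len z) τ-head lt))) ,
            m , h , refl , c≡ , ℓ≡ , reset
            where
            τ-head : τ⟨ hd (cons m h) ⟩ ≡ cons y τ
            τ-head = trans (cong τ⟨_⟩ (hd-cons m h)) τ≡
            longer : ∀ α γ′ {s k v} → run (nthN ⌜ α ⌝) s (start e k) ≡ ⟪ v , 0 ⟫ →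
                     run (nthN ⌜ α ++ γ′ ⌝) s (start e k) ≡ ⟪ v , 0 ⟫
            longer α γ′ {s} {k} {v} eq =
              trans (run-mono (nthN-++ α γ′) s (start e k) (trans (cong π₂ eq) (π₂-⟪,⟫ v 0))) eq
            computed′ : ∀ k → k < len (cons y τ) →
                        ∃[ s ] run (nthN ⌜ (σ ++ γ) ++ ρ ⌝) s (start e k) ≡ ⟪ at (cons y τ) k , 0 ⟫
            computed′ k lt with m≤n⇒m<n∨m≡n (≤-pred (subst (k <_) (len-cons y τ) lt))
            ... | inj₂ refl = s , trans (longer (σ ++ γ) ρ {s} {k} cy) (cong (λ v → ⟪ v , 0 ⟫) (sym (at-top y τ)))
            ... | inj₁ lt′ with s′ , eq ← computed k lt′ =
              s′ , trans (longer (σ ++ γ) ρ {s′} {k} (longer σ γ {s′} {k} eq)) (cong (λ v → ⟪ v , 0 ⟫) (sym (at-cons y τ k lt′)))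

        Ext⇒Drops : ∀ {g h} → lev (hd g) ≡ ℓ → g ≢ 0 → Ext (suc ℓ) g h → Drops ℓ h g
        Ext⇒Drops lv g≢0 (snoc m p l _) = skip l (Ext⇒Drops lv g≢0 p)
        Ext⇒Drops {g} lv g≢0 refl = subst (λ z → Drops ℓ z z) (cons-hd-tl g≢0) (stop (≤-reflexive lv))

        -- Stability forces the limit to be `i`. If the functional `i` had a value `f` in Q at `x`,
        -- then `τ` would be an initial segment of `f`, and a prefix of `x` long enough to compute
        -- the next entry would be a witness, since above `g` only items of level greater than `ℓ`
        -- occur.
        stuck⇒beaten : (B : Base) → ¬ Wit (g B) → ∀ x → Ray (suc ℓ) (g B) x → Beaten ψ x
        stuck⇒beaten (mkBase {σ} {g} pos ext pr lv computed) ¬W x ray j f (N , conv) Φx f∈Q =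
          ¬W (wit (ray L))
          where
          τ N₀ : ℕ
          τ = τ⟨ hd g ⟩
          N₀ = len τ
          ox : ℕ → ℕ
          ox q = suc (x q)
          j≡i : j ≡ i
          j≡i with σ′ , h′ , p , ex , l , eq ← ray (N ⊔ length σ₀) =
            trans (sym (conv (length σ′) (≤-trans (m≤m⊔n N _) l)))
              (trans (cong ψ (sym (trans (take-all (length σ′) σ′ ≤-refl) eq)))
                (stable p (Ext-trans ext (Ext-weaken (n≤1+n ℓ) ex)) (length σ′) (≤-trans (m≤n⊔m N _) l) ≤-refl))
          halts : ∀ n → ∃[ s ] run ox s (start e n) ≡ ⟪ f n , 0 ⟫
          halts n = e-halts x (subst (λ j → ⟦ decode j ⟧ (x Vec.∷ Vec.[]) n (f n)) j≡i (Φx n))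
          s L : ℕ
          s = proj₁ (halts N₀)
          L = proj₁ (run-use ox s (start e N₀))
          prefix : ∀ {σ′ h′} → Pos σ′ h′ → Ext (suc ℓ) g h′ → σ′ ≡ x ↾ length σ′ → nthN ⌜ σ ⌝ ⊑ᵒ ox
          prefix {σ′} p ex eq q {v} e with γ , eq′ ← pos-++ pos p ex =
            cong suc (sym (nthN-↾⁻ x (length σ′) q
              (trans (cong (λ σ → nthN ⌜ σ ⌝ q) (sym eq)) (trans (cong (λ σ → nthN ⌜ σ ⌝ q) eq′) (nthN-++ σ γ q e)))))
          τ-prefix : nthN ⌜ σ ⌝ ⊑ᵒ ox → τ ≡ rcode f N₀
          τ-prefix sub = rcode-at τ f λ n lt →
            let s₁ , e₁ = computed n lt
                s₂ , e₂ = halts n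
                z₁ = trans (cong π₂ e₁) (π₂-⟪,⟫ _ 0)
                e₁′ = trans (run-mono sub s₁ (start e n) z₁) e₁
                same = halted-unique ox {s₁} {s₂} {start e n} (trans (cong π₂ e₁′) (π₂-⟪,⟫ _ 0)) (trans (cong π₂ e₂) (π₂-⟪,⟫ _ 0))
            in trans (sym (π₁-⟪,⟫ _ 0)) (trans (cong π₁ (trans (sym e₁′) (trans same e₂))) (π₁-⟪,⟫ _ 0))
          wit : (∃[ σ′ ] ∃[ h′ ] Pos σ′ h′ × Ext (suc ℓ) g h′ × L ≤ length σ′ × σ′ ≡ x ↾ length σ′) → Wit g
          wit (σ′ , h′ , p , ex , l , eq) = mkWit σ′ {s = s} (at-σ p) (Drops⇒dropN (Ext⇒Drops lv (h≢0 pos) ex))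
            (trans (proj₂ (run-use ox s (start e N₀)) (nthN ⌜ σ′ ⌝)
                     λ q lt → trans (cong (λ σ → nthN ⌜ σ ⌝ q) eq) (nthN-↾ x (<-≤-trans lt l)))
                   (proj₂ (halts N₀)))
            (trans (cong (λ τ → tQ (cons (f N₀) τ)) (τ-prefix (prefix p ex eq))) (f∈Q (suc N₀)))

        base₀ : Base
        base₀ with m , σ , p , ex , _ , pr , lv , τ≡0 ← commit n ℓ≤b pos₀ =
          mkBase p ex (trans (cong prog (hd-cons m h₀)) pr) (trans (cong lev (hd-cons m h₀)) lv)
            λ k lt → contradiction (subst (λ z → k < len z) (trans (cong τ⟨_⟩ (hd-cons m h₀)) τ≡0) lt)
                       (λ lt → n≮0 (subst (k <_) len-0 lt))

        stuck-base : Σ[ B ∈ Base ] ¬ Wit (g B)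
        stuck-base with em {Σ[ B ∈ Base ] ¬ Wit (g B)}
        ... | yes p = p
        ... | no ¬p = ⊥-elim (no-infinite-chain (λ j → g (bases j)) b ℓ λ j → proj₂ (advance (bases j) (wit (bases j))))
          where
          wit : ∀ B → Wit (g B)
          wit B with em {Wit (g B)}
          ... | yes w = w
          ... | no ¬w = contradiction (B , ¬w) ¬p
          bases : ℕ → Base
          bases zero    = base₀
          bases (suc j) = proj₁ (advance (bases j) (wit (bases j)))

      restrain : ∃[ σ ] ∃[ h ] Pos σ h × Ext ℓ h₀ h × (∀ x → Ray (suc ℓ) h x → Beaten ψ x)
      restrain = let B , stuck = stuck-base in _ , _ , Base.pos B , Base.ext B , stuck⇒beaten B stuck
        where open WithProgram (proj₁ search-program) (proj₂ search-program)

    module Unstable (R : List Learner) (ℓ : ℕ) (ℓ≤b : ℓ ≤ b) {σ₀ h₀} (pos₀ : Pos σ₀ h₀)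
                    (unstable : ∀ {ψ} → ψ ∈ R → ∀ {σ h} → Pos σ h → Ext ℓ h₀ h → ¬ (∃[ i ] Stable ψ i ℓ σ h)) where

      record Changes (ψ : Learner) (σ σ′ : List ℕ) : Set where
        constructor mkChanges
        field
          m n     : ℕ
          m≥      : length σ ≤ m
          m≤      : m ≤ length σ′
          n≥      : length σ ≤ n
          n≤      : n ≤ length σ′
          differs : ψ (take m σ′) ≢ ψ (take n σ′)

      -- If no extension showed a change of mind, `ψ` would be stable from `σ` on with guess `ψ σ`.
      change : ∀ {ψ} → ψ ∈ R → ∀ {σ h} → Pos σ h → Ext ℓ h₀ h →
               ∃[ σ′ ] ∃[ h′ ] Pos σ′ h′ × Ext ℓ h h′ × Changes ψ σ σ′
      change {ψ} ψ∈R {σ} {h} p ex with em {∃[ σ′ ] ∃[ h′ ] Pos σ′ h′ × Ext ℓ h h′ × Changes ψ σ σ′}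
      ... | yes c = c
      ... | no ¬c = ⊥-elim (unstable ψ∈R p ex (ψ σ , constant))
        where
        constant : Stable ψ (ψ σ) ℓ σ h
        constant {σ′} {h′} p′ ex′ n le le′ with γ , refl ← pos-++ p p′ ex′ with ψ (take n σ′) ≟ ψ σ
        ... | yes eq = eq
        ... | no neq = contradiction
          (σ′ , h′ , p′ , ex′ , mkChanges n (length σ) le le′ ≤-refl (≤-trans le le′)
            λ eq → neq (trans eq (cong ψ (trans (take-++ σ ≤-refl) (take-all (length σ) σ ≤-refl))))) ¬c

      Changes-++ : ∀ {ψ α σ σ′ γ γ′} → σ ≡ α ++ γ → Changes ψ σ σ′ → Changes ψ α (σ′ ++ γ′)
      Changes-++ {ψ} {α} {σ} {σ′} {γ} {γ′} refl (mkChanges m n m≥ m≤ n≥ n≤ neq) =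
        mkChanges m n (≤-trans le m≥) (≤-trans m≤ le′) (≤-trans le n≥) (≤-trans n≤ le′)
        λ eq → neq (trans (cong ψ (sym (take-++ σ′ m≤))) (trans eq (cong ψ (take-++ σ′ n≤))))
        where
        le : length α ≤ length (α ++ γ)
        le = length-≤ {σ = α} refl
        le′ : length σ′ ≤ length (σ′ ++ γ′)
        le′ = length-≤ {σ = σ′} refl

      -- The learners are served one after another, and a change once forced remains visible in
      -- every longer string. The final commit, whose program number 0 is a placeholder, makes the
      -- string grow strictly even when there is no learner to serve.
      round : ∀ R′ → (∀ {ψ} → ψ ∈ R′ → ψ ∈ R) → ∀ {σ h} → Pos σ h → Ext ℓ h₀ h →
              ∃[ σ′ ] ∃[ h′ ] Pos σ′ h′ × Ext ℓ h h′ × length σ < length σ′ × (∀ {ψ} → ψ ∈ R′ → Changes ψ σ σ′)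
      round [] sub p ex with m , σ′ , p′ , ex′ , lt , _ ← commit 0 ℓ≤b p = σ′ , _ , p′ , ex′ , lt , λ ()
      round (ψ ∷ R′) sub {σ} p ex
        with σ₁ , h₁ , p₁ , ex₁ , c₁ ← change (sub (here refl)) p ex
        with σ₂ , h₂ , p₂ , ex₂ , lt , c₂ ← round R′ (sub ∘ there) p₁ (Ext-trans ex ex₁)
        with γ₁ , eq₁ ← pos-++ p p₁ ex₁ with γ₂ , eq₂ ← pos-++ p₁ p₂ ex₂ =
        σ₂ , h₂ , p₂ , Ext-trans ex₁ ex₂ ,
        ≤-<-trans (length-≤ {σ = σ} eq₁) lt ,
        λ { (here refl) → subst (Changes ψ _) (sym eq₂) (Changes-++ (sym (++-identityʳ _)) c₁)
          ; (there ψ∈) → subst (Changes _ _) (++-identityʳ σ₂) (Changes-++ eq₁ (c₂ ψ∈)) }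

      record Stage : Set where
        constructor mkStage
        field
          {σ} : List ℕ
          {h} : ℕ
          pos : Pos σ h
          ext : Ext ℓ h₀ h
      open Stage

      next-stage : (A : Stage) → ∃[ σ′ ] ∃[ h′ ] Pos σ′ h′ × Ext ℓ (h A) h′ × length (σ A) < length σ′ ×
                   (∀ {ψ} → ψ ∈ R → Changes ψ (σ A) σ′)
      next-stage A = round R (λ z → z) (pos A) (ext A)

      stage : ℕ → Stage
      stage zero    = mkStage pos₀ refl
      stage (suc j) = let _ , _ , p , ex , _ = next-stage (stage j) in mkStage p (Ext-trans (ext (stage j)) ex)

      stage-long : ∀ j → j ≤ length (σ (stage j))
      stage-long zero    = z≤n
      stage-long (suc j) = let _ , _ , _ , _ , lt , _ = next-stage (stage j) in ≤-trans (s≤s (stage-long j)) lt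

      ray : ∃[ x ] ∀ j → σ (stage j) ≡ x ↾ length (σ (stage j))
      ray = limit-↾ (λ j → σ (stage j))
        (λ j → let _ , _ , p , ex , _ = next-stage (stage j) in pos-++ (pos (stage j)) p ex) stage-long

      unstable-ray : ∃[ x ] Ray ℓ h₀ x × (∀ {ψ} → ψ ∈ R → Beaten ψ x)
      unstable-ray = x , (λ N → σ (stage N) , h (stage N) , pos (stage N) , ext (stage N) , stage-long N , x-stage N) , beaten
        where
        x : Baire
        x = proj₁ ray
        x-stage : ∀ j → σ (stage j) ≡ x ↾ length (σ (stage j))
        x-stage = proj₂ ray
        beaten : ∀ {ψ} → ψ ∈ R → Beaten ψ x
        beaten {ψ} ψ∈R j f (N , conv) _ _ =
          let mkChanges m n m≥ m≤ n≥ n≤ neq = proj₂ (proj₂ (proj₂ (proj₂ (proj₂ (next-stage (stage N)))))) ψ∈R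
          in neq (trans (value m≥ m≤) (sym (value n≥ n≤)))
          where
          value : ∀ {m} → length (σ (stage N)) ≤ m → m ≤ length (σ (stage (suc N))) → ψ (take m (σ (stage (suc N)))) ≡ j
          value {m} m≥ m≤ = trans (cong ψ (trans (cong (take m) (x-stage (suc N))) (take-↾ x m≤)))
            (conv m (≤-trans (stage-long N) m≥))

    -- Every restrained learner uses up one level, so the levels up to b suffice.
    beat-all : ∀ d R ℓ → length R ≡ d → ℓ + d ≤ b → ∀ {σ h} → Pos σ h →
               ∃[ x ] Ray ℓ h x × (∀ {ψ} → ψ ∈ R → Beaten ψ x)
    beat-all d R ℓ len-R le {σ} {h} p
      with em {∃[ R₁ ] ∃[ ψ ] ∃[ R₂ ] R ≡ R₁ ++ ψ ∷ R₂ × (∃[ σ′ ] ∃[ h′ ] Pos σ′ h′ × Ext ℓ h h′ × (∃[ i ] Stable ψ i ℓ σ′ h′))}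
    ... | no ¬s = Unstable.unstable-ray R ℓ (≤-trans (m≤m+n ℓ d) le) p λ {ψ} ψ∈R p′ ex st →
            let R₁ , R₂ , eq = ∈-∃++ ψ∈R in ¬s (R₁ , ψ , R₂ , eq , _ , _ , p′ , ex , st)
    beat-all zero    R ℓ len-R le p | yes ([] , _ , _ , refl , _) with () ← len-R
    beat-all zero    R ℓ len-R le p | yes (_ ∷ _ , _ , _ , refl , _) with () ← len-R
    beat-all (suc d) R ℓ len-R le p | yes (R₁ , ψ , R₂ , refl , σ′ , h′ , p′ , ex , i , stable) =
      let _ , _ , p″ , ex′ , beaten = Restrain.restrain ψ i ℓ (≤-trans (m≤m+n ℓ (suc d)) le) p′ stable
          x , ray , all = beat-all d (R₁ ++ R₂) (suc ℓ) (suc-injective (trans (sym (length-middle R₁)) len-R))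
                            (subst (_≤ b) (+-suc ℓ d) le) p″
      in x , Ray-weaken (n≤1+n ℓ) (Ext-trans ex ex′) ray , λ ψ∈ → cases (beaten x ray) all (∈-++⁻ R₁ ψ∈)
      where
      cases : ∀ {x χ} → Beaten ψ x → (∀ {χ} → χ ∈ R₁ ++ R₂ → Beaten χ x) → χ ∈ R₁ ⊎ χ ∈ ψ ∷ R₂ → Beaten χ x
      cases beaten all (inj₁ χ∈)          = all (∈-++⁺ˡ χ∈)
      cases beaten all (inj₂ (here refl)) = beaten
      cases beaten all (inj₂ (there χ∈))  = all (∈-++⁺ʳ R₁ χ∈)

    -- The default item 0 of the empty history has an empty `κ`, which is an initial segment of
    -- every point.
    κ-root : ∀ p → κ⟨ hd 0 ⟩ ≡ rcode p (len κ⟨ hd 0 ⟩)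
    κ-root p rewrite hd-0 | κ-0 | len-0 = refl

    Ray-good : ∀ {ℓ h x} → Ray ℓ h x → ∀ n → bad (parse (x ↾ n)) ≡ 0
    Ray-good {x = x} ray n with σ , h′ , p , _ , l , eq ← ray n with γ , eq′ ← ↾-++ x l =
      bad-++ (x ↾ n) γ (trans (cong (bad ∘ parse) (sym (trans eq eq′))) (trans (cong bad (At⇒parse (at-σ p))) (bad-⟪⟫ 0 0 h′)))

    diagonal : ∀ {p} → InP p → ∀ R → length R ≤ b →
               ∃[ x ] (∀ n → bad (parse (x ↾ n)) ≡ 0) × (∀ {ψ} → ψ ∈ R → Beaten ψ x)
    diagonal {p} p∈P R le
      -- The first item fixes the cap at `b`. It is a commit of level 0 whose program number is
      -- again a placeholder.
      with ch , ex ← commit-check {0} 0 p p∈P (κ-root p) (λ z → contradiction refl z) (z≤n {b})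
      with ρ , _ , a ← At-snoc empty ch
      with x , ray , beaten ← beat-all (length R) R 0 refl le
             (mkPos a (subst (λ m → Extendible κ⟨ m ⟩) (sym (hd-cons _ 0)) ex) cons≢0
                      (trans (cong cap (hd-cons _ 0)) (cap-item b 0 0 0 _ 0))) = x , Ray-good ray , beaten

-- Trees of lists as tests on reversed codes

list : ℕ → List ℕ
list z = proj₁ (code-surjective z)

⌜list⌝ : ∀ z → ⌜ list z ⌝ ≡ z
⌜list⌝ z = proj₂ (code-surjective z)

foldl-code : ∀ acc σ → foldl (λ z x → cons x z) ⌜ acc ⌝ σ ≡ ⌜ foldl (λ τ x → x ∷ τ) acc σ ⌝
foldl-code acc []      = refl
foldl-code acc (x ∷ σ) =
  trans (cong (λ z → foldl (λ z x → cons x z) z σ) (sym (code-∷ x acc))) (foldl-code (x ∷ acc) σ)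

revN-reverse : ∀ σ → revN ⌜ σ ⌝ ≡ ⌜ reverse σ ⌝
revN-reverse σ = trans (revN-code σ) (foldl-code [] σ)

rcode-reverse : ∀ g n → rcode g n ≡ ⌜ reverse (g ↾ n) ⌝
rcode-reverse g zero    = refl
rcode-reverse g (suc n) = begin
  cons (g n) (rcode g n)            ≡⟨ cong (cons (g n)) (rcode-reverse g n) ⟩
  cons (g n) ⌜ reverse (g ↾ n) ⌝    ≡⟨ sym (code-∷ (g n) (reverse (g ↾ n))) ⟩
  ⌜ g n ∷ reverse (g ↾ n) ⌝         ≡⟨ cong ⌜_⌝ (sym (reverse-++ (g ↾ n) (g n ∷ []))) ⟩
  ⌜ reverse ((g ↾ n) ∷ʳ g n) ⌝      ≡⟨ cong (⌜_⌝ ∘ reverse) (applyUpTo-∷ʳ g n) ⟩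
  ⌜ reverse (g ↾ suc n) ⌝           ∎
  where open ≡-Reasoning

module Membership (T : ComputableTree) where
  open ComputableTree T

  char : List ℕ → ℕ
  char σ = if mem σ then 1 else 0

  charN : ℕ → ℕ
  charN z = char (list z)

  charᶜ : Comp Vec.[] charN
  charᶜ = proj₁ computable by λ z →
    subst (λ n → ⟦ proj₁ computable ⟧ Vec.[] n (charN z)) (⌜list⌝ z) (proj₂ computable (list z))

  -- The lists `list ⌜ σ ⌝` and `σ` have the same code, and the program sees only the code, so
  -- determinism gives equal values.
  charN-code : ∀ σ → charN ⌜ σ ⌝ ≡ char σ
  charN-code σ = deterministic (proj₁ computable) (graph charᶜ ⌜ σ ⌝) (proj₂ computable σ)

  -- The tree is given on forward codes while the construction prepends new entries, hence the
  -- reversal; the subtraction makes 0 mean membership.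
  inT : ℕ → ℕ
  inT z = 1 ∸ charN (revN z)

  inTᶜ : Comp Vec.[] inT
  inTᶜ = constᶜ 1 ∸ᶜ charᶜ ∙ revNᶜ

  inT-code : ∀ σ → inT ⌜ σ ⌝ ≡ 1 ∸ char (reverse σ)
  inT-code σ = cong (1 ∸_) (trans (cong charN (revN-reverse σ)) (charN-code (reverse σ)))

  char⇒ : ∀ σ → 1 ∸ char σ ≡ 0 → mem σ ≡ true
  char⇒ σ e with mem σ
  ... | true  = refl

  char⇐ : ∀ σ → mem σ ≡ true → 1 ∸ char σ ≡ 0
  char⇐ σ e rewrite e = refl

  inT-tail : ∀ {i η} → inT (cons i η) ≡ 0 → inT η ≡ 0
  inT-tail {i} {η} e with σ , refl ← code-surjective η =
    trans (inT-code σ) (char⇐ _ (prefix-closed (reverse σ) (i ∷ [])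
      (subst (λ τ → mem τ ≡ true) (unfold-reverse i σ)
        (char⇒ _ (trans (sym (inT-code (i ∷ σ))) (trans (cong inT (code-∷ i σ)) e))))))

  inT-rcode : ∀ g n → inT (rcode g n) ≡ 1 ∸ char (g ↾ n)
  inT-rcode g n = trans (cong inT (rcode-reverse g n))
    (trans (inT-code _) (cong (λ σ → 1 ∸ char σ) (reverse-involutive (g ↾ n))))

  Path⇒ : ∀ {g} → Path g → ∀ n → inT (rcode g n) ≡ 0
  Path⇒ {g} path n = trans (inT-rcode g n) (char⇐ _ (path n))

  Path⇐ : ∀ {g} → (∀ n → inT (rcode g n) ≡ 0) → Path g
  Path⇐ {g} z n = char⇒ _ (trans (sym (inT-rcode g n)) (z n))

excess : ℕ → ℕ → ℕ
excess a x = a + (x ∸ 1)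

opaque
  bits : ℕ → ℕ
  bits = foldN excess 0

  bitsᶜ : Comp Vec.[] bits
  bitsᶜ = foldNᶜ (curried (π₁ᶜ +ᶜ (π₂ᶜ ∸ᶜ constᶜ 1))) (constᶜ 0) idᶜ

  bits-0 : bits 0 ≡ 0
  bits-0 = foldN-code excess 0 []

  bits-cons : ∀ i η → bits (cons i η) ≡ (i ∸ 1) + bits η
  bits-cons i η with σ , refl ← code-surjective η =
    trans (cong (foldN excess 0) (sym (code-∷ i σ)))
      (trans (foldN-code excess 0 (i ∷ σ)) (trans (accumulate (i ∸ 1) σ) (cong ((i ∸ 1) +_) (sym (foldN-code excess 0 σ)))))
    where
    accumulate : ∀ a σ → foldl excess a σ ≡ a + foldl excess 0 σ
    accumulate a []      = sym (+-identityʳ a)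
    accumulate a (x ∷ σ) = trans (accumulate (a + (x ∸ 1)) σ)
      (trans (+-assoc a (x ∸ 1) _) (cong (a +_) (sym (accumulate (x ∸ 1) σ))))

oracle-cong : ∀ {k} (c : Code k) {gs hs : Vec Baire k} → (∀ i → lookup gs i ≗ lookup hs i) →
              ∀ {x y} → ⟦ c ⟧ gs x y → ⟦ c ⟧ hs x y
oracle-cong zer eq p = p
oracle-cong suc eq p = p
oracle-cong fst eq p = p
oracle-cong snd eq p = p
oracle-cong (oracle i) eq p = trans p (eq i _)
oracle-cong (pair c d) eq (a , b , p , q , e) = a , b , oracle-cong c eq p , oracle-cong d eq q , e
oracle-cong (comp c d) eq (z , p , q) = z , oracle-cong d eq p , oracle-cong c eq q
oracle-cong (prec c d) {gs} {hs} eq {x} = go (proj₁ (unpair x)) (proj₂ (unpair x))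
  where
  go : ∀ a n {y} → PrecGraph c d gs a n y → PrecGraph c d hs a n y
  go a zero    p           = oracle-cong c eq p
  go a (suc n) (z , p , q) = z , go a n p , oracle-cong d eq q
oracle-cong (min c) eq (p , q) = oracle-cong c eq p , λ m m<y → let z , r = q m m<y in z , oracle-cong c eq r

Comp⇒≤ᵀ : ∀ {q g} → Comp (g Vec.∷ Vec.[]) q → q ≤ᵀ g
Comp⇒≤ᵀ {q} {g} (c by C) = encode c , λ n → subst (λ c → ⟦ c ⟧ (g Vec.∷ Vec.[]) n (q n)) (sym (decode-encode c)) (C n)

-- Muchnik reductions as partial functions

module Pointwise (em : ExcludedMiddle 0ℓ) where

  least-index : (A : ℕ → Set) → ∃ A → ∃[ e ] A e × (∀ j → j < e → ¬ A j)
  least-index A (n , a) =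
    let e , z , below = least p (char-yes a) in e , char⁻ e z , λ j lt a → below j lt (char-yes a)
    where
    char : ∀ {X : Set} → Dec X → ℕ
    char (yes _) = 0
    char (no _)  = 1
    p : ℕ → ℕ
    p e = char (em {A e})
    char-yes : ∀ {e} → A e → p e ≡ 0
    char-yes {e} a with em {A e}
    ... | yes _ = refl
    ... | no ¬a = contradiction a ¬a
    char⁻ : ∀ e → p e ≡ 0 → A e
    char⁻ e z with em {A e}
    ... | yes a = a

  -- A partial function must give the same value at pointwise equal arguments, whatever the domain
  -- proofs. Choosing the least index that yields a member of `A` achieves this: pointwise equal
  -- oracles have the same least index, and an index determines its value.
  muchnik : ∀ {A B : Pred Baire 0ℓ} → (∀ g → g ∈ᴾ B → ∃[ q ] q ∈ᴾ A × q ≤ᵀ g) → A ≤^ω-1 B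
  muchnik {A} {B} red = Γ , (λ g d → index g d , proj₂ (proj₂ (chosen g d))) , (λ {g} → red g) ,
                        λ g p → proj₁ (proj₂ (chosen g (red g p)))
    where
    At-index : Baire → ℕ → Set
    At-index g e = ∃[ q ] q ∈ᴾ A × Φ[ e ] g ≃ q
    Dom : Baire → Set
    Dom g = ∃[ q ] q ∈ᴾ A × q ≤ᵀ g
    least-Φ : ∀ g → Dom g → ∃[ e ] At-index g e × (∀ j → j < e → ¬ At-index g j)
    least-Φ g (q , q∈A , e , Φ) = least-index (At-index g) (e , q , q∈A , Φ)
    index : ∀ g → Dom g → ℕ
    index g d = proj₁ (least-Φ g d)
    chosen : ∀ g (d : Dom g) → At-index g (index g d)
    chosen g d = proj₁ (proj₂ (least-Φ g d))
    Φ-cong : ∀ {g h e q} → g ≗ h → Φ[ e ] g ≃ q → Φ[ e ] h ≃ q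
    Φ-cong {e = e} eq Φ n = oracle-cong (decode e) (λ { Fin.zero → eq }) (Φ n)
    index-≤ : ∀ {g h} → g ≗ h → (d : Dom g) (d′ : Dom h) → index g d ≤ index h d′
    index-≤ {g} {h} eq d d′ = ≮⇒≥ λ lt → let q , q∈A , Φ = chosen h d′ in
      proj₂ (proj₂ (least-Φ g d)) _ lt (q , q∈A , Φ-cong {e = index h d′} (sym ∘ eq) Φ)
    Γ : PartialFunction
    Γ = record
      { dom        = Dom
      ; apply      = λ g d → proj₁ (chosen g d)
      ; dom-resp   = λ { eq (q , q∈A , e , Φ) → q , q∈A , e , Φ-cong {e = e} eq Φ }
      ; apply-cong = λ {g} {h} eq d d′ n →
          let same = ≤-antisym (index-≤ eq d d′) (index-≤ (sym ∘ eq) d′ d) in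
          deterministic (decode (index h d′))
            (subst (λ e → ⟦ decode e ⟧ (h Vec.∷ Vec.[]) n (proj₁ (chosen g d) n)) same
              (Φ-cong {e = index g d} eq (proj₂ (proj₂ (chosen g d))) n))
            (proj₂ (proj₂ (chosen h d′)) n)
      }

-- Applying the construction to the given sets

module Result (em : ExcludedMiddle 0ℓ) (P Q : Pred Baire 0ℓ)
              (P⊆2^ℕ : P ⊆ 2^ℕ) (P-Π⁰₁ : IsΠ⁰₁ P) (P-special : Special P)
              (Q-Π⁰₁ : IsΠ⁰₁ Q) (Q-special : Special Q) where

  module TP = Membership (proj₁ P-Π⁰₁)
  module TQ = Membership (proj₁ Q-Π⁰₁)

  -- The given tree for P may contain strings that are not binary. Adding `bits` prunes them, so
  -- that exits are binary strings and the points of `P̂` lie in Cantor space.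
  tP tQ : ℕ → ℕ
  tP z = TP.inT z + bits z
  tQ = TQ.inT

  tPᶜ : Comp Vec.[] tP
  tPᶜ = TP.inTᶜ +ᶜ bitsᶜ

  open Construction tP tQ tPᶜ TQ.inTᶜ

  tP-tail : ∀ {i η} → tP (cons i η) ≡ 0 → tP η ≡ 0
  tP-tail {i} {η} e with e₁ , e₂ ← sum≡0 {TP.inT (cons i η)} e =
    sum≡0⁻ (TP.inT-tail e₁) (proj₂ (sum≡0 {i ∸ 1} (trans (sym (bits-cons i η)) e₂)))

  tP-bits : ∀ {i η} → tP (cons i η) ≡ 0 → i ≤ 1
  tP-bits {i} {η} e = m∸n≡0⇒m≤n (proj₁ (sum≡0 (trans (sym (bits-cons i η)) (proj₂ (sum≡0 {TP.inT (cons i η)} e)))))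

  P⇒ : ∀ {p} → p ∈ᴾ P → InP p
  P⇒ {p} p∈P n = sum≡0⁻ (TP.Path⇒ (Equivalence.to (proj₂ P-Π⁰₁ p) p∈P) n) (binary n)
    where
    binary : ∀ n → bits (rcode p n) ≡ 0
    binary zero    = bits-0
    binary (suc n) = trans (bits-cons (p n) (rcode p n)) (sum≡0⁻ (m≤n⇒m∸n≡0 (≤-pred (P⊆2^ℕ p∈P n))) (binary n))

  P⇐ : ∀ {p} → InP p → p ∈ᴾ P
  P⇐ {p} z = Equivalence.from (proj₂ P-Π⁰₁ p) (TP.Path⇐ λ n → proj₁ (sum≡0 (z n)))

  member : Baire
  member = proj₁ (proj₁ P-special)

  member∈P : InP member
  member∈P = P⇒ (proj₂ (proj₁ P-special))

  Q-noncomputable : ∀ y → InQ y → ¬ Comp Vec.[] y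
  Q-noncomputable y y∈Q (c by C) =
    proj₂ Q-special y (Equivalence.from (proj₂ Q-Π⁰₁ y) (TQ.Path⇐ y∈Q)) (c , C)

  -- If all minimal non-members were below N, every extension of member ↾ N would remain in the tree.
  exits : ∀ N → ∃[ z ] N ≤ z × exit z ≡ 0
  exits N with em {∃[ z ] N ≤ z × exit z ≡ 0}
  ... | yes p = p
  ... | no ¬p = contradiction (code yᶜ , graph yᶜ) (proj₂ P-special y (P⇐ y∈P))
    where
    y : Baire
    y n = pred (nthN ⌜ member ↾ N ⌝ n)
    yᶜ : Comp Vec.[] y
    yᶜ = predᶜ ∙ nthNᶜ (constᶜ _) idᶜ
    y≤1 : ∀ n → y n ≤ 1
    y≤1 n with nthN ⌜ member ↾ N ⌝ n in eq
    ... | zero  = z≤n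
    ... | suc v = subst (_≤ 1) (sym (nthN-↾⁻ member N n eq)) (≤-pred (P⊆2^ℕ (proj₂ (proj₁ P-special)) n))
    y-agrees : ∀ {n} → n ≤ N → rcode y n ≡ rcode member n
    y-agrees {zero}  le = refl
    y-agrees {suc n} le = cong₂ cons (cong pred (nthN-↾ member le)) (y-agrees (<⇒≤ le))
    n≤rcode : ∀ n → n ≤ rcode y n
    n≤rcode zero    = z≤n
    n≤rcode (suc n) = ≤-trans (s≤s (n≤rcode n)) (z<cons (y n) (rcode y n))
    beyond : ∀ d → tP (rcode y (d + N)) ≡ 0
    beyond zero    = trans (cong tP (y-agrees ≤-refl)) (member∈P N)
    beyond (suc d) with tP (rcode y (suc d + N)) ≟ 0
    ... | yes e = e
    ... | no ne = contradiction
      (rcode y (suc d + N) , ≤-trans (m≤n+m N (suc d)) (n≤rcode (suc d + N)) , exit⇐ (y≤1 (d + N)) (beyond d) ne) ¬p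
    y∈P : InP y
    y∈P n = rcode-closed tP tP-tail y (m≤m+n n N) (beyond n)

  P̂ : Pred Baire 0ℓ
  P̂ g = ∀ n → bad (parse (g ↾ n)) ≡ 0

  parse-suc : ∀ g n → parse (g ↾ suc n) ≡ δ (parse (g ↾ n)) (g n)
  parse-suc g n = trans (cong parse (sym (applyUpTo-∷ʳ g n))) (parse-∷ʳ (g ↾ n) (g n))

  P̂⊆2^ℕ : P̂ ⊆ 2^ℕ
  P̂⊆2^ℕ {g} g∈P̂ n = s≤s (δ-bits (parse (g ↾ n)) (g n) (trans (cong bad (sym (parse-suc g n))) (g∈P̂ (suc n))))

  is-zero : ℕ → Bool
  is-zero zero    = true
  is-zero (suc _) = false

  P̂-Π⁰₁ : IsΠ⁰₁ P̂
  P̂-Π⁰₁ = record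
    { mem           = λ σ → is-zero (bad (parse σ))
    ; computable    = code memᶜ , λ σ → subst (⟦ code memᶜ ⟧ Vec.[] ⌜ σ ⌝)
                        (trans (cong (λ s → ifz (bad s) 1 0) (parse-code σ)) (ifz-if (bad (parse σ)))) (graph memᶜ ⌜ σ ⌝)
    ; prefix-closed = λ σ τ e → is-zero⇐ (bad-++ σ τ (is-zero⇒ e))
    } , λ g → mk⇔ (λ g∈P̂ n → is-zero⇐ (g∈P̂ n)) (λ path n → is-zero⇒ (path n))
    where
    memᶜ : Comp Vec.[] (λ z → ifz (bad (foldN δ s₀ z)) 1 0)
    memᶜ = ifzᶜ (π₁ᶜ ∙ foldNᶜ δᶜ (constᶜ s₀) idᶜ) (constᶜ 1) (constᶜ 0)
    ifz-if : ∀ n → ifz n 1 0 ≡ (if is-zero n then 1 else 0)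
    ifz-if zero    = refl
    ifz-if (suc _) = refl
    is-zero⇒ : ∀ {n} → is-zero n ≡ true → n ≡ 0
    is-zero⇒ {zero} _ = refl
    is-zero⇐ : ∀ {n} → n ≡ 0 → is-zero n ≡ true
    is-zero⇐ refl = refl

  P⊆P̂ : P ⊆ P̂
  P⊆P̂ {g} g∈P n = trans (cong bad (At⇒parse (no-items n))) (bad-⟪⟫ 0 (rcode g n) 0)
    where
    no-items : ∀ n → At (g ↾ n) (rcode g n) 0
    no-items zero    = empty
    no-items (suc n) = subst (λ σ → At σ (rcode g (suc n)) 0) (applyUpTo-∷ʳ g n)
      (stay (no-items n) (≤-pred (P⊆2^ℕ g∈P n)) (P⇒ g∈P (suc n)))

  open Pointwise em

  P̂≤P : P̂ ≤^ω-1 P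
  P̂≤P = muchnik {P̂} {P} λ g g∈P → g , P⊆P̂ g∈P , Comp⇒≤ᵀ (oracle Fin.zero by λ _ → refl)

  P≤P̂ : P ≤^ω-1 P̂
  P≤P̂ = muchnik {P} {P̂} λ g g∈P̂ →
    let q , q∈P , qᶜ = Chains.Member.computes TQ.inT-tail Q-noncomputable em (member∈P 0) tP-tail g g∈P̂
    in q , P⇐ q∈P , Comp⇒≤ᵀ qᶜ

  -- Indices of functions that are not total contribute nothing, so the list may be shorter than
  -- `b`. An index determines its learner only pointwise, hence the cover is up to pointwise
  -- equality.
  learners : ∀ b → ∃[ R ] length R ≤ b ×
             (∀ e ψ → e < b → Ψ[ e ]≃ ψ → ∃[ χ ] χ ∈ R × (∀ σ → χ σ ≡ ψ σ))
  learners zero    = [] , z≤n , λ _ _ ()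
  learners (suc b) with R , le , covers ← learners b with em {∃[ ψ ] Ψ[ b ]≃ ψ}
  ... | no none = R , m≤n⇒m≤1+n le , covers′
    where
    covers′ : ∀ e ψ → e < suc b → Ψ[ e ]≃ ψ → ∃[ χ ] χ ∈ R × (∀ σ → χ σ ≡ ψ σ)
    covers′ e ψ (s≤s e≤b) Ψ with m≤n⇒m<n∨m≡n e≤b
    ... | inj₁ lt   = covers e ψ lt Ψ
    ... | inj₂ refl = contradiction (ψ , Ψ) none
  ... | yes (χ , Χ) = χ ∷ R , s≤s le , covers′
    where
    covers′ : ∀ e ψ → e < suc b → Ψ[ e ]≃ ψ → ∃[ χ′ ] χ′ ∈ χ ∷ R × (∀ σ → χ′ σ ≡ ψ σ)
    covers′ e ψ (s≤s e≤b) Ψ with m≤n⇒m<n∨m≡n e≤b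
    ... | inj₁ lt   = let χ′ , χ′∈ , eq = covers e ψ lt Ψ in χ′ , there χ′∈ , eq
    ... | inj₂ refl = χ , here refl , λ σ → deterministic (decode b) (Χ σ) (Ψ σ)

  Q≰P̂ : ¬ (Q ≤^<ω-ω P̂)
  Q≰P̂ (Γ , (b , identified) , P̂⊆dom , into-Q) =
    let R , le , covers = learners b
        x , x∈P̂ , beaten = Diagonal.diagonal em (member∈P 0) tP-tail tP-bits exits TQ.inT-tail Q-noncomputable b
                             member∈P R le
        e , e<b , ψ , Ψ , i , (N , conv) , Φ = identified x (P̂⊆dom x∈P̂)
        χ , χ∈R , eq = covers e ψ e<b Ψ
    in beaten {χ} χ∈R i (apply Γ x (P̂⊆dom x∈P̂)) (N , λ n N≤n → trans (eq (x ↾ n)) (conv n N≤n)) Φ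
         (TQ.Path⇒ (Equivalence.to (proj₂ Q-Π⁰₁ _) (into-Q x x∈P̂)))

theorem63 : ExcludedMiddle 0ℓ →
    (P Q : Pred Baire 0ℓ) →
    P ⊆ 2^ℕ → IsΠ⁰₁ P → Special P →
    Q ⊆ 2^ℕ → IsΠ⁰₁ Q → Special Q →
    Σ[ P̂ ∈ Pred Baire 0ℓ ]
    P̂ ⊆ 2^ℕ × IsΠ⁰₁ P̂ × ¬ (Q ≤^<ω-ω P̂) × P̂ ≡^ω-1 P
theorem63 em P Q P⊆2^ℕ P-Π⁰₁ P-special _ Q-Π⁰₁ Q-special =
  P̂ , P̂⊆2^ℕ , P̂-Π⁰₁ , Q≰P̂ , P̂≤P , P≤P̂
  where open Result em P Q P⊆2^ℕ P-Π⁰₁ P-special Q-Π⁰₁ Q-special
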